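{- $\mathcal{I}_{\Delta}\subset\mathcal{I}_{\mathrm{CF}}$; that is, the ideal of $(\mathcal{A}^0,ш)$ generated by the duality relations is contained in the module of confluence relations.
   Context: Let $\mathcal{A}_z=\mathbb{Z}\langle e_0,e_1,e_z\rangle$ be the free non-commutative (associative, unital) ring on formal symbols $e_0,e_1,e_z$, and $\mathcal{A}=\mathbb{Z}\langle e_0,e_1\rangle\subset\mathcal{A}_z$. Put $\mathcal{A}_z^0=\mathbb{Z}\oplus\mathbb{Z}e_z\oplus\bigoplus_{a\in\{1,z\},\,b\in\{0,z\}}e_a\mathcal{A}_ze_b$, $\mathcal{A}^0=\mathbb{Z}\oplus e_1\mathcal{A}e_0$, $\mathcal{A}_z^{ -2}=\mathbb{Z}\oplus e_1\mathcal{A}_ze_0\oplus e_z\mathcal{A}_ze_0$, and $\mathcal{A}_z^{ -1}=\mathcal{A}_z^{ -2}\,\mathbb{Z}\langle e_z\rangle$ (the span of concatenations $ue_z^k$, $u\in\mathcal{A}_z^{ -2}$, $k\ge0$). Tensor products are over $\mathbb{Z}$. The shuffle product $ш$ on $\mathcal{A}_z$ is the bilinear product with $w\,ш\,1=1\,ш\,w=w$ and $e_au\,ш\,e_bv=e_a(u\,ш\,e_bv)+e_b(e_au\,ш\,v)$; $\mathcal{A}^0$ and $\mathcal{A}_z^0$ are commutative rings under $ш$. Let $\tau_\infty$ be the anti-automorphism of the ring $\mathcal{A}$ with $\tau_\infty(e_0)=-e_1$, $\tau_\infty(e_1)=-e_0$, and set $\Delta(w)=w-\tau_\infty(w)$.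 $\mathcal{I}_\Delta$ is the ideal of $(\mathcal{A}^0,ш)$ generated by $\{\Delta(w)\mid w\in\mathcal{A}^0\}$. For $\alpha,\beta\in\{0,1,z\}$ define the linear operator $\partial_{\alpha,\beta}$ on $\mathcal{A}_z$ by $\partial_{\alpha,\beta}(e_{a_1}\cdots e_{a_n})=\sum_{i=1}^n\left(\delta_{\{a_i,a_{i+1}\},\{\alpha,\beta\}}-\delta_{\{a_{i-1},a_i\},\{\alpha,\beta\}}\right)e_{a_1}\cdots\widehat{e_{a_i}}\cdots e_{a_n}$, where $a_0=0$, $a_{n+1}=1$, the hat denotes omission, and $\delta_{S,T}=1$ if $S=T$ as sets and $0$ otherwise. $\mathrm{Const}:\mathcal{A}_z\to\mathcal{A}$ is the linear map sending a word to itself if it contains no letter $e_z$, and to $0$ otherwise. The set of standard relations is $\mathcal{I}_{\mathrm{ST}}=\{w\in\mathcal{A}_z^0\mid \mathrm{Const}(\partial_{z,\alpha_1}\cdots\partial_{z,\alpha_r}w)=0\text{ for all }r\ge0\text{ and }\alpha_1,\dots,\alpha_r\in\{0,1\}\}$. The duality map $\tau_z$ is the anti-automorphism of the ring $\mathcal{A}_z$ with $\tau_z(e_0)=e_z-e_1$, $\tau_z(e_1)=e_z-e_0$, $\tau_z(e_z)=e_z$. The map $u\otimes v\mapsto u\,ш\,v$ is an isomorphism $\mathcal{A}_z^{ -2}\otimes(\mathcal{A}_z^0\cap\mathbb{Z}\langle e_1,e_z\rangle)\to\mathcal{A}_z^0$; let $\mathrm{reg}_{\{z,1\}}$ be its inverse.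 It is also an isomorphism $\mathcal{A}_z^{ -2}\otimes\mathbb{Z}\langle e_z\rangle\to\mathcal{A}_z^{ -1}$; let $\mathrm{reg}_{\{z\}}$ be its inverse. Define $N:\mathcal{A}_z^0\to\mathcal{A}_z^{ -1}$ as the composition of $\mathrm{reg}_{\{z,1\}}$, then $\mathrm{id}\otimes\tau_z$ (which lands in $\mathcal{A}_z^{ -2}\otimes(\mathcal{A}_z^0\cap\mathbb{Z}\langle e_0,e_z\rangle)$), then $u\otimes v\mapsto u\,ш\,v$. Define $\lambda:\mathcal{A}_z^0\to\mathcal{A}^0$ as the composition of $N$, then $\mathrm{reg}_{\{z\}}$, then $\mathrm{id}\otimes\mathrm{const}:\mathcal{A}_z^{ -2}\otimes\mathbb{Z}\langle e_z\rangle\to\mathcal{A}_z^{ -2}$ (where $\mathrm{const}$ takes the constant term: $1\mapsto1$, $e_z^k\mapsto0$ for $k\ge1$), then $\lambda':\mathcal{A}_z^{ -2}\to\mathcal{A}^0$, the restriction of the ring homomorphism replacing $e_z$ by $e_1$. The module of confluence relations is $\mathcal{I}_{\mathrm{CF}}=\{\lambda(w)\mid w\in\mathcal{I}_{\mathrm{ST}}\}\subset\mathcal{A}^0$. -}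

module Defs where

open import Data.Bool using (if_then_else_)
open import Data.Integer using (ℤ; 0ℤ; 1ℤ; -1ℤ) renaming (_+_ to _+ℤ_; _*_ to _*ℤ_; _-_ to _-ℤ_)
open import Data.List using (List; []; _∷_; [_]; _++_; map; foldr)
open import Data.List.Membership.Propositional using (_∈_)
open import Data.List.Properties using (≡-dec)
open import Data.List.Relation.Unary.All using (All)
open import Data.List.Relation.Unary.Any using (any?)
open import Data.Product using (∃; _×_; _,_; map₁; map₂)
open import Level using (0ℓ)
open import Relation.Binary.Definitions using (DecidableEquality)
open import Relation.Binary.PropositionalEquality using (_≡_; _≢_; refl)
open import Relation.Nullary using (yes; no; does)
open import Relation.Nullary.Decidable using (_×-dec_; _⊎-dec_)
open import Relation.Unary using (Pred; _∩_; _∪_)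

infix  4 _≈_
infixl 6 _⊕_ _⊖_
infixr 7 _•_ _◃_
infixl 7 _·_ _ш_ _шʷ_
infixr 6 _⊗_

data Letter : Set where
  e0 e1 ez : Letter

_≟ˡ_ : DecidableEquality Letter
e0 ≟ˡ e0 = yes refl
e0 ≟ˡ e1 = no λ ()
e0 ≟ˡ ez = no λ ()
e1 ≟ˡ e0 = no λ ()
e1 ≟ˡ e1 = yes refl
e1 ≟ˡ ez = no λ ()
ez ≟ˡ e0 = no λ ()
ez ≟ˡ e1 = no λ ()
ez ≟ˡ ez = yes refl

Word : Set
Word = List Letter

_≟ʷ_ : DecidableEquality Word
_≟ʷ_ = ≡-dec _≟ˡ_

-- Elements of ℤ⟨e₀,e₁,e_z⟩ are formal sums Σ cᵢ wᵢ, in which words may repeat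
-- and coefficients may vanish; _≈_ (equality of all coefficients) is the
-- equality of the ring.
Poly : Set
Poly = List (ℤ × Word)

coeff : Poly → Word → ℤ
coeff []            w = 0ℤ
coeff ((c , v) ∷ p) w = (if does (v ≟ʷ w) then c else 0ℤ) +ℤ coeff p w

_≈_ : Poly → Poly → Set
p ≈ q = ∀ w → coeff p w ≡ coeff q w

𝟘 : Poly
𝟘 = []

word : Word → Poly
word w = [ 1ℤ , w ]

letter : Letter → Poly
letter a = word [ a ]

_⊕_ : Poly → Poly → Poly
_⊕_ = _++_

_•_ : ℤ → Poly → Poly
c • p = map (map₁ (c *ℤ_)) p

_⊖_ : Poly → Poly → Poly
p ⊖ q = p ⊕ -1ℤ • q

_◃_ : Letter → Poly → Poly
a ◃ p = map (map₂ (a ∷_)) p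

linear : (Word → Poly) → Poly → Poly
linear f []            = 𝟘
linear f ((c , w) ∷ p) = c • f w ⊕ linear f p

bilinear : (Word → Word → Poly) → Poly → Poly → Poly
bilinear f p q = linear (λ u → linear (f u) q) p

_·_ : Poly → Poly → Poly
_·_ = bilinear λ u v → word (u ++ v)

_шʷ_ : Word → Word → Poly
[]          шʷ v           = word v
u@(_ ∷ _)   шʷ []          = word u
u@(a ∷ u′)  шʷ v@(b ∷ v′)  = a ◃ (u′ шʷ v) ⊕ b ◃ (u шʷ v′)

_ш_ : Poly → Poly → Poly
_ш_ = bilinear _шʷ_

ringHom : (Letter → Poly) → Poly → Poly
ringHom f = linear (foldr (λ a p → f a · p) (word []))

antiHom : (Letter → Poly) → Poly → Poly
antiHom f = linear (foldr (λ a p → p · f a) (word []))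

Span : Pred Word 0ℓ → Pred Poly 0ℓ
Span P p = ∀ w → coeff p w ≢ 0ℤ → P w

Over : List Letter → Pred Word 0ℓ
Over S = All (_∈ S)

-- The words spanning ℤ ⊕ ⨁_{a ∈ S, b ∈ T} e_a 𝒜_z e_b.
data Bounded (S T : List Letter) : Pred Word 0ℓ where
  empty : Bounded S T []
  ends  : ∀ {a b} → a ∈ S → (u : Word) → b ∈ T → Bounded S T (a ∷ u ++ [ b ])

ℤ⟨_⟩ : List Letter → Pred Poly 0ℓ
ℤ⟨ S ⟩ = Span (Over S)

𝒜z⁰ : Pred Poly 0ℓ
𝒜z⁰ = Span ((_≡ [ ez ]) ∪ Bounded (e1 ∷ ez ∷ []) (e0 ∷ ez ∷ []))

𝒜⁰ : Pred Poly 0ℓ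
𝒜⁰ = Span (Bounded [ e1 ] [ e0 ] ∩ Over (e0 ∷ e1 ∷ []))

𝒜z⁻² : Pred Poly 0ℓ
𝒜z⁻² = Span (Bounded (e1 ∷ ez ∷ []) [ e0 ])

-- Only used on ℤ⟨e₀,e₁⟩; the value at e_z is immaterial.
τ∞ : Poly → Poly
τ∞ = antiHom λ where
  e0 → -1ℤ • letter e1
  e1 → -1ℤ • letter e0
  ez → letter ez

Δ : Poly → Poly
Δ w = w ⊖ τ∞ w

-- The ideal of (𝒜⁰, ш) generated by G.  One-sided absorption suffices as ш is
-- commutative.
data Ideal (G : Pred Poly 0ℓ) : Pred Poly 0ℓ where
  generator : ∀ {p} → G p → Ideal G p
  zero      : Ideal G 𝟘
  plus      : ∀ {p q} → Ideal G p → Ideal G q → Ideal G (p ⊕ q)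
  absorb    : ∀ {a p} → 𝒜⁰ a → Ideal G p → Ideal G (a ш p)
  resp      : ∀ {p q} → p ≈ q → Ideal G p → Ideal G q

𝓘Δ : Pred Poly 0ℓ
𝓘Δ = Ideal λ p → ∃ λ w → 𝒜⁰ w × p ≈ Δ w

-- The indicator of {a , b} = {α , β} as sets.
δ : (a b α β : Letter) → ℤ
δ a b α β =
  if does ((a ≟ˡ α ×-dec b ≟ˡ β) ⊎-dec (a ≟ˡ β ×-dec b ≟ˡ α)) then 1ℤ else 0ℤ

-- The letter following aᵢ, with the convention a_{n+1} = 1.
next : Word → Letter
next []      = e1
next (a ∷ _) = a

-- ∂ʷ α β p w is the sum over the letters of w of the terms defining ∂_{α,β},
-- where p is the letter preceding w.
∂ʷ : (α β p : Letter) → Word → Poly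
∂ʷ α β p []      = 𝟘
∂ʷ α β p (a ∷ w) =
  (δ a (next w) α β -ℤ δ p a α β) • word w ⊕ a ◃ ∂ʷ α β a w

∂ : (α β : Letter) → Poly → Poly
∂ α β = linear (∂ʷ α β e0)

Const : Poly → Poly
Const = linear λ w → if does (any? (_≟ˡ ez) w) then 𝟘 else word w

𝓘ST : Pred Poly 0ℓ
𝓘ST w = 𝒜z⁰ w ×
  (∀ (αs : List Letter) → All (_∈ e0 ∷ e1 ∷ []) αs →
     Const (foldr (∂ ez) w αs) ≈ 𝟘)

τz : Poly → Poly
τz = antiHom λ where
  e0 → letter ez ⊖ letter e1
  e1 → letter ez ⊖ letter e0
  ez → letter ez

-- Elements of M ⊗ N are represented by finite sums of pure tensors u ⊗ v.  The
-- maps applied to them below are induced by bilinear ones, so their values do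
-- not depend on the representative.
Tensor : Set
Tensor = List (Poly × Poly)

_⊗_ : Pred Poly 0ℓ → Pred Poly 0ℓ → Pred Tensor 0ℓ
M ⊗ N = All λ (u , v) → M u × N v

shuffle : Tensor → Poly
shuffle = foldr (λ (u , v) p → u ш v ⊕ p) 𝟘

id⊗const : Tensor → Poly
id⊗const = foldr (λ (u , v) p → coeff v [] • u ⊕ p) 𝟘

-- Reg D w t : t represents the preimage of w under the isomorphism from D
-- given by u ⊗ v ↦ u ш v.
Reg : Pred Tensor 0ℓ → Poly → Tensor → Set
Reg D w t = D t × shuffle t ≈ w

reg[z,1] : Poly → Tensor → Set
reg[z,1] = Reg (𝒜z⁻² ⊗ (𝒜z⁰ ∩ ℤ⟨ e1 ∷ ez ∷ [] ⟩))

reg[z] : Poly → Tensor → Set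
reg[z] = Reg (𝒜z⁻² ⊗ ℤ⟨ [ ez ] ⟩)

λ′ : Poly → Poly
λ′ = ringHom λ where
  e0 → letter e0
  e1 → letter e1
  ez → letter e1

-- N and λ are given by their graphs, being built from the inverses above.
N[_]≈_ : Poly → Poly → Set
N[ w ]≈ n = ∃ λ t → reg[z,1] w t × n ≈ shuffle (map (map₂ τz) t)

λ[_]≈_ : Poly → Poly → Set
λ[ w ]≈ x = ∃ λ n → N[ w ]≈ n × ∃ λ t → reg[z] n t × x ≈ λ′ (id⊗const t)

𝓘CF : Pred Poly 0ℓ
𝓘CF x = ∃ λ w → 𝓘ST w × λ[ w ]≈ x

{-# OPTIONS --safe #-}

-- Let φ be the substitution e₀ ↦ e₀, e₁ ↦ e₁ − e_z on ℤ⟨e₀,e₁⟩.  Then τz φ = φ τ∞,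
-- and λ′ φ w is the constant term of w for w ∈ 𝒜⁰, so λ kills φ w − φ τ∞ w.  On 𝒜_z⁰
-- the operators ∂_{z,0} and ∂_{z,1} commute with τz, while Const τz = τ∞ Const;
-- hence Const ∂_{z,α₁} ⋯ ∂_{z,αₙ} maps φ w − φ τ∞ w to Δ of its value at φ w.  The
-- operators D e₀ = − ∂_{z,0} − ∂_{z,1} and D e_z = ∂_{z,1} remove the last letter from
-- the words in e₀ and e_z that start with e_z, so these words serve as a dual basis,
-- and
--
--   Δ w + Σ_r Δ (Const (D* (φ w) r)) ш W r − (φ w − φ τ∞ w) ∈ 𝓘ST   (r nonempty),
--
-- where W r is the word dual to D* _ r.  Applying λ turns the terms of the sum into
-- multiples of dualities of lower weight, so Δ w ∈ 𝓘CF by induction on the weight.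
-- Since ∂_{z,α} is a derivation that vanishes on 𝒜⁰, 𝓘CF is an ideal of 𝒜⁰.
module Submission where

open import Data.Bool using (Bool; true; false; if_then_else_; _∧_; _∨_)
open import Data.Bool.Properties using (∧-comm; ∨-comm)
open import Data.Empty using (⊥-elim)
open import Data.Fin using (Fin; zero; suc)
import Data.Fin.Properties as Fin
open import Data.Integer using (ℤ; 0ℤ; 1ℤ; -1ℤ; -_)
  renaming (_≟_ to _≟ℤ_; _+_ to _+ℤ_; _*_ to _*ℤ_; _-_ to _-ℤ_)
open import Data.Integer.Properties using
  (+-identityˡ; +-assoc; +-comm; +-inverseʳ; *-zeroˡ; *-zeroʳ; *-identityˡ; *-identityʳ;
   *-assoc; *-comm; *-distribˡ-+; *-distribʳ-+; -1*i≡-i)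
open import Data.List using
  (List; []; _∷_; [_]; _++_; _∷ʳ_; map; foldr; length; filter; replicate; initLast; _∷ʳ′_)
open import Data.List.Membership.Propositional using (_∈_)
open import Data.List.Properties using
  (≡-dec; length-filter; map-++; ++-assoc; ++-identityʳ; ∷ʳ-injective)
open import Data.List.Relation.Unary.All using (All; []; _∷_)
import Data.List.Relation.Unary.All as All
open import Data.List.Relation.Unary.All.Properties using (++⁺; map⁺; replicate⁺)
open import Data.List.Relation.Unary.Any using (Any; any?; here; there)
open import Data.Nat using (ℕ; zero; suc; _≤_; _<_; s≤s; _⊔_) renaming (_+_ to _+ℕ_)
import Data.Nat.Properties as ℕ
open import Data.Product using (∃; ∃₂; _×_; _,_; proj₁; proj₂; map₁; map₂)
open import Data.Product.Properties using () renaming (≡-dec to ×-≡-dec)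
open import Data.Sum using (_⊎_; inj₁; inj₂)
open import Data.Vec using (Vec; []; _∷_; lookup)
open import Function using (_∘_; id)
open import Level using (0ℓ)
open import Relation.Binary.Bundles using (Setoid)
open import Relation.Binary.Definitions using (DecidableEquality)
open import Relation.Binary.PropositionalEquality using
  (_≡_; _≢_; refl; sym; trans; cong; cong₂; subst)
open import Relation.Nullary using (yes; no; does; ¬_; ¬?)
open import Relation.Nullary.Decidable using (decidable-stable)
open import Relation.Unary using (Pred; _⊆_)
open import Defs

-- The functionals `Const (D* _ r)` behave like Taylor coefficients: an element of 𝒜_z⁰ is standard
-- when all of them vanish, and elements without e_z are constants for the operators. The obstacle
-- is that `φ w ⊖ φ (τ∞ w)`, although killed by λ, is not standard: its coefficients are dualities.
-- The correction is the Taylor polynomial with these very coefficients. The one at the empty word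
-- is `Δ w`; each of the others involves at least one deletion of a letter, which is what makes the
-- induction descend.
--
-- `D` is an invertible integral change of basis of the two operators ∂_{z,0} and ∂_{z,1}, chosen so
-- that the dual basis consists of single words with coefficient one and no denominators arise. The
-- boundary conventions a₀ = 0 and a_{n+1} = 1 disturb the commutation with `τz` by terms that
-- vanish exactly under the conditions defining 𝒜_z⁰.
--
-- λ is only applied to sums of products u ш e_z^k with u in 𝒜_z⁻², where preimages can be written
-- down. Words `W r` ending in e_z are the ones for which finding such a sum takes work.

infix 4 _≃_

-- _≈_ unfolds to a function type, which would block the inference of its
-- arguments.
record _≃_ (p q : Poly) : Set where
  constructor pointwise
  field coeff-≡ : p ≈ q

open _≃_ public

≃-refl : ∀ {p} → p ≃ p
≃-refl = pointwise λ _ → refl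

≃-sym : ∀ {p q} → p ≃ q → q ≃ p
≃-sym (pointwise e) = pointwise λ w → sym (e w)

≃-trans : ∀ {p q r} → p ≃ q → q ≃ r → p ≃ r
≃-trans (pointwise e) (pointwise f) = pointwise λ w → trans (e w) (f w)

≡⇒≃ : ∀ {p q} → p ≡ q → p ≃ q
≡⇒≃ refl = ≃-refl

polySetoid : Setoid _ _
polySetoid = record
  { Carrier = Poly ; _≈_ = _≃_
  ; isEquivalence = record { refl = ≃-refl ; sym = ≃-sym ; trans = ≃-trans } }

open import Relation.Binary.Reasoning.Setoid polySetoid

-- The module of formal sums

coeff-⊕ : ∀ p q w → coeff (p ⊕ q) w ≡ coeff p w +ℤ coeff q w
coeff-⊕ []            q w = sym (+-identityˡ _)
coeff-⊕ ((c , v) ∷ p) q w rewrite coeff-⊕ p q w = sym (+-assoc (if does (v ≟ʷ w) then c else 0ℤ) _ _)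

coeff-• : ∀ c p w → coeff (c • p) w ≡ c *ℤ coeff p w
coeff-• c []            w = sym (*-zeroʳ c)
coeff-• c ((d , v) ∷ p) w rewrite coeff-• c p w with does (v ≟ʷ w)
... | true  = sym (*-distribˡ-+ c d _)
... | false = trans (cong (_+ℤ (c *ℤ coeff p w)) (sym (*-zeroʳ c))) (sym (*-distribˡ-+ c 0ℤ (coeff p w)))

⊕-cong : ∀ {p p′ q q′} → p ≃ p′ → q ≃ q′ → p ⊕ q ≃ p′ ⊕ q′
⊕-cong {p} {p′} {q} {q′} (pointwise e) (pointwise f) = pointwise λ w →
  trans (coeff-⊕ p q w) (trans (cong₂ _+ℤ_ (e w) (f w)) (sym (coeff-⊕ p′ q′ w)))

•-cong : ∀ c {p q} → p ≃ q → c • p ≃ c • q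
•-cong c {p} {q} (pointwise e) = pointwise λ w →
  trans (coeff-• c p w) (trans (cong (c *ℤ_) (e w)) (sym (coeff-• c q w)))

⊖-cong : ∀ {p p′ q q′} → p ≃ p′ → q ≃ q′ → p ⊖ q ≃ p′ ⊖ q′
⊖-cong e f = ⊕-cong e (•-cong -1ℤ f)

⊕-assoc : ∀ p q r → (p ⊕ q) ⊕ r ≃ p ⊕ (q ⊕ r)
⊕-assoc p q r = ≡⇒≃ (++-assoc p q r)

⊕-identityʳ : ∀ p → p ⊕ 𝟘 ≃ p
⊕-identityʳ p = ≡⇒≃ (++-identityʳ p)

⊕-comm : ∀ p q → p ⊕ q ≃ q ⊕ p
⊕-comm p q = pointwise λ w → trans (coeff-⊕ p q w) (trans (+-comm (coeff p w) _) (sym (coeff-⊕ q p w)))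

⊕-interchange : ∀ p q r s → (p ⊕ q) ⊕ (r ⊕ s) ≃ (p ⊕ r) ⊕ (q ⊕ s)
⊕-interchange p q r s = begin
  (p ⊕ q) ⊕ (r ⊕ s) ≈⟨ ⊕-assoc p q (r ⊕ s) ⟩
  p ⊕ (q ⊕ (r ⊕ s)) ≈⟨ ⊕-cong (≃-refl {p}) (⊕-assoc q r s) ⟨
  p ⊕ ((q ⊕ r) ⊕ s) ≈⟨ ⊕-cong (≃-refl {p}) (⊕-cong (⊕-comm q r) ≃-refl) ⟩
  p ⊕ ((r ⊕ q) ⊕ s) ≈⟨ ⊕-cong (≃-refl {p}) (⊕-assoc r q s) ⟩
  p ⊕ (r ⊕ (q ⊕ s)) ≈⟨ ⊕-assoc p r (q ⊕ s) ⟨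
  (p ⊕ r) ⊕ (q ⊕ s) ∎

1• : ∀ p → 1ℤ • p ≃ p
1• p = pointwise λ w → trans (coeff-• 1ℤ p w) (*-identityˡ (coeff p w))

0• : ∀ p → 0ℤ • p ≃ 𝟘
0• p = pointwise λ w → trans (coeff-• 0ℤ p w) (*-zeroˡ (coeff p w))

•-⊕ : ∀ c p q → c • (p ⊕ q) ≃ c • p ⊕ c • q
•-⊕ c p q = pointwise λ w → trans (coeff-• c (p ⊕ q) w) (trans (cong (c *ℤ_) (coeff-⊕ p q w))
  (trans (*-distribˡ-+ c (coeff p w) _)
    (trans (sym (cong₂ _+ℤ_ (coeff-• c p w) (coeff-• c q w))) (sym (coeff-⊕ (c • p) _ w)))))

•-• : ∀ c d p → c • d • p ≃ (c *ℤ d) • p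
•-• c d p = pointwise λ w → trans (coeff-• c (d • p) w) (trans (cong (c *ℤ_) (coeff-• d p w))
  (trans (sym (*-assoc c d _)) (sym (coeff-• (c *ℤ d) p w))))

+-• : ∀ c d p → (c +ℤ d) • p ≃ c • p ⊕ d • p
+-• c d p = pointwise λ w → trans (coeff-• (c +ℤ d) p w) (trans (*-distribʳ-+ (coeff p w) c d)
  (trans (sym (cong₂ _+ℤ_ (coeff-• c p w) (coeff-• d p w))) (sym (coeff-⊕ (c • p) _ w))))

•-comm : ∀ c d p → c • d • p ≃ d • c • p
•-comm c d p = ≃-trans (•-• c d p) (≃-trans (≡⇒≃ (cong (_• p) (*-comm c d))) (≃-sym (•-• d c p)))

⊖-self : ∀ p → p ⊖ p ≃ 𝟘
⊖-self p = pointwise λ w → trans (coeff-⊕ p (-1ℤ • p) w)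
  (trans (cong (coeff p w +ℤ_) (trans (coeff-• -1ℤ p w) (-1*i≡-i (coeff p w)))) (+-inverseʳ (coeff p w)))

⊖-null : ∀ {p q} → p ≃ q → p ⊖ q ≃ 𝟘
⊖-null {p} {q} e = ≃-trans (⊖-cong e ≃-refl) (⊖-self q)

⊖-null⁻¹ : ∀ {p q} → p ⊖ q ≃ 𝟘 → p ≃ q
⊖-null⁻¹ {p} {q} e = begin
  p                    ≈⟨ ⊕-identityʳ p ⟨
  p ⊕ 𝟘                ≈⟨ ⊕-cong (≃-refl {p}) (≃-trans (⊕-comm (-1ℤ • q) q) (⊖-self q)) ⟨
  p ⊕ (-1ℤ • q ⊕ q)    ≈⟨ ⊕-assoc p (-1ℤ • q) q ⟨
  (p ⊖ q) ⊕ q          ≈⟨ ⊕-cong e ≃-refl ⟩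
  q                    ∎

-- Congruence has to be a field: a function on lists need not respect `_≃_`, even if it is
-- compatible with `_⊕_` and `_•_`.
record Linear (F : Poly → Poly) : Set where
  field
    congruent : ∀ {p q} → p ≃ q → F p ≃ F q
    additive  : ∀ p q → F (p ⊕ q) ≃ F p ⊕ F q
    scaling   : ∀ c p → F (c • p) ≃ c • F p

  subtractive : ∀ p q → F (p ⊖ q) ≃ F p ⊖ F q
  subtractive p q = ≃-trans (additive p (-1ℤ • q)) (⊕-cong ≃-refl (scaling -1ℤ q))

  null : F 𝟘 ≃ 𝟘
  null = ≃-trans (scaling 0ℤ 𝟘) (0• (F 𝟘))

  annihilates : ∀ {p} → p ≃ 𝟘 → F p ≃ 𝟘
  annihilates e = ≃-trans (congruent e) null

open Linear public

-- A solver for identities between linear expressions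

Op : Set
Op = ∃ Linear

infixl 6 _:⊕_ _:⊖_
infixr 7 _:•_
infixr 8 _$_

data Expr (k n : ℕ) : Set where
  var  : Fin n → Expr k n
  :𝟘   : Expr k n
  _:⊕_ : Expr k n → Expr k n → Expr k n
  _:•_ : ℤ → Expr k n → Expr k n
  _$_  : Fin k → Expr k n → Expr k n

_:⊖_ : ∀ {k n} → Expr k n → Expr k n → Expr k n
e :⊖ f = e :⊕ -1ℤ :• f

Term : (k n : ℕ) → Set
Term k n = List (Fin k) × Fin n

_≟ᵗ_ : ∀ {k n} → DecidableEquality (Term k n)
_≟ᵗ_ = ×-≡-dec (≡-dec Fin._≟_) Fin._≟_

normal : ∀ {k n} → Expr k n → List (ℤ × Term k n)
normal (var i)  = [ 1ℤ , [] , i ]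
normal :𝟘       = []
normal (e :⊕ f) = normal e ++ normal f
normal (c :• e) = map (map₁ (c *ℤ_)) (normal e)
normal (j $ e)  = map (map₂ (map₁ (j ∷_))) (normal e)

insert : ∀ {k n} → ℤ × Term k n → List (ℤ × Term k n) → List (ℤ × Term k n)
insert x       []             = [ x ]
insert (c , t) ((d , s) ∷ xs) with t ≟ᵗ s
... | yes _ = (c +ℤ d , s) ∷ xs
... | no _  = (d , s) ∷ insert (c , t) xs

collect : ∀ {k n} → List (ℤ × Term k n) → List (ℤ × Term k n)
collect = foldr insert []

vanishing : ∀ {k n} → List (ℤ × Term k n) → Bool
vanishing = foldr (λ (c , _) b → does (c ≟ℤ 0ℤ) ∧ b) true

module _ {k n} (ops : Vec Op k) (ρ : Vec Poly n) where

  apply : Fin k → Poly → Poly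
  apply j = proj₁ (lookup ops j)

  applyˡ : ∀ j → Linear (apply j)
  applyˡ j = proj₂ (lookup ops j)

  ⟦_⟧ : Expr k n → Poly
  ⟦ var i  ⟧ = lookup ρ i
  ⟦ :𝟘     ⟧ = 𝟘
  ⟦ e :⊕ f ⟧ = ⟦ e ⟧ ⊕ ⟦ f ⟧
  ⟦ c :• e ⟧ = c • ⟦ e ⟧
  ⟦ j $ e  ⟧ = apply j ⟦ e ⟧

  term : Term k n → Poly
  term (js , i) = foldr apply (lookup ρ i) js

  value : List (ℤ × Term k n) → Poly
  value = foldr (λ (c , t) p → c • term t ⊕ p) 𝟘

  value-++ : ∀ xs ys → value (xs ++ ys) ≃ value xs ⊕ value ys
  value-++ []             ys = ≃-refl
  value-++ ((c , t) ∷ xs) ys = ≃-trans (⊕-cong (≃-refl {c • term t}) (value-++ xs ys))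
    (≃-sym (⊕-assoc (c • term t) (value xs) (value ys)))

  value-• : ∀ c xs → value (map (map₁ (c *ℤ_)) xs) ≃ c • value xs
  value-• c []             = ≃-refl
  value-• c ((d , t) ∷ xs) = ≃-trans (⊕-cong (≃-sym (•-• c d (term t))) (value-• c xs))
    (≃-sym (•-⊕ c (d • term t) (value xs)))

  value-$ : ∀ j xs → value (map (map₂ (map₁ (j ∷_))) xs) ≃ apply j (value xs)
  value-$ j []             = ≃-sym (null (applyˡ j))
  value-$ j ((d , t) ∷ xs) = ≃-trans (⊕-cong (≃-sym (scaling (applyˡ j) d (term t))) (value-$ j xs))
    (≃-sym (additive (applyˡ j) (d • term t) (value xs)))

  value-normal : ∀ e → value (normal e) ≃ ⟦ e ⟧
  value-normal (var i)  = ≃-trans (⊕-identityʳ (1ℤ • lookup ρ i)) (1• (lookup ρ i))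
  value-normal :𝟘       = ≃-refl
  value-normal (e :⊕ f) = ≃-trans (value-++ (normal e) (normal f)) (⊕-cong (value-normal e) (value-normal f))
  value-normal (c :• e) = ≃-trans (value-• c (normal e)) (•-cong c (value-normal e))
  value-normal (j $ e)  = ≃-trans (value-$ j (normal e)) (congruent (applyˡ j) (value-normal e))

  value-insert : ∀ c t xs → value (insert (c , t) xs) ≃ c • term t ⊕ value xs
  value-insert c t []             = ≃-refl
  value-insert c t ((d , s) ∷ xs) with t ≟ᵗ s
  ... | yes refl = ≃-trans (⊕-cong (+-• c d (term t)) (≃-refl {value xs}))
    (⊕-assoc (c • term t) (d • term t) (value xs))
  ... | no _ = begin
    d • term s ⊕ value (insert (c , t) xs)  ≈⟨ ⊕-cong (≃-refl {d • term s}) (value-insert c t xs) ⟩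
    d • term s ⊕ (c • term t ⊕ value xs)    ≈⟨ ⊕-assoc (d • term s) (c • term t) (value xs) ⟨
    (d • term s ⊕ c • term t) ⊕ value xs    ≈⟨ ⊕-cong (⊕-comm (d • term s) (c • term t)) ≃-refl ⟩
    (c • term t ⊕ d • term s) ⊕ value xs    ≈⟨ ⊕-assoc (c • term t) (d • term s) (value xs) ⟩
    c • term t ⊕ (d • term s ⊕ value xs)    ∎

  value-collect : ∀ xs → value (collect xs) ≃ value xs
  value-collect []             = ≃-refl
  value-collect ((c , t) ∷ xs) = ≃-trans (value-insert c t (collect xs))
    (⊕-cong (≃-refl {c • term t}) (value-collect xs))

  value-vanishing : ∀ xs → vanishing xs ≡ true → value xs ≃ 𝟘
  value-vanishing []             _ = ≃-refl
  value-vanishing ((c , t) ∷ xs) h with c ≟ℤ 0ℤ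
  ... | yes refl = ⊕-cong (0• (term t)) (value-vanishing xs h)

  -- Proof by reflection: the collected coefficients of `e :⊖ f` compute to zero, so `refl` proves
  -- the hypothesis. They must be closed integers for this, which is why products such as `k • X`
  -- with a symbolic `k` are passed as atoms.
  solve : ∀ e f → vanishing (collect (normal (e :⊖ f))) ≡ true → ⟦ e ⟧ ≃ ⟦ f ⟧
  solve e f h = ⊖-null⁻¹ (begin
    ⟦ e ⟧ ⊖ ⟦ f ⟧                      ≈⟨ value-normal (e :⊖ f) ⟨
    value (normal (e :⊖ f))            ≈⟨ value-collect (normal (e :⊖ f)) ⟨
    value (collect (normal (e :⊖ f)))  ≈⟨ value-vanishing (collect (normal (e :⊖ f))) h ⟩
    𝟘                                  ∎)

pattern #0 = zero
pattern #1 = suc zero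
pattern #2 = suc (suc zero)
pattern #3 = suc (suc (suc zero))
pattern #4 = suc (suc (suc (suc zero)))
pattern #5 = suc (suc (suc (suc (suc zero))))
pattern #6 = suc (suc (suc (suc (suc (suc zero)))))
pattern #7 = suc #6
pattern #8 = suc #7
pattern #9 = suc #8
pattern #10 = suc #9
pattern #11 = suc #10
pattern x₀ = var #0
pattern x₁ = var #1
pattern x₂ = var #2
pattern x₃ = var #3
pattern x₄ = var #4
pattern x₅ = var #5
pattern x₆ = var #6
pattern x₇ = var #7
pattern x₈ = var #8
pattern x₉ = var #9
pattern x₁₀ = var #10
pattern x₁₁ = var #11

-- Linear extension and extensionality

linear-⊕ : ∀ f p {q} → linear f (p ⊕ q) ≃ linear f p ⊕ linear f q
linear-⊕ f []            = ≃-refl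
linear-⊕ f ((c , v) ∷ p) {q} = ≃-trans (⊕-cong ≃-refl (linear-⊕ f p))
  (solve [] (c • f v ∷ linear f p ∷ linear f q ∷ []) (x₀ :⊕ (x₁ :⊕ x₂)) ((x₀ :⊕ x₁) :⊕ x₂) refl)

linear-• : ∀ f c p → linear f (c • p) ≃ c • linear f p
linear-• f c []            = ≃-refl
linear-• f c ((d , v) ∷ p) = ≃-trans (⊕-cong (≃-sym (•-• c d (f v))) (linear-• f c p))
  (≃-sym (•-⊕ c (d • f v) (linear f p)))

remove : Word → Poly → Poly
remove v = filter (λ e → ¬? (proj₂ e ≟ʷ v))

coeff-remove : ∀ v p w → coeff p w ≡ 0ℤ → coeff (remove v p) w ≡ 0ℤ
coeff-remove v p w h with v ≟ʷ w
... | yes refl = removed p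
  where
  removed : ∀ p → coeff (remove v p) v ≡ 0ℤ
  removed []            = refl
  removed ((c , u) ∷ p) with u ≟ʷ v in eq
  ... | yes _ = removed p
  ... | no _ rewrite eq = trans (+-identityˡ (coeff (remove v p) v)) (removed p)
... | no v≢w = trans (kept p) h
  where
  kept : ∀ p → coeff (remove v p) w ≡ coeff p w
  kept []            = refl
  kept ((c , u) ∷ p) with u ≟ʷ v
  ... | no _ = cong ((if does (u ≟ʷ w) then c else 0ℤ) +ℤ_) (kept p)
  ... | yes refl with v ≟ʷ w
  ...   | yes v≡w = ⊥-elim (v≢w v≡w)
  ...   | no _ = trans (kept p) (sym (+-identityˡ (coeff p w)))

linear-remove : ∀ f v p → linear f p ≃ coeff p v • f v ⊕ linear f (remove v p)
linear-remove f v []            = ≃-sym (≃-trans (⊕-identityʳ (0ℤ • f v)) (0• (f v)))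
linear-remove f v ((c , u) ∷ p) with u ≟ʷ v
... | yes refl = ≃-trans (⊕-cong ≃-refl (linear-remove f v p))
  (≃-trans (solve [] (c • f v ∷ coeff p v • f v ∷ linear f (remove v p) ∷ [])
             (x₀ :⊕ (x₁ :⊕ x₂)) ((x₀ :⊕ x₁) :⊕ x₂) refl)
    (⊕-cong (≃-sym (+-• c (coeff p v) (f v))) ≃-refl))
... | no _ = ≃-trans (⊕-cong ≃-refl (linear-remove f v p))
  (≃-trans (solve [] (c • f u ∷ coeff p v • f v ∷ linear f (remove v p) ∷ [])
             (x₀ :⊕ (x₁ :⊕ x₂)) (x₁ :⊕ (x₀ :⊕ x₂)) refl)
    (⊕-cong (≡⇒≃ (cong (_• f v) (sym (+-identityˡ (coeff p v))))) ≃-refl))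

-- A list representing zero may still contain words whose coefficients cancel. All occurrences of
-- the head word are gathered, their total coefficient is zero, and the recursion continues without
-- that word. Since `remove v p` is not a sublist by structure, `n` bounds its length.
linear-null : ∀ f n p → length p ≤ n → p ≃ 𝟘 → linear f p ≃ 𝟘
linear-null f n       []            _         _ = ≃-refl
linear-null f (suc n) ((c , v) ∷ p) (s≤s len) p≃𝟘 = begin
  c • f v ⊕ linear f p                                    ≈⟨ ⊕-cong ≃-refl (linear-remove f v p) ⟩
  c • f v ⊕ (coeff p v • f v ⊕ linear f (remove v p))     ≈⟨ solve [] (c • f v ∷ coeff p v • f v ∷ linear f (remove v p) ∷ []) (x₀ :⊕ (x₁ :⊕ x₂)) ((x₀ :⊕ x₁) :⊕ x₂) refl ⟩
  (c • f v ⊕ coeff p v • f v) ⊕ linear f (remove v p)     ≈⟨ ⊕-cong (+-• c (coeff p v) (f v)) ≃-refl ⟨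
  (c +ℤ coeff p v) • f v ⊕ linear f (remove v p)          ≈⟨ ⊕-cong (≡⇒≃ (cong (_• f v) vanishes)) rest ⟩
  0ℤ • f v ⊕ 𝟘                                            ≈⟨ ≃-trans (⊕-identityʳ (0ℤ • f v)) (0• (f v)) ⟩
  𝟘                                                       ∎
  where
  vanishes : c +ℤ coeff p v ≡ 0ℤ
  vanishes with v ≟ʷ v | coeff-≡ p≃𝟘 v
  ... | yes _  | e = e
  ... | no v≢v | _ = ⊥-elim (v≢v refl)
  remove-head : remove v ((c , v) ∷ p) ≡ remove v p
  remove-head with v ≟ʷ v
  ... | yes _  = refl
  ... | no v≢v = ⊥-elim (v≢v refl)
  rest : linear f (remove v p) ≃ 𝟘
  rest = linear-null f n (remove v p) (ℕ.≤-trans (length-filter _ p) len)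
    (subst (_≃ 𝟘) remove-head (pointwise λ w → coeff-remove v ((c , v) ∷ p) w (coeff-≡ p≃𝟘 w)))

linear-linear : ∀ f → Linear (linear f)
linear-linear f = record
  { congruent = λ {p} {q} e → ⊖-null⁻¹ (≃-trans
      (≃-sym (≃-trans (linear-⊕ f p) (⊕-cong ≃-refl (linear-• f -1ℤ q))))
      (linear-null f _ (p ⊖ q) ℕ.≤-refl (⊖-null e)))
  ; additive  = λ p q → linear-⊕ f p
  ; scaling   = linear-• f }

linear-word : ∀ f w → linear f (word w) ≃ f w
linear-word f w = ≃-trans (⊕-identityʳ (1ℤ • f w)) (1• (f w))

word-• : ∀ c w → c • word w ≡ (c , w) ∷ []
word-• c w = cong (λ d → (d , w) ∷ []) (*-identityʳ c)

ext : ∀ {F G} → Linear F → Linear G → (∀ w → F (word w) ≃ G (word w)) → ∀ p → F p ≃ G p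
ext F G h []            = ≃-trans (null F) (≃-sym (null G))
ext {F} {G} LF LG h ((c , w) ∷ p) = begin
  F ((c , w) ∷ p)      ≡⟨ cong (λ t → F (t ++ p)) (word-• c w) ⟨
  F (c • word w ⊕ p)   ≈⟨ ≃-trans (additive LF (c • word w) p) (⊕-cong (scaling LF c (word w)) ≃-refl) ⟩
  c • F (word w) ⊕ F p ≈⟨ ⊕-cong (•-cong c (h w)) (ext LF LG h p) ⟩
  c • G (word w) ⊕ G p ≈⟨ ≃-trans (additive LG (c • word w) p) (⊕-cong (scaling LG c (word w)) ≃-refl) ⟨
  G (c • word w ⊕ p)   ≡⟨ cong (λ t → G (t ++ p)) (word-• c w) ⟩
  G ((c , w) ∷ p)      ∎

infixr 9 _∘ˡ_
infixl 6 _⊕ˡ_ _⊖ˡ_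
infixr 7 _•ˡ_

idˡ : Linear id
idˡ = record { congruent = id ; additive = λ _ _ → ≃-refl ; scaling = λ _ _ → ≃-refl }

_∘ˡ_ : ∀ {F G} → Linear F → Linear G → Linear (F ∘ G)
_∘ˡ_ {F} {G} LF LG = record
  { congruent = congruent LF ∘ congruent LG
  ; additive  = λ p q → ≃-trans (congruent LF (additive LG p q)) (additive LF (G p) (G q))
  ; scaling   = λ c p → ≃-trans (congruent LF (scaling LG c p)) (scaling LF c (G p)) }

_⊕ˡ_ : ∀ {F G} → Linear F → Linear G → Linear (λ p → F p ⊕ G p)
_⊕ˡ_ {F} {G} LF LG = record
  { congruent = λ e → ⊕-cong (congruent LF e) (congruent LG e)
  ; additive  = λ p q → ≃-trans (⊕-cong (additive LF p q) (additive LG p q)) (⊕-interchange (F p) (F q) (G p) (G q))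
  ; scaling   = λ c p → ≃-trans (⊕-cong (scaling LF c p) (scaling LG c p)) (≃-sym (•-⊕ c (F p) (G p))) }

_•ˡ_ : ∀ {F} c → Linear F → Linear (λ p → c • F p)
_•ˡ_ {F} c LF = record
  { congruent = λ e → •-cong c (congruent LF e)
  ; additive  = λ p q → ≃-trans (•-cong c (additive LF p q)) (•-⊕ c (F p) (F q))
  ; scaling   = λ d p → ≃-trans (•-cong c (scaling LF d p)) (•-comm c d (F p)) }

_⊖ˡ_ : ∀ {F G} → Linear F → Linear G → Linear (λ p → F p ⊖ G p)
F ⊖ˡ G = F ⊕ˡ (-1ℤ •ˡ G)

𝟘ˡ : Linear (λ _ → 𝟘)
𝟘ˡ = record { congruent = λ _ → ≃-refl ; additive = λ _ _ → ≃-refl ; scaling = λ _ _ → ≃-refl }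

-- Yields linearity of `bilinear` in its second argument, where the variable occurs inside the
-- function that is being extended.
linear-parametric : ∀ {G : Word → Poly → Poly} → (∀ w → Linear (G w)) → ∀ p → Linear (λ q → linear (λ w → G w q) p)
linear-parametric {G} L [] = 𝟘ˡ
linear-parametric {G} L ((c , w) ∷ p) = (c •ˡ L w) ⊕ˡ linear-parametric L p

bilinear-linearˡ : ∀ f q → Linear (λ p → bilinear f p q)
bilinear-linearˡ f q = linear-linear _

bilinear-linearʳ : ∀ f p → Linear (bilinear f p)
bilinear-linearʳ f = linear-parametric λ u → linear-linear (f u)

bilinear-word : ∀ f u v → bilinear f (word u) (word v) ≃ f u v
bilinear-word f u v = ≃-trans (linear-word (λ u → linear (f u) (word v)) u) (linear-word (f u) v)

bilinear-cong : ∀ f {p p′ q q′} → p ≃ p′ → q ≃ q′ → bilinear f p q ≃ bilinear f p′ q′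
bilinear-cong f {p′ = p′} {q} e e′ = ≃-trans (congruent (bilinear-linearˡ f q) e) (congruent (bilinear-linearʳ f p′) e′)

infixl 8 _▹_

_▹_ : Poly → Letter → Poly
p ▹ a = map (map₂ (_∷ʳ a)) p

-- Congruence is not visible on lists, as `g` may identify words. It is inherited from
-- `linear (word ∘ g)`, which has the same values.
map-word-linear : ∀ (g : Word → Word) → Linear (map (map₂ g))
map-word-linear g = record
  { congruent = λ {p} {q} e → ≃-trans (≃-sym (as-linear p)) (≃-trans (congruent (linear-linear (word ∘ g)) e) (as-linear q))
  ; additive  = λ p q → ≡⇒≃ (map-++ _ p q)
  ; scaling   = λ c p → ≡⇒≃ (commute c p) }
  where
  as-linear : ∀ p → linear (word ∘ g) p ≃ map (map₂ g) p
  as-linear []            = ≃-refl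
  as-linear ((c , w) ∷ p) = ⊕-cong (≡⇒≃ (word-• c (g w))) (as-linear p)
  commute : ∀ c p → map (map₂ g) (c • p) ≡ c • map (map₂ g) p
  commute c []            = refl
  commute c ((d , w) ∷ p) = cong (_ ∷_) (commute c p)

◃-linear : ∀ a → Linear (a ◃_)
◃-linear a = map-word-linear (a ∷_)

▹-linear : ∀ a → Linear (_▹ a)
▹-linear a = map-word-linear (_∷ʳ a)

-- The shuffle product

BilinearOp : (Poly → Poly → Poly) → Set
BilinearOp F = (∀ q → Linear (λ p → F p q)) × (∀ p → Linear (F p))

ext₂ : ∀ {F G} → BilinearOp F → BilinearOp G → (∀ u v → F (word u) (word v) ≃ G (word u) (word v)) →
       ∀ p q → F p q ≃ G p q
ext₂ (F₁ , F₂) (G₁ , G₂) h p q = ext (F₁ q) (G₁ q) (λ u → ext (F₂ (word u)) (G₂ (word u)) (h u) q) p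

ш-linearˡ : ∀ q → Linear (_ш q)
ш-linearˡ = bilinear-linearˡ _шʷ_

ш-linearʳ : ∀ p → Linear (p ш_)
ш-linearʳ = bilinear-linearʳ _шʷ_

ш-cong : ∀ {p p′ q q′} → p ≃ p′ → q ≃ q′ → p ш q ≃ p′ ш q′
ш-cong = bilinear-cong _шʷ_

ш-word : ∀ u v → word u ш word v ≃ u шʷ v
ш-word = bilinear-word _шʷ_

ш-identityˡ : ∀ p → word [] ш p ≃ p
ш-identityˡ = ext (ш-linearʳ (word [])) idˡ (ш-word [])

шʷ-[] : ∀ u → u шʷ [] ≡ word u
шʷ-[] []      = refl
шʷ-[] (_ ∷ _) = refl

ш-identityʳ : ∀ p → p ш word [] ≃ p
ш-identityʳ = ext (ш-linearˡ (word [])) idˡ λ u → ≃-trans (ш-word u []) (≡⇒≃ (шʷ-[] u))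

шʷ-comm : ∀ u v → u шʷ v ≃ v шʷ u
шʷ-comm []      v       = ≡⇒≃ (sym (шʷ-[] v))
шʷ-comm (a ∷ u) []      = ≃-refl
шʷ-comm (a ∷ u) (b ∷ v) = begin
  a ◃ (u шʷ (b ∷ v)) ⊕ b ◃ ((a ∷ u) шʷ v)  ≈⟨ ⊕-comm _ (b ◃ ((a ∷ u) шʷ v)) ⟩
  b ◃ ((a ∷ u) шʷ v) ⊕ a ◃ (u шʷ (b ∷ v))  ≈⟨ ⊕-cong (congruent (◃-linear b) (шʷ-comm (a ∷ u) v)) (congruent (◃-linear a) (шʷ-comm u (b ∷ v))) ⟩
  b ◃ (v шʷ (a ∷ u)) ⊕ a ◃ ((b ∷ v) шʷ u)  ∎

ш-comm : ∀ p q → p ш q ≃ q ш p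
ш-comm = ext₂ (ш-linearˡ , ш-linearʳ) (ш-linearʳ , ш-linearˡ) λ u v → begin
  word u ш word v ≈⟨ ш-word u v ⟩
  u шʷ v          ≈⟨ шʷ-comm u v ⟩
  v шʷ u          ≈⟨ ш-word v u ⟨
  word v ш word u ∎

◃-ш-◃ : ∀ a b p q → (a ◃ p) ш (b ◃ q) ≃ a ◃ (p ш (b ◃ q)) ⊕ b ◃ ((a ◃ p) ш q)
◃-ш-◃ a b = ext₂
  ((λ q → ш-linearˡ (b ◃ q) ∘ˡ ◃-linear a) , (λ p → ш-linearʳ (a ◃ p) ∘ˡ ◃-linear b))
  ((λ q → (◃-linear a ∘ˡ ш-linearˡ (b ◃ q)) ⊕ˡ (◃-linear b ∘ˡ ш-linearˡ q ∘ˡ ◃-linear a)) ,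
   (λ p → (◃-linear a ∘ˡ ш-linearʳ p ∘ˡ ◃-linear b) ⊕ˡ (◃-linear b ∘ˡ ш-linearʳ (a ◃ p))))
  λ u v → ≃-trans (ш-word (a ∷ u) (b ∷ v)) (≃-sym
    (⊕-cong (congruent (◃-linear a) (ш-word u (b ∷ v))) (congruent (◃-linear b) (ш-word (a ∷ u) v))))

-- Expanding both sides by the first letter gives words starting with `a`, `b` or `c`; the three
-- groups match by `h₁`, `h₂`, `h₃`. The tails are arbitrary polynomials because expanding one
-- product produces sums inside the other.
ш-assoc-◃ : ∀ a b c U V W →
  (U ш (b ◃ V)) ш (c ◃ W) ≃ U ш ((b ◃ V) ш (c ◃ W)) →
  ((a ◃ U) ш V) ш (c ◃ W) ≃ (a ◃ U) ш (V ш (c ◃ W)) →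
  ((a ◃ U) ш (b ◃ V)) ш W ≃ (a ◃ U) ш ((b ◃ V) ш W) →
  ((a ◃ U) ш (b ◃ V)) ш (c ◃ W) ≃ (a ◃ U) ш ((b ◃ V) ш (c ◃ W))
ш-assoc-◃ a b c U V W h₁ h₂ h₃ = begin
  (aU ш bV) ш cW
    ≈⟨ congruent (ш-linearˡ cW) (◃-ш-◃ a b U V) ⟩
  (a ◃ UV ⊕ b ◃ VU) ш cW
    ≈⟨ additive (ш-linearˡ cW) (a ◃ UV) (b ◃ VU) ⟩
  (a ◃ UV) ш cW ⊕ (b ◃ VU) ш cW
    ≈⟨ ⊕-cong (◃-ш-◃ a c UV W) (◃-ш-◃ b c VU W) ⟩
  (a ◃ (UV ш cW) ⊕ c ◃ ((a ◃ UV) ш W)) ⊕ (b ◃ (VU ш cW) ⊕ c ◃ ((b ◃ VU) ш W))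
    ≈⟨ solve ((_ , ◃-linear a) ∷ (_ , ◃-linear b) ∷ (_ , ◃-linear c) ∷ (_ , ш-linearˡ W) ∷ [])
             (UV ш cW ∷ VU ш cW ∷ (a ◃ UV) ∷ (b ◃ VU) ∷ [])
             ((#0 $ x₀ :⊕ #2 $ #3 $ x₂) :⊕ (#1 $ x₁ :⊕ #2 $ #3 $ x₃))
             (#0 $ x₀ :⊕ #1 $ x₁ :⊕ #2 $ #3 $ (x₂ :⊕ x₃)) refl ⟩
  a ◃ (UV ш cW) ⊕ b ◃ (VU ш cW) ⊕ c ◃ ((a ◃ UV ⊕ b ◃ VU) ш W)
    ≈⟨ ⊕-cong (⊕-cong (congruent (◃-linear a) h₁)
                      (congruent (◃-linear b) h₂))
              (congruent (◃-linear c) (≃-trans (congruent (ш-linearˡ W) (≃-sym (◃-ш-◃ a b U V))) h₃)) ⟩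
  a ◃ (U ш (bV ш cW)) ⊕ b ◃ (aU ш VW) ⊕ c ◃ (aU ш WV)
    ≈⟨ ⊕-cong (⊕-cong (congruent (◃-linear a) (congruent (ш-linearʳ U) (◃-ш-◃ b c V W))) (≃-refl {b ◃ (aU ш VW)})) (≃-refl {c ◃ (aU ш WV)}) ⟩
  a ◃ (U ш (b ◃ VW ⊕ c ◃ WV)) ⊕ b ◃ (aU ш VW) ⊕ c ◃ (aU ш WV)
    ≈⟨ solve ((_ , ◃-linear a) ∷ (_ , ш-linearʳ U) ∷ [])
             (b ◃ VW ∷ c ◃ WV ∷ b ◃ (aU ш VW) ∷ c ◃ (aU ш WV) ∷ [])
             (#0 $ #1 $ (x₀ :⊕ x₁) :⊕ x₂ :⊕ x₃)
             ((#0 $ #1 $ x₀ :⊕ x₂) :⊕ (#0 $ #1 $ x₁ :⊕ x₃)) refl ⟩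
  (a ◃ (U ш (b ◃ VW)) ⊕ b ◃ (aU ш VW)) ⊕ (a ◃ (U ш (c ◃ WV)) ⊕ c ◃ (aU ш WV))
    ≈⟨ ⊕-cong (◃-ш-◃ a b U VW) (◃-ш-◃ a c U WV) ⟨
  aU ш (b ◃ VW) ⊕ aU ш (c ◃ WV)
    ≈⟨ additive (ш-linearʳ aU) (b ◃ VW) (c ◃ WV) ⟨
  aU ш (b ◃ VW ⊕ c ◃ WV)
    ≈⟨ congruent (ш-linearʳ aU) (◃-ш-◃ b c V W) ⟨
  aU ш (bV ш cW) ∎
  where
  aU = a ◃ U
  bV = b ◃ V
  cW = c ◃ W
  UV = U ш bV
  VU = aU ш V
  VW = V ш cW
  WV = bV ш W

ш-assoc-word : ∀ u v w → (word u ш word v) ш word w ≃ word u ш (word v ш word w)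
ш-assoc-word [] v w = ≃-trans (congruent (ш-linearˡ (word w)) (ш-identityˡ (word v))) (≃-sym (ш-identityˡ (word v ш word w)))
ш-assoc-word u@(_ ∷ _) [] w = ≃-trans (congruent (ш-linearˡ (word w)) (ш-identityʳ (word u)))
  (congruent (ш-linearʳ (word u)) (≃-sym (ш-identityˡ (word w))))
ш-assoc-word u@(_ ∷ _) v@(_ ∷ _) [] = ≃-trans (ш-identityʳ (word u ш word v))
  (congruent (ш-linearʳ (word u)) (≃-sym (ш-identityʳ (word v))))
ш-assoc-word (a ∷ u) (b ∷ v) (c ∷ w) = ш-assoc-◃ a b c (word u) (word v) (word w)
  (ш-assoc-word u (b ∷ v) (c ∷ w)) (ш-assoc-word (a ∷ u) v (c ∷ w)) (ш-assoc-word (a ∷ u) (b ∷ v) w)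

ш-assoc : ∀ p q r → (p ш q) ш r ≃ p ш (q ш r)
ш-assoc p q r = ext (ш-linearˡ r ∘ˡ ш-linearˡ q) (ш-linearˡ (q ш r)) (λ u →
  ext₂ ((λ r → ш-linearˡ r ∘ˡ ш-linearʳ (word u)) , (λ q → ш-linearʳ (word u ш q)))
       ((λ r → ш-linearʳ (word u) ∘ˡ ш-linearˡ r) , (λ q → ш-linearʳ (word u) ∘ˡ ш-linearʳ q))
       (ш-assoc-word u) q r) p

◃-▹ : ∀ a b p → (a ◃ p) ▹ b ≡ a ◃ (p ▹ b)
◃-▹ a b []      = refl
◃-▹ a b (_ ∷ p) = cong (_ ∷_) (◃-▹ a b p)

-- Induction step for the recursion of ш by last letters, the mirror image of its definition. First
-- letters are split off on the outside, the hypotheses split the last letters inside, and `◃-▹`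
-- lets the two operations change places.
▹-ш-▹-◃ : ∀ a b c d U V →
  (U ▹ a) ш (d ◃ (V ▹ b)) ≃ (U ш (d ◃ (V ▹ b))) ▹ a ⊕ ((U ▹ a) ш (d ◃ V)) ▹ b →
  (c ◃ (U ▹ a)) ш (V ▹ b) ≃ ((c ◃ U) ш (V ▹ b)) ▹ a ⊕ ((c ◃ (U ▹ a)) ш V) ▹ b →
  (c ◃ (U ▹ a)) ш (d ◃ (V ▹ b)) ≃
    ((c ◃ U) ш (d ◃ (V ▹ b))) ▹ a ⊕ ((c ◃ (U ▹ a)) ш (d ◃ V)) ▹ b
▹-ш-▹-◃ a b c d U V h₁ h₂ = begin
  (c ◃ (U ▹ a)) ш (d ◃ (V ▹ b))
    ≈⟨ ◃-ш-◃ c d (U ▹ a) (V ▹ b) ⟩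
  c ◃ ((U ▹ a) ш (d ◃ (V ▹ b))) ⊕ d ◃ ((c ◃ (U ▹ a)) ш (V ▹ b))
    ≈⟨ ⊕-cong (congruent (◃-linear c) h₁) (congruent (◃-linear d) h₂) ⟩
  c ◃ (A ▹ a ⊕ B ▹ b) ⊕ d ◃ (C ▹ a ⊕ D ▹ b)
    ≈⟨ solve ((_ , ◃-linear c) ∷ (_ , ◃-linear d) ∷ []) (A ▹ a ∷ B ▹ b ∷ C ▹ a ∷ D ▹ b ∷ [])
         (#0 $ (x₀ :⊕ x₁) :⊕ #1 $ (x₂ :⊕ x₃)) ((#0 $ x₀ :⊕ #1 $ x₂) :⊕ (#0 $ x₁ :⊕ #1 $ x₃)) refl ⟩
  (c ◃ (A ▹ a) ⊕ d ◃ (C ▹ a)) ⊕ (c ◃ (B ▹ b) ⊕ d ◃ (D ▹ b))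
    ≡⟨ cong₂ _⊕_ (cong₂ _⊕_ (◃-▹ c a A) (◃-▹ d a C)) (cong₂ _⊕_ (◃-▹ c b B) (◃-▹ d b D)) ⟨
  ((c ◃ A) ▹ a ⊕ (d ◃ C) ▹ a) ⊕ ((c ◃ B) ▹ b ⊕ (d ◃ D) ▹ b)
    ≈⟨ ⊕-cong (additive (▹-linear a) (c ◃ A) (d ◃ C)) (additive (▹-linear b) (c ◃ B) (d ◃ D)) ⟨
  (c ◃ A ⊕ d ◃ C) ▹ a ⊕ (c ◃ B ⊕ d ◃ D) ▹ b
    ≈⟨ ⊕-cong (congruent (▹-linear a) (◃-ш-◃ c d U (V ▹ b))) (congruent (▹-linear b) (◃-ш-◃ c d (U ▹ a) V)) ⟨
  ((c ◃ U) ш (d ◃ (V ▹ b))) ▹ a ⊕ ((c ◃ (U ▹ a)) ш (d ◃ V)) ▹ b ∎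
  where
  A = U ш (d ◃ (V ▹ b))
  B = (U ▹ a) ш (d ◃ V)
  C = (c ◃ U) ш (V ▹ b)
  D = (c ◃ (U ▹ a)) ш V

▹-ш-▹-[]-◃ : ∀ a b d V →
  letter a ш (V ▹ b) ≃ (V ▹ b) ▹ a ⊕ (letter a ш V) ▹ b →
  letter a ш (d ◃ (V ▹ b)) ≃ d ◃ (V ▹ b ▹ a) ⊕ (letter a ш (d ◃ V)) ▹ b
▹-ш-▹-[]-◃ a b d V h = begin
  letter a ш (d ◃ (V ▹ b))
    ≈⟨ ◃-ш-◃ a d (word []) (V ▹ b) ⟩
  a ◃ (word [] ш (d ◃ (V ▹ b))) ⊕ d ◃ (letter a ш (V ▹ b))
    ≈⟨ ⊕-cong (congruent (◃-linear a) (ш-identityˡ (d ◃ (V ▹ b)))) (congruent (◃-linear d) h) ⟩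
  a ◃ (d ◃ (V ▹ b)) ⊕ d ◃ (V ▹ b ▹ a ⊕ (letter a ш V) ▹ b)
    ≡⟨ cong (_⊕ d ◃ (V ▹ b ▹ a ⊕ (letter a ш V) ▹ b)) (trans (◃-▹ a b (d ◃ V)) (cong (a ◃_) (◃-▹ d b V))) ⟨
  (a ◃ (d ◃ V)) ▹ b ⊕ d ◃ (V ▹ b ▹ a ⊕ (letter a ш V) ▹ b)
    ≈⟨ solve ((_ , ◃-linear d) ∷ []) ((a ◃ (d ◃ V)) ▹ b ∷ V ▹ b ▹ a ∷ (letter a ш V) ▹ b ∷ [])
         (x₀ :⊕ #0 $ (x₁ :⊕ x₂)) (#0 $ x₁ :⊕ (x₀ :⊕ #0 $ x₂)) refl ⟩
  d ◃ (V ▹ b ▹ a) ⊕ ((a ◃ (d ◃ V)) ▹ b ⊕ d ◃ ((letter a ш V) ▹ b))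
    ≡⟨ cong (λ t → d ◃ (V ▹ b ▹ a) ⊕ ((a ◃ (d ◃ V)) ▹ b ⊕ t)) (◃-▹ d b (letter a ш V)) ⟨
  d ◃ (V ▹ b ▹ a) ⊕ ((a ◃ (d ◃ V)) ▹ b ⊕ (d ◃ (letter a ш V)) ▹ b)
    ≈⟨ ⊕-cong (≃-refl {d ◃ (V ▹ b ▹ a)}) (additive (▹-linear b) (a ◃ (d ◃ V)) (d ◃ (letter a ш V))) ⟨
  d ◃ (V ▹ b ▹ a) ⊕ (a ◃ (d ◃ V) ⊕ d ◃ (letter a ш V)) ▹ b
    ≈⟨ ⊕-cong (≃-refl {d ◃ (V ▹ b ▹ a)}) (congruent (▹-linear b) (≃-trans (◃-ш-◃ a d (word []) V) (⊕-cong (congruent (◃-linear a) (ш-identityˡ (d ◃ V))) ≃-refl))) ⟨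
  d ◃ (V ▹ b ▹ a) ⊕ (letter a ш (d ◃ V)) ▹ b ∎

▹-ш-▹-[] : ∀ a b v → letter a ш (word v ▹ b) ≃ (word v ▹ b) ▹ a ⊕ (letter a ш word v) ▹ b
▹-ш-▹-[] a b [] = begin
  letter a ш letter b                          ≈⟨ ш-word [ a ] [ b ] ⟩
  word (a ∷ b ∷ []) ⊕ word (b ∷ a ∷ [])        ≈⟨ ⊕-comm (word (a ∷ b ∷ [])) (word (b ∷ a ∷ [])) ⟩
  letter b ▹ a ⊕ letter a ▹ b                  ≈⟨ ⊕-cong (≃-refl {letter b ▹ a}) (congruent (▹-linear b) (ш-identityʳ (letter a))) ⟨
  letter b ▹ a ⊕ (letter a ш word []) ▹ b      ∎
▹-ш-▹-[] a b (d ∷ v) = ▹-ш-▹-[]-◃ a b d (word v) (▹-ш-▹-[] a b v)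

▹-ш-▹-word : ∀ a b u v → (word u ▹ a) ш (word v ▹ b) ≃ (word u ш (word v ▹ b)) ▹ a ⊕ ((word u ▹ a) ш word v) ▹ b
▹-ш-▹-word a b [] v = ≃-trans (▹-ш-▹-[] a b v)
  (⊕-cong (congruent (▹-linear a) (≃-sym (ш-identityˡ (word v ▹ b)))) (≃-refl {(letter a ш word v) ▹ b}))
▹-ш-▹-word a b u@(_ ∷ _) [] = begin
  (word u ▹ a) ш letter b                                  ≈⟨ ш-comm (word u ▹ a) (letter b) ⟩
  letter b ш (word u ▹ a)                                  ≈⟨ ▹-ш-▹-[] b a u ⟩
  word u ▹ a ▹ b ⊕ (letter b ш word u) ▹ a                 ≈⟨ ⊕-comm (word u ▹ a ▹ b) ((letter b ш word u) ▹ a) ⟩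
  (letter b ш word u) ▹ a ⊕ word u ▹ a ▹ b                 ≈⟨ ⊕-cong (congruent (▹-linear a) (ш-comm (letter b) (word u))) (congruent (▹-linear b) (≃-sym (ш-identityʳ (word u ▹ a)))) ⟩
  (word u ш letter b) ▹ a ⊕ ((word u ▹ a) ш word []) ▹ b   ∎
▹-ш-▹-word a b (c ∷ u) (d ∷ v) =
  ▹-ш-▹-◃ a b c d (word u) (word v) (▹-ш-▹-word a b u (d ∷ v)) (▹-ш-▹-word a b (c ∷ u) v)

▹-ш-▹ : ∀ a b p q → (p ▹ a) ш (q ▹ b) ≃ (p ш (q ▹ b)) ▹ a ⊕ ((p ▹ a) ш q) ▹ b
▹-ш-▹ a b = ext₂
  ((λ q → ш-linearˡ (q ▹ b) ∘ˡ ▹-linear a) , (λ p → ш-linearʳ (p ▹ a) ∘ˡ ▹-linear b))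
  ((λ q → (▹-linear a ∘ˡ ш-linearˡ (q ▹ b)) ⊕ˡ (▹-linear b ∘ˡ ш-linearˡ q ∘ˡ ▹-linear a)) ,
   (λ p → (▹-linear a ∘ˡ ш-linearʳ p ∘ˡ ▹-linear b) ⊕ˡ (▹-linear b ∘ˡ ш-linearʳ (p ▹ a))))
  (▹-ш-▹-word a b)

when : Bool → Poly → Poly
when b p = if b then p else 𝟘

when-linear : ∀ b → Linear (when b)
when-linear true  = idˡ
when-linear false = 𝟘ˡ

-- Removing the first or the last letter

εʷ : Word → Poly
εʷ []      = word []
εʷ (_ ∷ _) = 𝟘

stripˡʷ : Letter → Word → Poly
stripˡʷ a []      = 𝟘
stripˡʷ a (b ∷ w) = when (does (b ≟ˡ a)) (word w)

-- The recursion runs from the left; `εʷ w` detects that `b` is the last letter.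
stripʳʷ : Letter → Word → Poly
stripʳʷ a []      = 𝟘
stripʳʷ a (b ∷ w) = b ◃ stripʳʷ a w ⊕ when (does (b ≟ˡ a)) (εʷ w)

ε : Poly → Poly
ε = linear εʷ

stripˡ stripʳ : Letter → Poly → Poly
stripˡ a = linear (stripˡʷ a)
stripʳ a = linear (stripʳʷ a)

ε-linear : Linear ε
ε-linear = linear-linear εʷ

stripˡ-linear : ∀ a → Linear (stripˡ a)
stripˡ-linear a = linear-linear (stripˡʷ a)

stripʳ-linear : ∀ a → Linear (stripʳ a)
stripʳ-linear a = linear-linear (stripʳʷ a)

ε-◃ : ∀ a p → ε (a ◃ p) ≃ 𝟘
ε-◃ a = ext (ε-linear ∘ˡ ◃-linear a) 𝟘ˡ λ w → ≃-refl

εʷ-∷ʳ : ∀ w b → εʷ (w ∷ʳ b) ≡ 𝟘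
εʷ-∷ʳ []      b = refl
εʷ-∷ʳ (_ ∷ _) b = refl

ε-▹ : ∀ a p → ε (p ▹ a) ≃ 𝟘
ε-▹ a = ext (ε-linear ∘ˡ ▹-linear a) 𝟘ˡ λ w → ≃-trans (linear-word εʷ (w ∷ʳ a)) (≡⇒≃ (εʷ-∷ʳ w a))

stripˡ-◃ : ∀ a b p → stripˡ a (b ◃ p) ≃ when (does (b ≟ˡ a)) p
stripˡ-◃ a b = ext (stripˡ-linear a ∘ˡ ◃-linear b) (when-linear _) λ w → linear-word (stripˡʷ a) (b ∷ w)

stripʳ-◃ : ∀ a b p → stripʳ a (b ◃ p) ≃ b ◃ stripʳ a p ⊕ when (does (b ≟ˡ a)) (ε p)
stripʳ-◃ a b = ext (stripʳ-linear a ∘ˡ ◃-linear b)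
  ((◃-linear b ∘ˡ stripʳ-linear a) ⊕ˡ (when-linear (does (b ≟ˡ a)) ∘ˡ ε-linear))
  λ w → ≃-trans (linear-word (stripʳʷ a) (b ∷ w)) (≃-sym
    (⊕-cong (congruent (◃-linear b) (linear-word (stripʳʷ a) w)) (congruent (when-linear (does (b ≟ˡ a))) (linear-word εʷ w))))

stripˡ-▹ : ∀ a b p → stripˡ a (p ▹ b) ≃ stripˡ a p ▹ b ⊕ when (does (b ≟ˡ a)) (ε p)
stripˡ-▹ a b = ext (stripˡ-linear a ∘ˡ ▹-linear b)
  ((▹-linear b ∘ˡ stripˡ-linear a) ⊕ˡ (when-linear (does (b ≟ˡ a)) ∘ˡ ε-linear))
  on-word
  where
  on-word : ∀ w → stripˡ a (word (w ∷ʳ b)) ≃ stripˡ a (word w) ▹ b ⊕ when (does (b ≟ˡ a)) (ε (word w))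
  on-word [] = linear-word (stripˡʷ a) [ b ]
  on-word (c ∷ w) with does (c ≟ˡ a) | does (b ≟ˡ a)
  ... | true  | true  = ≃-refl
  ... | true  | false = ≃-refl
  ... | false | true  = ≃-refl
  ... | false | false = ≃-refl

when-null : ∀ b {p} → p ≃ 𝟘 → when b p ≃ 𝟘
when-null b = annihilates (when-linear b)

stripʳʷ-∷ʳ : ∀ a w b → stripʳʷ a (w ∷ʳ b) ≃ when (does (b ≟ˡ a)) (word w)
stripʳʷ-∷ʳ a []      b = ≃-refl
stripʳʷ-∷ʳ a (c ∷ w) b = begin
  c ◃ stripʳʷ a (w ∷ʳ b) ⊕ when (does (c ≟ˡ a)) (εʷ (w ∷ʳ b))
    ≈⟨ ⊕-cong (congruent (◃-linear c) (stripʳʷ-∷ʳ a w b)) (when-null (does (c ≟ˡ a)) (≡⇒≃ (εʷ-∷ʳ w b))) ⟩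
  c ◃ when (does (b ≟ˡ a)) (word w) ⊕ 𝟘
    ≈⟨ ⊕-identityʳ (c ◃ when (does (b ≟ˡ a)) (word w)) ⟩
  c ◃ when (does (b ≟ˡ a)) (word w)
    ≈⟨ ◃-when (does (b ≟ˡ a)) ⟩
  when (does (b ≟ˡ a)) (word (c ∷ w)) ∎
  where
  ◃-when : ∀ x → c ◃ when x (word w) ≃ when x (word (c ∷ w))
  ◃-when true  = ≃-refl
  ◃-when false = ≃-refl

stripʳ-▹ : ∀ a b p → stripʳ a (p ▹ b) ≃ when (does (b ≟ˡ a)) p
stripʳ-▹ a b = ext (stripʳ-linear a ∘ˡ ▹-linear b) (when-linear _) λ w →
  ≃-trans (linear-word (stripʳʷ a) (w ∷ʳ b)) (stripʳʷ-∷ʳ a w b)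

when-ш : ∀ b p q → when b p ш q ≃ when b (p ш q)
when-ш true  p q = ≃-refl
when-ш false p q = ≃-refl

ш-when : ∀ b p q → p ш when b q ≃ when b (p ш q)
ш-when true  p q = ≃-refl
ш-when false p q = null (ш-linearʳ p)

-- The first letter of a shuffle is the first letter of one of the two factors.
stripˡ-ш-word : ∀ c u v → stripˡ c (word u ш word v) ≃ stripˡ c (word u) ш word v ⊕ word u ш stripˡ c (word v)
stripˡ-ш-word c [] v = begin
  stripˡ c (word [] ш word v)  ≈⟨ congruent (stripˡ-linear c) (ш-identityˡ (word v)) ⟩
  stripˡ c (word v)            ≈⟨ ш-identityˡ (stripˡ c (word v)) ⟨
  word [] ш stripˡ c (word v)  ∎
stripˡ-ш-word c u@(_ ∷ _) [] = begin
  stripˡ c (word u ш word [])        ≈⟨ congruent (stripˡ-linear c) (ш-identityʳ (word u)) ⟩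
  stripˡ c (word u)                  ≈⟨ ш-identityʳ (stripˡ c (word u)) ⟨
  stripˡ c (word u) ш word []        ≈⟨ ⊕-identityʳ _ ⟨
  stripˡ c (word u) ш word [] ⊕ 𝟘    ∎
stripˡ-ш-word c (a ∷ u) (b ∷ v) = step (word u) (word v)
  where
  step : ∀ U V → stripˡ c ((a ◃ U) ш (b ◃ V)) ≃ stripˡ c (a ◃ U) ш (b ◃ V) ⊕ (a ◃ U) ш stripˡ c (b ◃ V)
  step U V = begin
    stripˡ c ((a ◃ U) ш (b ◃ V))
      ≈⟨ congruent (stripˡ-linear c) (◃-ш-◃ a b U V) ⟩
    stripˡ c (a ◃ (U ш (b ◃ V)) ⊕ b ◃ ((a ◃ U) ш V))
      ≈⟨ additive (stripˡ-linear c) (a ◃ (U ш (b ◃ V))) (b ◃ ((a ◃ U) ш V)) ⟩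
    stripˡ c (a ◃ (U ш (b ◃ V))) ⊕ stripˡ c (b ◃ ((a ◃ U) ш V))
      ≈⟨ ⊕-cong (stripˡ-◃ c a (U ш (b ◃ V))) (stripˡ-◃ c b ((a ◃ U) ш V)) ⟩
    when (does (a ≟ˡ c)) (U ш (b ◃ V)) ⊕ when (does (b ≟ˡ c)) ((a ◃ U) ш V)
      ≈⟨ ⊕-cong (when-ш (does (a ≟ˡ c)) U (b ◃ V)) (ш-when (does (b ≟ˡ c)) (a ◃ U) V) ⟨
    when (does (a ≟ˡ c)) U ш (b ◃ V) ⊕ (a ◃ U) ш when (does (b ≟ˡ c)) V
      ≈⟨ ⊕-cong (congruent (ш-linearˡ (b ◃ V)) (stripˡ-◃ c a U)) (congruent (ш-linearʳ (a ◃ U)) (stripˡ-◃ c b V)) ⟨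
    stripˡ c (a ◃ U) ш (b ◃ V) ⊕ (a ◃ U) ш stripˡ c (b ◃ V) ∎

stripʳ-ш-word : ∀ c u v → stripʳ c (word u ш word v) ≃ stripʳ c (word u) ш word v ⊕ word u ш stripʳ c (word v)
stripʳ-ш-word c u v with initLast u
... | [] = begin
  stripʳ c (word [] ш word v)  ≈⟨ congruent (stripʳ-linear c) (ш-identityˡ (word v)) ⟩
  stripʳ c (word v)            ≈⟨ ш-identityˡ (stripʳ c (word v)) ⟨
  word [] ш stripʳ c (word v)  ∎
... | u′ ∷ʳ′ a with initLast v
...   | [] = begin
  stripʳ c (word u ш word [])        ≈⟨ congruent (stripʳ-linear c) (ш-identityʳ (word u)) ⟩
  stripʳ c (word u)                  ≈⟨ ш-identityʳ (stripʳ c (word u)) ⟨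
  stripʳ c (word u) ш word []        ≈⟨ ⊕-identityʳ _ ⟨
  stripʳ c (word u) ш word [] ⊕ 𝟘    ≈⟨ ⊕-cong (≃-refl {stripʳ c (word u) ш word []}) (null (ш-linearʳ (word u))) ⟨
  stripʳ c (word u) ш word [] ⊕ word u ш 𝟘    ∎
...   | v′ ∷ʳ′ b = step (word u′) (word v′)
  where
  step : ∀ U V → stripʳ c ((U ▹ a) ш (V ▹ b)) ≃ stripʳ c (U ▹ a) ш (V ▹ b) ⊕ (U ▹ a) ш stripʳ c (V ▹ b)
  step U V = begin
    stripʳ c ((U ▹ a) ш (V ▹ b))
      ≈⟨ congruent (stripʳ-linear c) (▹-ш-▹ a b U V) ⟩
    stripʳ c ((U ш (V ▹ b)) ▹ a ⊕ ((U ▹ a) ш V) ▹ b)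
      ≈⟨ additive (stripʳ-linear c) ((U ш (V ▹ b)) ▹ a) (((U ▹ a) ш V) ▹ b) ⟩
    stripʳ c ((U ш (V ▹ b)) ▹ a) ⊕ stripʳ c (((U ▹ a) ш V) ▹ b)
      ≈⟨ ⊕-cong (stripʳ-▹ c a (U ш (V ▹ b))) (stripʳ-▹ c b ((U ▹ a) ш V)) ⟩
    when (does (a ≟ˡ c)) (U ш (V ▹ b)) ⊕ when (does (b ≟ˡ c)) ((U ▹ a) ш V)
      ≈⟨ ⊕-cong (when-ш (does (a ≟ˡ c)) U (V ▹ b)) (ш-when (does (b ≟ˡ c)) (U ▹ a) V) ⟨
    when (does (a ≟ˡ c)) U ш (V ▹ b) ⊕ (U ▹ a) ш when (does (b ≟ˡ c)) V
      ≈⟨ ⊕-cong (congruent (ш-linearˡ (V ▹ b)) (stripʳ-▹ c a U)) (congruent (ш-linearʳ (U ▹ a)) (stripʳ-▹ c b V)) ⟨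
    stripʳ c (U ▹ a) ш (V ▹ b) ⊕ (U ▹ a) ш stripʳ c (V ▹ b) ∎

-- Derivations of the shuffle product

Derivation : (Poly → Poly) → Set
Derivation D = ∀ p q → D (p ш q) ≃ D p ш q ⊕ p ш D q

derivation : ∀ {D} → Linear D → (∀ u v → D (word u ш word v) ≃ D (word u) ш word v ⊕ word u ш D (word v)) → Derivation D
derivation {D} L = ext₂ ((λ q → L ∘ˡ ш-linearˡ q) , (λ p → L ∘ˡ ш-linearʳ p))
  ((λ q → (ш-linearˡ q ∘ˡ L) ⊕ˡ ш-linearˡ (D q)) , (λ p → ш-linearʳ (D p) ⊕ˡ (ш-linearʳ p ∘ˡ L)))

stripˡ-ш : ∀ a → Derivation (stripˡ a)
stripˡ-ш a = derivation (stripˡ-linear a) (stripˡ-ш-word a)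

stripʳ-ш : ∀ a → Derivation (stripʳ a)
stripʳ-ш a = derivation (stripʳ-linear a) (stripʳ-ш-word a)

-- Membership in 𝒜_z⁰ and 𝒜_z⁻² will be expressed by kernels of derivations; this makes them closed
-- under ш.
derivation-null : ∀ {D} → Derivation D → ∀ {p q} → D p ≃ 𝟘 → D q ≃ 𝟘 → D (p ш q) ≃ 𝟘
derivation-null der {p} {q} hp hq = ≃-trans (der p q)
  (⊕-cong (congruent (ш-linearˡ q) hp) (annihilates (ш-linearʳ p) hq))

coeff-word-self : ∀ w → coeff (word w) w ≡ 1ℤ
coeff-word-self w with w ≟ʷ w
... | yes _  = refl
... | no w≢w = ⊥-elim (w≢w refl)

coeff-word-≢ : ∀ {v w} → v ≢ w → coeff (word v) w ≡ 0ℤ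
coeff-word-≢ {v} {w} v≢w with v ≟ʷ w
... | yes v≡w = ⊥-elim (v≢w v≡w)
... | no _    = refl

coeff-linear : ∀ f w w′ → (∀ v → coeff (f v) w ≡ coeff (word v) w′) → ∀ p → coeff (linear f p) w ≡ coeff p w′
coeff-linear f w w′ h []            = refl
coeff-linear f w w′ h ((c , v) ∷ p) = trans (coeff-⊕ (c • f v) (linear f p) w)
  (cong₂ _+ℤ_ (trans (coeff-• c (f v) w) (trans (cong (c *ℤ_) (h v)) head)) (coeff-linear f w w′ h p))
  where
  head : c *ℤ coeff (word v) w′ ≡ (if does (v ≟ʷ w′) then c else 0ℤ)
  head with does (v ≟ʷ w′)
  ... | true  = *-identityʳ c
  ... | false = *-zeroʳ c

-- Translates between kernels of `stripˡ a` and conditions on supports, in which `Span` is phrased.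
coeff-stripˡ : ∀ a p w → coeff (stripˡ a p) w ≡ coeff p (a ∷ w)
coeff-stripˡ a p w = coeff-linear (stripˡʷ a) w (a ∷ w) on-word p
  where
  on-word : ∀ v → coeff (stripˡʷ a v) w ≡ coeff (word v) (a ∷ w)
  on-word []      = refl
  on-word (b ∷ v) with b ≟ˡ a
  ... | no _     = refl
  ... | yes refl = refl

coeff-stripʳ : ∀ a p w → coeff (stripʳ a p) w ≡ coeff p (w ∷ʳ a)
coeff-stripʳ a p w = coeff-linear (stripʳʷ a) w (w ∷ʳ a) on-word p
  where
  ∷ʳ-≢ : ∀ w → [] ≢ w ∷ʳ a
  ∷ʳ-≢ []      ()
  ∷ʳ-≢ (_ ∷ _) ()
  on-word : ∀ v → coeff (stripʳʷ a v) w ≡ coeff (word v) (w ∷ʳ a)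
  on-word v with initLast v
  ... | [] = sym (coeff-word-≢ (∷ʳ-≢ w))
  ... | v′ ∷ʳ′ b = trans (coeff-≡ (stripʳʷ-∷ʳ a v′ b) w) cases
    where
    cases : coeff (when (does (b ≟ˡ a)) (word v′)) w ≡ coeff (word (v′ ∷ʳ b)) (w ∷ʳ a)
    cases with b ≟ˡ a
    ... | no b≢a = sym (coeff-word-≢ λ e → b≢a (proj₂ (∷ʳ-injective v′ w e)))
    ... | yes refl with v′ ≟ʷ w
    ...   | yes refl = sym (coeff-word-self (v′ ∷ʳ a))
    ...   | no v≢w   = sym (coeff-word-≢ λ e → v≢w (proj₁ (∷ʳ-injective v′ w e)))

-- Const and ∂_{α,β} under the shuffle product

Constʷ : Word → Poly
Constʷ w = if does (any? (_≟ˡ ez) w) then 𝟘 else word w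

Const-linear : Linear Const
Const-linear = linear-linear Constʷ

-- What `a ◃_` becomes behind `Const`.
keep : Letter → Poly → Poly
keep a p = if does (a ≟ˡ ez) then 𝟘 else a ◃ p

keep-linear : ∀ a → Linear (keep a)
keep-linear e0 = ◃-linear e0
keep-linear e1 = ◃-linear e1
keep-linear ez = 𝟘ˡ

keep-ш-keep : ∀ a b p q → keep a p ш keep b q ≃ keep a (p ш keep b q) ⊕ keep b (keep a p ш q)
keep-ш-keep e0 e0 p q = ◃-ш-◃ e0 e0 p q
keep-ш-keep e0 e1 p q = ◃-ш-◃ e0 e1 p q
keep-ш-keep e1 e0 p q = ◃-ш-◃ e1 e0 p q
keep-ш-keep e1 e1 p q = ◃-ш-◃ e1 e1 p q
keep-ш-keep ez e0 p q = ≃-refl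
keep-ш-keep ez e1 p q = ≃-refl
keep-ш-keep ez ez p q = ≃-refl
keep-ш-keep e0 ez p q = ≃-trans (null (ш-linearʳ (e0 ◃ p))) (≃-sym (≃-trans (⊕-identityʳ (e0 ◃ (p ш 𝟘))) (annihilates (◃-linear e0) (null (ш-linearʳ p)))))
keep-ш-keep e1 ez p q = ≃-trans (null (ш-linearʳ (e1 ◃ p))) (≃-sym (≃-trans (⊕-identityʳ (e1 ◃ (p ш 𝟘))) (annihilates (◃-linear e1) (null (ш-linearʳ p)))))

Constʷ-∷ : ∀ a w → Constʷ (a ∷ w) ≃ keep a (Constʷ w)
Constʷ-∷ ez w = ≃-refl
Constʷ-∷ e0 w with does (any? (_≟ˡ ez) w)
... | true  = ≃-refl
... | false = ≃-refl
Constʷ-∷ e1 w with does (any? (_≟ˡ ez) w)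
... | true  = ≃-refl
... | false = ≃-refl

Const-◃ : ∀ a p → Const (a ◃ p) ≃ keep a (Const p)
Const-◃ a = ext (Const-linear ∘ˡ ◃-linear a) (keep-linear a ∘ˡ Const-linear) λ w →
  ≃-trans (linear-word Constʷ (a ∷ w)) (≃-trans (Constʷ-∷ a w) (congruent (keep-linear a) (≃-sym (linear-word Constʷ w))))

Const-ш-word : ∀ u v → Const (word u ш word v) ≃ Const (word u) ш Const (word v)
Const-ш-word [] v = ≃-trans (congruent Const-linear (ш-identityˡ (word v))) (≃-sym (ш-identityˡ (Const (word v))))
Const-ш-word u@(_ ∷ _) [] = ≃-trans (congruent Const-linear (ш-identityʳ (word u))) (≃-sym (ш-identityʳ (Const (word u))))
Const-ш-word (a ∷ u) (b ∷ v) = step (word u) (word v) (Const-ш-word u (b ∷ v)) (Const-ш-word (a ∷ u) v)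
  where
  step : ∀ U V → Const (U ш (b ◃ V)) ≃ Const U ш Const (b ◃ V) → Const ((a ◃ U) ш V) ≃ Const (a ◃ U) ш Const V →
    Const ((a ◃ U) ш (b ◃ V)) ≃ Const (a ◃ U) ш Const (b ◃ V)
  step U V h₁ h₂ = begin
    Const ((a ◃ U) ш (b ◃ V))
      ≈⟨ congruent Const-linear (◃-ш-◃ a b U V) ⟩
    Const (a ◃ (U ш (b ◃ V)) ⊕ b ◃ ((a ◃ U) ш V))
      ≈⟨ additive Const-linear (a ◃ (U ш (b ◃ V))) (b ◃ ((a ◃ U) ш V)) ⟩
    Const (a ◃ (U ш (b ◃ V))) ⊕ Const (b ◃ ((a ◃ U) ш V))
      ≈⟨ ⊕-cong (Const-◃ a (U ш (b ◃ V))) (Const-◃ b ((a ◃ U) ш V)) ⟩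
    keep a (Const (U ш (b ◃ V))) ⊕ keep b (Const ((a ◃ U) ш V))
      ≈⟨ ⊕-cong (congruent (keep-linear a) (≃-trans h₁ (congruent (ш-linearʳ (Const U)) (Const-◃ b V))))
                (congruent (keep-linear b) (≃-trans h₂ (congruent (ш-linearˡ (Const V)) (Const-◃ a U)))) ⟩
    keep a (Const U ш keep b (Const V)) ⊕ keep b (keep a (Const U) ш Const V)
      ≈⟨ keep-ш-keep a b (Const U) (Const V) ⟨
    keep a (Const U) ш keep b (Const V)
      ≈⟨ ш-cong (Const-◃ a U) (Const-◃ b V) ⟨
    Const (a ◃ U) ш Const (b ◃ V) ∎

Const-ш : ∀ p q → Const (p ш q) ≃ Const p ш Const q
Const-ш = ext₂ ((λ q → Const-linear ∘ˡ ш-linearˡ q) , (λ p → Const-linear ∘ˡ ш-linearʳ p))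
  ((λ q → ш-linearˡ (Const q) ∘ˡ Const-linear) , (λ p → ш-linearʳ (Const p) ∘ˡ Const-linear))
  Const-ш-word

δ-sym : ∀ a b α β → δ a b α β ≡ δ b a α β
δ-sym a b α β = cong (λ x → if x then 1ℤ else 0ℤ)
  (trans (∨-comm (does (a ≟ˡ α) ∧ does (b ≟ˡ β)) _) (cong₂ _∨_ (∧-comm (does (a ≟ˡ β)) _) (∧-comm (does (a ≟ˡ α)) _)))

minus-• : ∀ c d p → (c -ℤ d) • p ≃ c • p ⊖ d • p
minus-• c d p = ≃-trans (+-• c (- d) p) (⊕-cong (≃-refl {c • p})
  (≃-trans (≡⇒≃ (cong (_• p) (sym (-1*i≡-i d)))) (≃-sym (•-• -1ℤ d p))))

module _ (α β : Letter) where

  ∂from : Letter → Poly → Poly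
  ∂from p = linear (∂ʷ α β p)

  ∂from-linear : ∀ p → Linear (∂from p)
  ∂from-linear p = linear-linear (∂ʷ α β p)

  -- The share of the leading coefficient in `∂ʷ` that depends on the letter after `a`. It is
  -- isolated because shuffling changes the first letter of the tail.
  weighʷ : Letter → Word → Poly
  weighʷ a w = δ a (next w) α β • word w

  weigh : Letter → Poly → Poly
  weigh a = linear (weighʷ a)

  weigh-linear : ∀ a → Linear (weigh a)
  weigh-linear a = linear-linear (weighʷ a)

  ∂from-◃ : ∀ p a q → ∂from p (a ◃ q) ≃ weigh a q ⊖ δ p a α β • q ⊕ a ◃ ∂from a q
  ∂from-◃ p a = ext (∂from-linear p ∘ˡ ◃-linear a)
    ((weigh-linear a ⊖ˡ (δ p a α β •ˡ idˡ)) ⊕ˡ (◃-linear a ∘ˡ ∂from-linear a)) λ w →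
    ≃-trans (linear-word (∂ʷ α β p) (a ∷ w)) (⊕-cong
      (≃-trans (minus-• (δ a (next w) α β) (δ p a α β) (word w)) (⊕-cong (≃-sym (linear-word (weighʷ a) w)) ≃-refl))
      (congruent (◃-linear a) (≃-sym (linear-word (∂ʷ α β a) w))))

  weigh-◃ : ∀ a b q → weigh a (b ◃ q) ≃ δ a b α β • b ◃ q
  weigh-◃ a b = ext (weigh-linear a ∘ˡ ◃-linear b) (δ a b α β •ˡ ◃-linear b) λ w → linear-word (weighʷ a) (b ∷ w)

  -- Words of the shuffle start with the first letter of `u` or with `b`. The first summand gives
  -- all of them the weight for `u`; the other two correct the weight of those starting with `b`.
  -- For empty `u` every word starts with `b`, and the two terms with the default weight from
  -- `next []` cancel.
  weigh-ш-◃ : ∀ a b u V → weigh a (word u ш (b ◃ V)) ≃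
    δ a (next u) α β • (word u ш (b ◃ V)) ⊕ δ a b α β • b ◃ (word u ш V) ⊖ δ a (next u) α β • b ◃ (word u ш V)
  weigh-ш-◃ a b [] V = begin
    weigh a (word [] ш (b ◃ V))
      ≈⟨ congruent (weigh-linear a) (ш-identityˡ (b ◃ V)) ⟩
    weigh a (b ◃ V)
      ≈⟨ weigh-◃ a b V ⟩
    d • b ◃ V
      ≈⟨ solve [] (d • b ◃ V ∷ k • b ◃ V ∷ []) x₀ (x₁ :⊕ x₀ :⊖ x₁) refl ⟩
    k • b ◃ V ⊕ d • b ◃ V ⊖ k • b ◃ V
      ≈⟨ ⊖-cong (⊕-cong (•-cong k (ш-identityˡ (b ◃ V))) (•-cong d (congruent (◃-linear b) (ш-identityˡ V))))
                (•-cong k (congruent (◃-linear b) (ш-identityˡ V))) ⟨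
    k • (word [] ш (b ◃ V)) ⊕ d • b ◃ (word [] ш V) ⊖ k • b ◃ (word [] ш V) ∎
    where
    k = δ a e1 α β
    d = δ a b α β
  weigh-ш-◃ a b (c ∷ u) V = step (word u)
    where
    k = δ a c α β
    d = δ a b α β
    step : ∀ U → weigh a ((c ◃ U) ш (b ◃ V)) ≃
      k • ((c ◃ U) ш (b ◃ V)) ⊕ d • b ◃ ((c ◃ U) ш V) ⊖ k • b ◃ ((c ◃ U) ш V)
    step U = begin
      weigh a ((c ◃ U) ш (b ◃ V))
        ≈⟨ congruent (weigh-linear a) (◃-ш-◃ c b U V) ⟩
      weigh a (c ◃ X ⊕ b ◃ Y)
        ≈⟨ additive (weigh-linear a) (c ◃ X) (b ◃ Y) ⟩
      weigh a (c ◃ X) ⊕ weigh a (b ◃ Y)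
        ≈⟨ ⊕-cong (weigh-◃ a c X) (weigh-◃ a b Y) ⟩
      k • c ◃ X ⊕ d • b ◃ Y
        ≈⟨ solve [] (k • c ◃ X ∷ d • b ◃ Y ∷ k • b ◃ Y ∷ []) (x₀ :⊕ x₁) (x₀ :⊕ x₂ :⊕ x₁ :⊖ x₂) refl ⟩
      k • c ◃ X ⊕ k • b ◃ Y ⊕ d • b ◃ Y ⊖ k • b ◃ Y
        ≈⟨ ⊖-cong (⊕-cong (≃-trans (•-cong k (◃-ш-◃ c b U V)) (•-⊕ k (c ◃ X) (b ◃ Y))) (≃-refl {d • b ◃ Y})) (≃-refl {k • b ◃ Y}) ⟨
      k • ((c ◃ U) ш (b ◃ V)) ⊕ d • b ◃ Y ⊖ k • b ◃ Y ∎
      where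
      X = U ш (b ◃ V)
      Y = (c ◃ U) ш V

  -- Fix a letter of one factor that is deleted, and sum over the places it may have occupied
  -- between its neighbours in that factor. The adjacencies with letters of the other factor
  -- telescope, because `δ` is symmetric and enters with opposite signs on the two sides. Only the
  -- adjacencies within the factor remain.
  ∂from-ш-word : ∀ p u v → ∂from p (word u ш word v) ≃ ∂from p (word u) ш word v ⊕ word u ш ∂from p (word v)
  ∂from-ш-word p [] v = begin
    ∂from p (word [] ш word v)  ≈⟨ congruent (∂from-linear p) (ш-identityˡ (word v)) ⟩
    ∂from p (word v)            ≈⟨ ш-identityˡ (∂from p (word v)) ⟨
    word [] ш ∂from p (word v)  ∎
  ∂from-ш-word p u@(_ ∷ _) [] = begin
    ∂from p (word u ш word [])        ≈⟨ congruent (∂from-linear p) (ш-identityʳ (word u)) ⟩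
    ∂from p (word u)                  ≈⟨ ш-identityʳ (∂from p (word u)) ⟨
    ∂from p (word u) ш word []        ≈⟨ ⊕-identityʳ (∂from p (word u) ш word []) ⟨
    ∂from p (word u) ш word [] ⊕ 𝟘    ∎
  ∂from-ш-word p (a ∷ u) (b ∷ v) =
    step (word u) (word v)
      (linear-word (weighʷ a) u) (linear-word (weighʷ b) v)
      (weigh-ш-◃ a b u (word v))
      (≃-trans (congruent (weigh-linear b) (ш-comm (a ◃ word u) (word v)))
        (≃-trans (weigh-ш-◃ b a v (word u))
          (⊖-cong (⊕-cong (•-cong l (ш-comm (word v) (a ◃ word u)))
                          (≃-trans (≡⇒≃ (cong (λ c → c • a ◃ (word v ш word u)) (δ-sym b a α β)))
                                   (•-cong d (congruent (◃-linear a) (ш-comm (word v) (word u))))))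
                  (•-cong l (congruent (◃-linear a) (ш-comm (word v) (word u)))))))
      (∂from-ш-word a u (b ∷ v)) (∂from-ш-word b (a ∷ u) v)
    where
    k = δ a (next u) α β
    l = δ b (next v) α β
    d = δ a b α β
    s = δ p a α β
    t = δ p b α β
    step : ∀ U V →
      weigh a U ≃ k • U → weigh b V ≃ l • V →
      weigh a (U ш (b ◃ V)) ≃ k • (U ш (b ◃ V)) ⊕ d • b ◃ (U ш V) ⊖ k • b ◃ (U ш V) →
      weigh b ((a ◃ U) ш V) ≃ l • ((a ◃ U) ш V) ⊕ d • a ◃ (U ш V) ⊖ l • a ◃ (U ш V) →
      ∂from a (U ш (b ◃ V)) ≃ ∂from a U ш (b ◃ V) ⊕ U ш ∂from a (b ◃ V) →
      ∂from b ((a ◃ U) ш V) ≃ ∂from b (a ◃ U) ш V ⊕ (a ◃ U) ш ∂from b V →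
      ∂from p ((a ◃ U) ш (b ◃ V)) ≃ ∂from p (a ◃ U) ш (b ◃ V) ⊕ (a ◃ U) ш ∂from p (b ◃ V)
    step U V wU wV wX wY hX hY = begin
      ∂from p (aU ш bV)
        ≈⟨ congruent (∂from-linear p) (◃-ш-◃ a b U V) ⟩
      ∂from p (a ◃ X ⊕ b ◃ Y)
        ≈⟨ additive (∂from-linear p) (a ◃ X) (b ◃ Y) ⟩
      ∂from p (a ◃ X) ⊕ ∂from p (b ◃ Y)
        ≈⟨ ⊕-cong (∂from-◃ p a X) (∂from-◃ p b Y) ⟩
      (weigh a X ⊖ s • X ⊕ a ◃ ∂from a X) ⊕ (weigh b Y ⊖ t • Y ⊕ b ◃ ∂from b Y)
        ≈⟨ ⊕-cong (⊕-cong (⊕-cong wX ≃-refl) aX) (⊕-cong (⊕-cong wY ≃-refl) bY) ⟩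
      ((k • X ⊕ d • b ◃ Z ⊖ k • b ◃ Z) ⊖ s • X ⊕ (A ⊕ (l • a ◃ Z ⊖ d • a ◃ Z ⊕ B)))
        ⊕ ((l • Y ⊕ d • a ◃ Z ⊖ l • a ◃ Z) ⊖ t • Y ⊕ ((k • b ◃ Z ⊖ d • b ◃ Z ⊕ C) ⊕ D))
        -- The multiples of `a ◃ Z` and `b ◃ Z` cancel in pairs; the rest is regrouped by the factor
        -- that is differentiated.
        ≈⟨ solve []
             (k • X ∷ d • b ◃ Z ∷ k • b ◃ Z ∷ s • X ∷ A ∷ l • a ◃ Z ∷ d • a ◃ Z ∷ B ∷ l • Y ∷ t • Y ∷ C ∷ D ∷ [])
             (((x₀ :⊕ x₁ :⊖ x₂) :⊖ x₃ :⊕ (x₄ :⊕ (x₅ :⊖ x₆ :⊕ x₇)))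
               :⊕ ((x₈ :⊕ x₆ :⊖ x₅) :⊖ x₉ :⊕ ((x₂ :⊖ x₁ :⊕ x₁₀) :⊕ x₁₁)))
             ((x₀ :⊖ x₃ :⊕ (x₄ :⊕ x₁₀)) :⊕ (x₈ :⊖ x₉ :⊕ (x₇ :⊕ x₁₁))) refl ⟩
      (k • X ⊖ s • X ⊕ (A ⊕ C)) ⊕ (l • Y ⊖ t • Y ⊕ (B ⊕ D))
        ≈⟨ ⊕-cong left right ⟨
      ∂from p aU ш bV ⊕ aU ш ∂from p bV ∎
      where
      aU = a ◃ U
      bV = b ◃ V
      X = U ш bV
      Y = aU ш V
      Z = U ш V
      A = a ◃ (∂from a U ш bV)
      B = a ◃ (U ш (b ◃ ∂from b V))
      C = b ◃ ((a ◃ ∂from a U) ш V)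
      D = b ◃ (aU ш ∂from b V)
      LX = ◃-linear a ∘ˡ ш-linearʳ U
      LY = ◃-linear b ∘ˡ ш-linearˡ V
      aX : a ◃ ∂from a X ≃ A ⊕ (l • a ◃ Z ⊖ d • a ◃ Z ⊕ B)
      aX = begin
        a ◃ ∂from a X
          ≈⟨ congruent (◃-linear a) hX ⟩
        a ◃ (∂from a U ш bV ⊕ U ш ∂from a bV)
          ≈⟨ additive (◃-linear a) (∂from a U ш bV) (U ш ∂from a bV) ⟩
        A ⊕ a ◃ (U ш ∂from a bV)
          ≈⟨ ⊕-cong (≃-refl {A}) (congruent LX (≃-trans (∂from-◃ a b V) (⊕-cong (⊕-cong wV ≃-refl) ≃-refl))) ⟩
        A ⊕ a ◃ (U ш (l • V ⊖ d • V ⊕ b ◃ ∂from b V))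
          ≈⟨ solve ((_ , LX) ∷ []) (A ∷ l • V ∷ d • V ∷ b ◃ ∂from b V ∷ [])
               (x₀ :⊕ #0 $ (x₁ :⊖ x₂ :⊕ x₃)) (x₀ :⊕ (#0 $ x₁ :⊖ #0 $ x₂ :⊕ #0 $ x₃)) refl ⟩
        A ⊕ (a ◃ (U ш (l • V)) ⊖ a ◃ (U ш (d • V)) ⊕ B)
          ≈⟨ ⊕-cong (≃-refl {A}) (⊕-cong (⊖-cong (scaling LX l V) (scaling LX d V)) ≃-refl) ⟩
        A ⊕ (l • a ◃ Z ⊖ d • a ◃ Z ⊕ B) ∎
      bY : b ◃ ∂from b Y ≃ (k • b ◃ Z ⊖ d • b ◃ Z ⊕ C) ⊕ D
      bY = begin
        b ◃ ∂from b Y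
          ≈⟨ congruent (◃-linear b) hY ⟩
        b ◃ (∂from b aU ш V ⊕ aU ш ∂from b V)
          ≈⟨ additive (◃-linear b) (∂from b aU ш V) (aU ш ∂from b V) ⟩
        b ◃ (∂from b aU ш V) ⊕ D
          ≈⟨ ⊕-cong (congruent LY (≃-trans (∂from-◃ b a U) (⊕-cong (⊖-cong wU (≡⇒≃ (cong (_• U) (δ-sym b a α β)))) ≃-refl))) (≃-refl {D}) ⟩
        b ◃ ((k • U ⊖ d • U ⊕ a ◃ ∂from a U) ш V) ⊕ D
          ≈⟨ solve ((_ , LY) ∷ []) (D ∷ k • U ∷ d • U ∷ a ◃ ∂from a U ∷ [])
               (#0 $ (x₁ :⊖ x₂ :⊕ x₃) :⊕ x₀) ((#0 $ x₁ :⊖ #0 $ x₂ :⊕ #0 $ x₃) :⊕ x₀) refl ⟩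
        (b ◃ ((k • U) ш V) ⊖ b ◃ ((d • U) ш V) ⊕ C) ⊕ D
          ≈⟨ ⊕-cong (⊕-cong (⊖-cong (scaling LY k U) (scaling LY d U)) (≃-refl {C})) (≃-refl {D}) ⟩
        (k • b ◃ Z ⊖ d • b ◃ Z ⊕ C) ⊕ D ∎
      left : ∂from p aU ш bV ≃ k • X ⊖ s • X ⊕ (A ⊕ C)
      left = begin
        ∂from p aU ш bV
          ≈⟨ congruent (ш-linearˡ bV) (≃-trans (∂from-◃ p a U) (⊕-cong (⊕-cong wU ≃-refl) ≃-refl)) ⟩
        (k • U ⊖ s • U ⊕ a ◃ ∂from a U) ш bV
          ≈⟨ solve ((_ , ш-linearˡ bV) ∷ []) (k • U ∷ s • U ∷ a ◃ ∂from a U ∷ [])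
               (#0 $ (x₀ :⊖ x₁ :⊕ x₂)) (#0 $ x₀ :⊖ #0 $ x₁ :⊕ #0 $ x₂) refl ⟩
        (k • U) ш bV ⊖ (s • U) ш bV ⊕ (a ◃ ∂from a U) ш bV
          ≈⟨ ⊕-cong (⊖-cong (scaling (ш-linearˡ bV) k U) (scaling (ш-linearˡ bV) s U)) (◃-ш-◃ a b (∂from a U) V) ⟩
        k • X ⊖ s • X ⊕ (A ⊕ C) ∎
      right : aU ш ∂from p bV ≃ l • Y ⊖ t • Y ⊕ (B ⊕ D)
      right = begin
        aU ш ∂from p bV
          ≈⟨ congruent (ш-linearʳ aU) (≃-trans (∂from-◃ p b V) (⊕-cong (⊕-cong wV ≃-refl) ≃-refl)) ⟩
        aU ш (l • V ⊖ t • V ⊕ b ◃ ∂from b V)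
          ≈⟨ solve ((_ , ш-linearʳ aU) ∷ []) (l • V ∷ t • V ∷ b ◃ ∂from b V ∷ [])
               (#0 $ (x₀ :⊖ x₁ :⊕ x₂)) (#0 $ x₀ :⊖ #0 $ x₁ :⊕ #0 $ x₂) refl ⟩
        aU ш (l • V) ⊖ aU ш (t • V) ⊕ aU ш (b ◃ ∂from b V)
          ≈⟨ ⊕-cong (⊖-cong (scaling (ш-linearʳ aU) l V) (scaling (ш-linearʳ aU) t V)) (◃-ш-◃ a b U (∂from b V)) ⟩
        l • Y ⊖ t • Y ⊕ (B ⊕ D) ∎

  ∂from-ш : ∀ p → Derivation (∂from p)
  ∂from-ш p = derivation (∂from-linear p) (∂from-ш-word p)

-- Recursion formulas for ∂_{α,β}

Σˡ : (Letter → Poly) → Poly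
Σˡ F = F e0 ⊕ F e1 ⊕ F ez

Σˡ-cong : ∀ {F G} → (∀ a → F a ≃ G a) → Σˡ F ≃ Σˡ G
Σˡ-cong h = ⊕-cong (⊕-cong (h e0) (h e1)) (h ez)

Σˡ-linear : ∀ {F : Letter → Poly → Poly} → (∀ a → Linear (F a)) → Linear (λ p → Σˡ λ a → F a p)
Σˡ-linear L = L e0 ⊕ˡ L e1 ⊕ˡ L ez

decompose : ∀ p → p ≃ ε p ⊕ Σˡ λ a → a ◃ stripˡ a p
decompose = ext idˡ (ε-linear ⊕ˡ Σˡ-linear λ a → ◃-linear a ∘ˡ stripˡ-linear a) on-word
  where
  on-word : ∀ w → word w ≃ ε (word w) ⊕ Σˡ λ a → a ◃ stripˡ a (word w)
  on-word []       = ≃-refl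
  on-word (e0 ∷ w) = ≃-refl
  on-word (e1 ∷ w) = ≃-refl
  on-word (ez ∷ w) = ≃-refl

module _ (α β : Letter) where

  weigh-expand : ∀ a p → weigh α β a p ≃ δ a e1 α β • ε p ⊕ Σˡ λ b → δ a b α β • b ◃ stripˡ b p
  weigh-expand a = ext (weigh-linear α β a)
    ((δ a e1 α β •ˡ ε-linear) ⊕ˡ Σˡ-linear λ b → δ a b α β •ˡ ◃-linear b ∘ˡ stripˡ-linear b) on-word
    where
    on-word : ∀ w → weigh α β a (word w) ≃ δ a e1 α β • ε (word w) ⊕ Σˡ λ b → δ a b α β • b ◃ stripˡ b (word w)
    on-word []       = 1• (δ a e1 α β • word [])
    on-word (e0 ∷ w) = 1• (δ a e0 α β • word (e0 ∷ w))
    on-word (e1 ∷ w) = 1• (δ a e1 α β • word (e1 ∷ w))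
    on-word (ez ∷ w) = 1• (δ a ez α β • word (ez ∷ w))

  -- The preceding letter enters only the coefficient of the term in which the first letter is
  -- deleted. This allows the recursion for `∂` to be stated with `∂` itself, whose preceding letter
  -- is always `e0`.
  ∂from-change : ∀ p q → ∂from α β p q ≃
    ∂ α β q ⊕ Σˡ λ b → δ e0 b α β • stripˡ b q ⊖ δ p b α β • stripˡ b q
  ∂from-change p = ext (∂from-linear α β p)
    (∂from-linear α β e0 ⊕ˡ Σˡ-linear λ b → (δ e0 b α β •ˡ stripˡ-linear b) ⊖ˡ (δ p b α β •ˡ stripˡ-linear b)) on-word
    where
    common : ∀ b w → ∂from α β p (word (b ∷ w)) ≃ ∂ α β (word (b ∷ w)) ⊕ (δ e0 b α β • word w ⊖ δ p b α β • word w)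
    common b w = begin
      ∂from α β p (word (b ∷ w))
        ≈⟨ linear-word (∂ʷ α β p) (b ∷ w) ⟩
      (x -ℤ s) • word w ⊕ Y
        ≈⟨ ⊕-cong (minus-• x s (word w)) (≃-refl {Y}) ⟩
      x • word w ⊖ s • word w ⊕ Y
        ≈⟨ solve [] (x • word w ∷ s • word w ∷ t • word w ∷ Y ∷ []) (x₀ :⊖ x₁ :⊕ x₃) ((x₀ :⊖ x₂ :⊕ x₃) :⊕ (x₂ :⊖ x₁)) refl ⟩
      (x • word w ⊖ t • word w ⊕ Y) ⊕ (t • word w ⊖ s • word w)
        ≈⟨ ⊕-cong (≃-trans (linear-word (∂ʷ α β e0) (b ∷ w)) (⊕-cong (minus-• x t (word w)) (≃-refl {Y}))) (≃-refl {t • word w ⊖ s • word w}) ⟨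
      ∂ α β (word (b ∷ w)) ⊕ (t • word w ⊖ s • word w) ∎
      where
      x = δ b (next w) α β
      s = δ p b α β
      t = δ e0 b α β
      Y = b ◃ ∂ʷ α β b w
    on-word : ∀ w → ∂from α β p (word w) ≃
      ∂ α β (word w) ⊕ Σˡ λ b → δ e0 b α β • stripˡ b (word w) ⊖ δ p b α β • stripˡ b (word w)
    on-word []       = ≃-refl
    on-word (e0 ∷ w) = common e0 w
    on-word (e1 ∷ w) = common e1 w
    on-word (ez ∷ w) = common ez w

  ∂-◃ : ∀ a p → ∂ α β (a ◃ p) ≃
    (δ a e1 α β • ε p ⊕ Σˡ λ b → δ a b α β • b ◃ stripˡ b p)
    ⊖ δ e0 a α β • (ε p ⊕ Σˡ λ b → b ◃ stripˡ b p)
    ⊕ a ◃ (∂ α β p ⊕ Σˡ λ b → δ e0 b α β • stripˡ b p ⊖ δ a b α β • stripˡ b p)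
  ∂-◃ a p = ≃-trans (∂from-◃ α β e0 a p)
    (⊕-cong (⊖-cong (weigh-expand a p) (•-cong (δ e0 a α β) (decompose p))) (congruent (◃-linear a) (∂from-change a p)))

  next-∷ʳ : ∀ v l c → next (v ∷ʳ l ∷ʳ c) ≡ next (v ∷ʳ l)
  next-∷ʳ []      l c = refl
  next-∷ʳ (_ ∷ _) l c = refl

  -- Appending `c` has two effects: the letter after `l` changes from the boundary `e1` to `c`, and
  -- there is a new term in which `c` is deleted.
  ∂ʷ-∷ʳ : ∀ p v l c → ∂ʷ α β p (v ∷ʳ l ∷ʳ c) ≃
    ∂ʷ α β p (v ∷ʳ l) ▹ c ⊕ (δ l c α β -ℤ δ l e1 α β) • word (v ∷ʳ c) ⊕ (δ c e1 α β -ℤ δ l c α β) • word (v ∷ʳ l)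
  ∂ʷ-∷ʳ p [] l c = begin
    (x -ℤ s) • W ⊕ ((y -ℤ x) • letter l ⊕ 𝟘)
      ≈⟨ ⊕-cong (minus-• x s W) ≃-refl ⟩
    x • W ⊖ s • W ⊕ ((y -ℤ x) • letter l ⊕ 𝟘)
      ≈⟨ solve [] (x • W ∷ s • W ∷ t • W ∷ (y -ℤ x) • letter l ∷ []) (x₀ :⊖ x₁ :⊕ (x₃ :⊕ :𝟘)) ((x₂ :⊖ x₁) :⊕ (x₀ :⊖ x₂) :⊕ x₃) refl ⟩
    (t • W ⊖ s • W) ⊕ (x • W ⊖ t • W) ⊕ (y -ℤ x) • letter l
      ≈⟨ ⊕-cong (⊕-cong (minus-• t s W) (minus-• x t W)) (≃-refl {(y -ℤ x) • letter l}) ⟨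
    (t -ℤ s) • W ⊕ (x -ℤ t) • W ⊕ (y -ℤ x) • letter l ∎
    where
    W = letter c
    x = δ l c α β
    y = δ c e1 α β
    s = δ p l α β
    t = δ l e1 α β
  ∂ʷ-∷ʳ p (a ∷ v) l c = begin
    (δ a (next (v ∷ʳ l ∷ʳ c)) α β -ℤ δ p a α β) • word (v ∷ʳ l ∷ʳ c) ⊕ a ◃ ∂ʷ α β a (v ∷ʳ l ∷ʳ c)
      ≈⟨ ⊕-cong (≡⇒≃ (cong (λ n → (δ a n α β -ℤ δ p a α β) • word (v ∷ʳ l ∷ʳ c)) (next-∷ʳ v l c)))
                (congruent (◃-linear a) (∂ʷ-∷ʳ a v l c)) ⟩
    H ⊕ a ◃ (T ▹ c ⊕ Y ⊕ Z)
      ≈⟨ solve ((_ , ◃-linear a) ∷ []) (H ∷ T ▹ c ∷ Y ∷ Z ∷ []) (x₀ :⊕ #0 $ (x₁ :⊕ x₂ :⊕ x₃)) (x₀ :⊕ #0 $ x₁ :⊕ #0 $ x₂ :⊕ #0 $ x₃) refl ⟩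
    H ⊕ a ◃ (T ▹ c) ⊕ a ◃ Y ⊕ a ◃ Z
      ≡⟨ cong (λ X → H ⊕ X ⊕ a ◃ Y ⊕ a ◃ Z) (◃-▹ a c T) ⟨
    H ⊕ (a ◃ T) ▹ c ⊕ a ◃ Y ⊕ a ◃ Z ∎
    where
    H = (δ a (next (v ∷ʳ l)) α β -ℤ δ p a α β) • word (v ∷ʳ l ∷ʳ c)
    T = ∂ʷ α β a (v ∷ʳ l)
    Y = (δ l c α β -ℤ δ l e1 α β) • word (v ∷ʳ c)
    Z = (δ c e1 α β -ℤ δ l c α β) • word (v ∷ʳ l)

  -- The sums over `b` sort `p` by its last letter. The final term treats the empty word, after
  -- which `c` is preceded by the boundary `e0`.
  ∂-▹ : ∀ c p → ∂ α β (p ▹ c) ≃ ∂ α β p ▹ c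
    ⊕ (Σˡ λ b → δ b c α β • stripʳ b p ▹ c ⊖ δ b e1 α β • stripʳ b p ▹ c)
    ⊕ δ c e1 α β • p ⊖ (Σˡ λ b → δ b c α β • stripʳ b p ▹ b) ⊖ δ e0 c α β • ε p
  ∂-▹ c = ext (∂from-linear α β e0 ∘ˡ ▹-linear c)
    ((▹-linear c ∘ˡ ∂from-linear α β e0)
      ⊕ˡ (Σˡ-linear λ b → (δ b c α β •ˡ ▹-linear c ∘ˡ stripʳ-linear b) ⊖ˡ (δ b e1 α β •ˡ ▹-linear c ∘ˡ stripʳ-linear b))
      ⊕ˡ (δ c e1 α β •ˡ idˡ)
      ⊖ˡ (Σˡ-linear λ b → δ b c α β •ˡ ▹-linear b ∘ˡ stripʳ-linear b)
      ⊖ˡ (δ e0 c α β •ˡ ε-linear)) on-word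
    where
    R : Word → Poly
    R w = ∂ α β (word w) ▹ c
      ⊕ (Σˡ λ b → δ b c α β • stripʳ b (word w) ▹ c ⊖ δ b e1 α β • stripʳ b (word w) ▹ c)
      ⊕ δ c e1 α β • word w ⊖ (Σˡ λ b → δ b c α β • stripʳ b (word w) ▹ b) ⊖ δ e0 c α β • ε (word w)
    snoc : ∀ v l → ∂ α β (word (v ∷ʳ l ∷ʳ c)) ≃ ∂ α β (word (v ∷ʳ l)) ▹ c
      ⊕ (δ l c α β • word v ▹ c ⊖ δ l e1 α β • word v ▹ c) ⊕ δ c e1 α β • word (v ∷ʳ l) ⊖ δ l c α β • word v ▹ l
    snoc v l = begin
      ∂ α β (word (v ∷ʳ l ∷ʳ c))
        ≈⟨ linear-word (∂ʷ α β e0) (v ∷ʳ l ∷ʳ c) ⟩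
      ∂ʷ α β e0 (v ∷ʳ l ∷ʳ c)
        ≈⟨ ∂ʷ-∷ʳ e0 v l c ⟩
      ∂ʷ α β e0 (v ∷ʳ l) ▹ c ⊕ (δ l c α β -ℤ δ l e1 α β) • word (v ∷ʳ c) ⊕ (δ c e1 α β -ℤ δ l c α β) • word (v ∷ʳ l)
        ≈⟨ ⊕-cong (⊕-cong (congruent (▹-linear c) (≃-sym (linear-word (∂ʷ α β e0) (v ∷ʳ l))))
             (minus-• (δ l c α β) (δ l e1 α β) (word (v ∷ʳ c)))) (minus-• (δ c e1 α β) (δ l c α β) (word (v ∷ʳ l))) ⟩
      X ⊕ (A ⊖ B) ⊕ (C ⊖ D)
        ≈⟨ solve [] (X ∷ A ∷ B ∷ C ∷ D ∷ []) (x₀ :⊕ (x₁ :⊖ x₂) :⊕ (x₃ :⊖ x₄)) (x₀ :⊕ (x₁ :⊖ x₂) :⊕ x₃ :⊖ x₄) refl ⟩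
      X ⊕ (A ⊖ B) ⊕ C ⊖ D ∎
      where
      X = ∂ α β (word (v ∷ʳ l)) ▹ c
      A = δ l c α β • word (v ∷ʳ c)
      B = δ l e1 α β • word (v ∷ʳ c)
      C = δ c e1 α β • word (v ∷ʳ l)
      D = δ l c α β • word (v ∷ʳ l)
    strips : ∀ v l → R (v ∷ʳ l) ≃ ∂ α β (word (v ∷ʳ l)) ▹ c
      ⊕ (Σˡ λ b → δ b c α β • when (does (l ≟ˡ b)) (word v) ▹ c ⊖ δ b e1 α β • when (does (l ≟ˡ b)) (word v) ▹ c)
      ⊕ δ c e1 α β • word (v ∷ʳ l) ⊖ (Σˡ λ b → δ b c α β • when (does (l ≟ˡ b)) (word v) ▹ b) ⊖ δ e0 c α β • 𝟘
    strips v l = ⊖-cong (⊖-cong (⊕-cong (⊕-cong (≃-refl {∂ α β (word (v ∷ʳ l)) ▹ c})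
        (Σˡ-cong λ b → ⊖-cong (•-cong (δ b c α β) (congruent (▹-linear c) (sr b))) (•-cong (δ b e1 α β) (congruent (▹-linear c) (sr b)))))
        (≃-refl {δ c e1 α β • word (v ∷ʳ l)}))
        (Σˡ-cong λ b → •-cong (δ b c α β) (congruent (▹-linear b) (sr b))))
        (•-cong (δ e0 c α β) (ε-▹ l (word v)))
      where
      sr : ∀ b → stripʳ b (word (v ∷ʳ l)) ≃ when (does (l ≟ˡ b)) (word v)
      sr b = stripʳ-▹ b l (word v)
    on-word : ∀ w → ∂ α β (word (w ∷ʳ c)) ≃ R w
    on-word w with initLast w
    ... | [] = begin
      ∂ α β (letter c)                                     ≈⟨ linear-word (∂ʷ α β e0) [ c ] ⟩
      (δ c e1 α β -ℤ δ e0 c α β) • word [] ⊕ 𝟘             ≈⟨ ⊕-identityʳ ((δ c e1 α β -ℤ δ e0 c α β) • word []) ⟩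
      (δ c e1 α β -ℤ δ e0 c α β) • word []                 ≈⟨ minus-• (δ c e1 α β) (δ e0 c α β) (word []) ⟩
      R []                                                 ∎
    ... | v ∷ʳ′ e0 = ≃-trans (snoc v e0) (≃-trans (solve []
      (∂ α β (word (v ∷ʳ e0)) ▹ c ∷ δ e0 c α β • word v ▹ c ∷ δ e0 e1 α β • word v ▹ c ∷ δ c e1 α β • word (v ∷ʳ e0) ∷ δ e0 c α β • word v ▹ e0 ∷ [])
      (x₀ :⊕ (x₁ :⊖ x₂) :⊕ x₃ :⊖ x₄)
      (x₀ :⊕ ((x₁ :⊖ x₂) :⊕ :𝟘 :⊕ :𝟘) :⊕ x₃ :⊖ (x₄ :⊕ :𝟘 :⊕ :𝟘) :⊖ :𝟘) refl) (≃-sym (strips v e0)))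
    ... | v ∷ʳ′ e1 = ≃-trans (snoc v e1) (≃-trans (solve []
      (∂ α β (word (v ∷ʳ e1)) ▹ c ∷ δ e1 c α β • word v ▹ c ∷ δ e1 e1 α β • word v ▹ c ∷ δ c e1 α β • word (v ∷ʳ e1) ∷ δ e1 c α β • word v ▹ e1 ∷ [])
      (x₀ :⊕ (x₁ :⊖ x₂) :⊕ x₃ :⊖ x₄)
      (x₀ :⊕ (:𝟘 :⊕ (x₁ :⊖ x₂) :⊕ :𝟘) :⊕ x₃ :⊖ (:𝟘 :⊕ x₄ :⊕ :𝟘) :⊖ :𝟘) refl) (≃-sym (strips v e1)))
    ... | v ∷ʳ′ ez = ≃-trans (snoc v ez) (≃-trans (solve []
      (∂ α β (word (v ∷ʳ ez)) ▹ c ∷ δ ez c α β • word v ▹ c ∷ δ ez e1 α β • word v ▹ c ∷ δ c e1 α β • word (v ∷ʳ ez) ∷ δ ez c α β • word v ▹ ez ∷ [])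
      (x₀ :⊕ (x₁ :⊖ x₂) :⊕ x₃ :⊖ x₄)
      (x₀ :⊕ (:𝟘 :⊕ :𝟘 :⊕ (x₁ :⊖ x₂)) :⊕ x₃ :⊖ (:𝟘 :⊕ :𝟘 :⊕ x₄) :⊖ :𝟘) refl) (≃-sym (strips v ez)))

decomposeʳ : ∀ p → p ≃ ε p ⊕ Σˡ λ a → stripʳ a p ▹ a
decomposeʳ = ext idˡ (ε-linear ⊕ˡ Σˡ-linear λ a → ▹-linear a ∘ˡ stripʳ-linear a) on-word
  where
  strips : ∀ w l → ε (word (w ∷ʳ l)) ⊕ (Σˡ λ a → stripʳ a (word (w ∷ʳ l)) ▹ a) ≃ Σˡ λ a → when (does (l ≟ˡ a)) (word w) ▹ a
  strips w l = ⊕-cong (ε-▹ l (word w)) (Σˡ-cong λ a → congruent (▹-linear a) (stripʳ-▹ a l (word w)))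
  on-word : ∀ w → word w ≃ ε (word w) ⊕ Σˡ λ a → stripʳ a (word w) ▹ a
  on-word w with initLast w
  ... | []       = ≃-refl
  ... | v ∷ʳ′ e0 = ≃-sym (strips v e0)
  ... | v ∷ʳ′ e1 = ≃-sym (strips v e1)
  ... | v ∷ʳ′ ez = ≃-sym (strips v ez)

-- Up to sign, the operators dual to `ez` and `e0`. Passing to the sum `K` pays off because it
-- treats `e0` and `e1` alike: it commutes with `τz` on the whole ring, so that only `J` needs
-- boundary terms.
J K : Poly → Poly
J = ∂ ez e1
K p = ∂ ez e0 p ⊕ ∂ ez e1 p

J-linear : Linear J
J-linear = ∂from-linear ez e1 e0

K-linear : Linear K
K-linear = ∂from-linear ez e0 e0 ⊕ˡ J-linear

index : Letter → Fin 3
index e0 = #0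
index e1 = #1
index ez = #2

◃-ops ▹-ops : Vec Op 3
◃-ops = (_ , ◃-linear e0) ∷ (_ , ◃-linear e1) ∷ (_ , ◃-linear ez) ∷ []
▹-ops = (_ , ▹-linear e0) ∷ (_ , ▹-linear e1) ∷ (_ , ▹-linear ez) ∷ []

◃-atoms ▹-atoms : Poly → Vec Poly 7
◃-atoms p = p ∷ ∂ ez e0 p ∷ ∂ ez e1 p ∷ ε p ∷ stripˡ e0 p ∷ stripˡ e1 p ∷ stripˡ ez p ∷ []
▹-atoms p = p ∷ ∂ ez e0 p ∷ ∂ ez e1 p ∷ ε p ∷ stripʳ e0 p ∷ stripʳ e1 p ∷ stripʳ ez p ∷ []

strip-var : ∀ {k} → Letter → Expr k 7
strip-var e0 = x₄
strip-var e1 = x₅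
strip-var ez = x₆

Σᵉ : ∀ {k n} → (Letter → Expr k n) → Expr k n
Σᵉ F = F e0 :⊕ F e1 :⊕ F ez

-- The right-hand sides of ∂-◃ and ∂-▹.
◃-expr ▹-expr : (α β a : Letter) → Expr 3 7 → Expr 3 7
◃-expr α β a ∂p =
  (δ a e1 α β :• x₃ :⊕ Σᵉ λ b → δ a b α β :• index b $ strip-var b)
  :⊖ δ e0 a α β :• (x₃ :⊕ Σᵉ λ b → index b $ strip-var b)
  :⊕ index a $ (∂p :⊕ Σᵉ λ b → δ e0 b α β :• strip-var b :⊖ δ a b α β :• strip-var b)
▹-expr α β c ∂p = index c $ ∂p
  :⊕ (Σᵉ λ b → δ b c α β :• index c $ strip-var b :⊖ δ b e1 α β :• index c $ strip-var b)
  :⊕ δ c e1 α β :• x₀ :⊖ (Σᵉ λ b → δ b c α β :• index b $ strip-var b) :⊖ δ e0 c α β :• x₃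

◃-K-expr ▹-K-expr : Letter → Expr 3 7
◃-K-expr a = ◃-expr ez e0 a x₁ :⊕ ◃-expr ez e1 a x₂
▹-K-expr c = ▹-expr ez e0 c x₁ :⊕ ▹-expr ez e1 c x₂

J-◃-e0 : ∀ p → J (e0 ◃ p) ≃ e0 ◃ J p
J-◃-e0 p = ≃-trans (∂-◃ ez e1 e0 p) (solve ◃-ops (◃-atoms p) (◃-expr ez e1 e0 x₂) (#0 $ x₂) refl)

J-◃-e1 : ∀ p → J (e1 ◃ p) ≃ e1 ◃ J p ⊕ (ez ◃ stripˡ ez p ⊖ e1 ◃ stripˡ ez p)
J-◃-e1 p = ≃-trans (∂-◃ ez e1 e1 p) (solve ◃-ops (◃-atoms p) (◃-expr ez e1 e1 x₂)
  (#1 $ x₂ :⊕ (#2 $ x₆ :⊖ #1 $ x₆)) refl)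

J-◃-ez : ∀ p → J (ez ◃ p) ≃ ez ◃ J p ⊕ (e1 ◃ stripˡ e1 p ⊖ ez ◃ stripˡ e1 p) ⊕ ε p
J-◃-ez p = ≃-trans (∂-◃ ez e1 ez p) (solve ◃-ops (◃-atoms p) (◃-expr ez e1 ez x₂)
  (#2 $ x₂ :⊕ (#1 $ x₅ :⊖ #2 $ x₅) :⊕ x₃) refl)

K-◃-e0 : ∀ p → K (e0 ◃ p) ≃ e0 ◃ K p ⊕ ez ◃ stripˡ ez p
K-◃-e0 p = ≃-trans (⊕-cong (∂-◃ ez e0 e0 p) (∂-◃ ez e1 e0 p)) (solve ◃-ops (◃-atoms p) (◃-K-expr e0)
  (#0 $ (x₁ :⊕ x₂) :⊕ #2 $ x₆) refl)

K-◃-e1 : ∀ p → K (e1 ◃ p) ≃ e1 ◃ K p ⊕ ez ◃ stripˡ ez p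
K-◃-e1 p = ≃-trans (⊕-cong (∂-◃ ez e0 e1 p) (∂-◃ ez e1 e1 p)) (solve ◃-ops (◃-atoms p) (◃-K-expr e1)
  (#1 $ (x₁ :⊕ x₂) :⊕ #2 $ x₆) refl)

K-◃-ez : ∀ p → K (ez ◃ p) ≃ ez ◃ K p ⊖ (ez ◃ stripˡ e0 p ⊕ ez ◃ stripˡ e1 p)
K-◃-ez p = ≃-trans (⊕-cong (∂-◃ ez e0 ez p) (∂-◃ ez e1 ez p)) (solve ◃-ops (◃-atoms p) (◃-K-expr ez)
  (#2 $ (x₁ :⊕ x₂) :⊖ (#2 $ x₄ :⊕ #2 $ x₅)) refl)

J-▹-e0 : ∀ p → J (p ▹ e0) ≃ J p ▹ e0 ⊖ stripʳ ez p ▹ e0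
J-▹-e0 p = ≃-trans (∂-▹ ez e1 e0 p) (solve ▹-ops (▹-atoms p) (▹-expr ez e1 e0 x₂)
  (#0 $ x₂ :⊖ #0 $ x₆) refl)

J-▹-e1 : ∀ p → J (p ▹ e1) ≃ J p ▹ e1 ⊖ stripʳ ez p ▹ ez
J-▹-e1 p = ≃-trans (∂-▹ ez e1 e1 p) (solve ▹-ops (▹-atoms p) (▹-expr ez e1 e1 x₂)
  (#1 $ x₂ :⊖ #2 $ x₆) refl)

J-▹-ez : ∀ p → J (p ▹ ez) ≃ J p ▹ ez ⊖ stripʳ ez p ▹ ez ⊕ stripʳ e1 p ▹ ez ⊖ stripʳ e1 p ▹ e1 ⊕ p
J-▹-ez p = ≃-trans (∂-▹ ez e1 ez p) (solve ▹-ops (▹-atoms p) (▹-expr ez e1 ez x₂)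
  (#2 $ x₂ :⊖ #2 $ x₆ :⊕ #2 $ x₅ :⊖ #1 $ x₅ :⊕ x₀) refl)

K-▹-e0 : ∀ p → K (p ▹ e0) ≃ K p ▹ e0 ⊖ stripʳ ez p ▹ ez
K-▹-e0 p = ≃-trans (⊕-cong (∂-▹ ez e0 e0 p) (∂-▹ ez e1 e0 p)) (solve ▹-ops (▹-atoms p) (▹-K-expr e0)
  (#0 $ (x₁ :⊕ x₂) :⊖ #2 $ x₆) refl)

K-▹-e1 : ∀ p → K (p ▹ e1) ≃ K p ▹ e1 ⊖ stripʳ ez p ▹ ez
K-▹-e1 p = ≃-trans (⊕-cong (∂-▹ ez e0 e1 p) (∂-▹ ez e1 e1 p)) (solve ▹-ops (▹-atoms p) (▹-K-expr e1)
  (#1 $ (x₁ :⊕ x₂) :⊖ #2 $ x₆) refl)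

-- Besides the stated terms the expansion contains `p` minus its decomposition by last letters,
-- which is zero. The share of a final `ez` in that decomposition comes from its lost adjacency with
-- the boundary letter 1.
K-▹-ez : ∀ p → K (p ▹ ez) ≃ K p ▹ ez ⊕ (stripʳ e0 p ▹ ez ⊕ stripʳ e1 p ▹ ez)
K-▹-ez p = ≃-trans (⊕-cong (∂-▹ ez e0 ez p) (∂-▹ ez e1 ez p)) (≃-trans (solve ▹-ops (▹-atoms p) (▹-K-expr ez)
  (#2 $ (x₁ :⊕ x₂) :⊕ (#2 $ x₄ :⊕ #2 $ x₅) :⊕ (x₀ :⊖ (x₃ :⊕ Σᵉ λ a → index a $ strip-var a))) refl)
  (≃-trans (⊕-cong (≃-refl {target}) (⊖-null (decomposeʳ p))) (⊕-identityʳ target)))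
  where target = K p ▹ ez ⊕ (stripʳ e0 p ▹ ez ⊕ stripʳ e1 p ▹ ez)

-- Stability of 𝒜_z⁰ under `J` and `K`

null-⊕ : ∀ {F} → Linear F → ∀ p q → F p ≃ 𝟘 → F q ≃ 𝟘 → F (p ⊕ q) ≃ 𝟘
null-⊕ L p q hp hq = ≃-trans (additive L p q) (⊕-cong hp hq)

null-• : ∀ {F} → Linear F → ∀ c p → F p ≃ 𝟘 → F (c • p) ≃ 𝟘
null-• L c p hp = ≃-trans (scaling L c p) (•-cong c hp)

null-⊖ : ∀ {F} → Linear F → ∀ p q → F p ≃ 𝟘 → F q ≃ 𝟘 → F (p ⊖ q) ≃ 𝟘
null-⊖ L p q hp hq = null-⊕ L p (-1ℤ • q) hp (null-• L -1ℤ q hq)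

stripˡ-e0-J : ∀ p → stripˡ e0 (J p) ≃ J (stripˡ e0 p)
stripˡ-e0-J = ext (L ∘ˡ J-linear) (J-linear ∘ˡ L) on-word
  where
  L = stripˡ-linear e0
  on-word : ∀ w → stripˡ e0 (J (word w)) ≃ J (stripˡ e0 (word w))
  on-word []       = ≃-refl
  on-word (e0 ∷ w) = ≃-trans (congruent L (J-◃-e0 (word w))) (stripˡ-◃ e0 e0 (J (word w)))
  on-word (e1 ∷ w) = ≃-trans (congruent L (J-◃-e1 (word w)))
    (null-⊕ L (e1 ◃ X) (ez ◃ Y ⊖ e1 ◃ Y) (stripˡ-◃ e0 e1 X)
      (null-⊖ L (ez ◃ Y) (e1 ◃ Y) (stripˡ-◃ e0 ez Y) (stripˡ-◃ e0 e1 Y)))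
    where
    X = J (word w)
    Y = stripˡ ez (word w)
  on-word (ez ∷ w) = ≃-trans (congruent L (J-◃-ez (word w)))
    (null-⊕ L (ez ◃ X ⊕ (e1 ◃ Y ⊖ ez ◃ Y)) (ε (word w))
      (null-⊕ L (ez ◃ X) (e1 ◃ Y ⊖ ez ◃ Y) (stripˡ-◃ e0 ez X)
        (null-⊖ L (e1 ◃ Y) (ez ◃ Y) (stripˡ-◃ e0 e1 Y) (stripˡ-◃ e0 ez Y)))
      (stripˡ-ε w))
    where
    X = J (word w)
    Y = stripˡ e1 (word w)
    stripˡ-ε : ∀ w → stripˡ e0 (ε (word w)) ≃ 𝟘
    stripˡ-ε []      = ≃-refl
    stripˡ-ε (_ ∷ _) = ≃-refl

stripˡ-e0-K : ∀ p → stripˡ e0 (K p) ≃ K (stripˡ e0 p)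
stripˡ-e0-K = ext (L ∘ˡ K-linear) (K-linear ∘ˡ L) on-word
  where
  L = stripˡ-linear e0
  on-word : ∀ w → stripˡ e0 (K (word w)) ≃ K (stripˡ e0 (word w))
  on-word []       = ≃-refl
  on-word (e0 ∷ w) = ≃-trans (congruent L (K-◃-e0 (word w))) (≃-trans (additive L (e0 ◃ X) (ez ◃ Y))
    (≃-trans (⊕-cong (stripˡ-◃ e0 e0 X) (stripˡ-◃ e0 ez Y)) (⊕-identityʳ X)))
    where
    X = K (word w)
    Y = stripˡ ez (word w)
  on-word (e1 ∷ w) = ≃-trans (congruent L (K-◃-e1 (word w)))
    (null-⊕ L (e1 ◃ X) (ez ◃ Y) (stripˡ-◃ e0 e1 X) (stripˡ-◃ e0 ez Y))
    where
    X = K (word w)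
    Y = stripˡ ez (word w)
  on-word (ez ∷ w) = ≃-trans (congruent L (K-◃-ez (word w)))
    (null-⊖ L (ez ◃ X) (ez ◃ Y ⊕ ez ◃ Z) (stripˡ-◃ e0 ez X)
      (null-⊕ L (ez ◃ Y) (ez ◃ Z) (stripˡ-◃ e0 ez Y) (stripˡ-◃ e0 ez Z)))
    where
    X = K (word w)
    Y = stripˡ e0 (word w)
    Z = stripˡ e1 (word w)

∷ʳ-ext : ∀ {F G} → Linear F → Linear G → F (word []) ≃ G (word []) → (∀ a p → F (p ▹ a) ≃ G (p ▹ a)) →
         ∀ p → F p ≃ G p
∷ʳ-ext {F} {G} LF LG base step = ext LF LG on-word
  where
  on-word : ∀ w → F (word w) ≃ G (word w)
  on-word w with initLast w
  ... | []       = base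
  ... | v ∷ʳ′ a  = step a (word v)

-- The case of a final `ez` is the delicate one: the summand `p` in `J-▹-ez` brings in words ending
-- in `e1`, and `stripʳ e1 p ▹ e1` takes away exactly these.
stripʳ-e1-J : ∀ p → stripʳ e1 (J p) ≃ J (stripʳ e1 p)
stripʳ-e1-J = ∷ʳ-ext (L ∘ˡ J-linear) (J-linear ∘ˡ L) ≃-refl step
  where
  L = stripʳ-linear e1
  step : ∀ a p → stripʳ e1 (J (p ▹ a)) ≃ J (stripʳ e1 (p ▹ a))
  step e0 p = begin
    stripʳ e1 (J (p ▹ e0))                       ≈⟨ congruent L (J-▹-e0 p) ⟩
    stripʳ e1 (J p ▹ e0 ⊖ stripʳ ez p ▹ e0)      ≈⟨ null-⊖ L (J p ▹ e0) (stripʳ ez p ▹ e0) (stripʳ-▹ e1 e0 (J p)) (stripʳ-▹ e1 e0 (stripʳ ez p)) ⟩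
    𝟘                                            ≈⟨ annihilates J-linear (stripʳ-▹ e1 e0 p) ⟨
    J (stripʳ e1 (p ▹ e0))                       ∎
  step e1 p = begin
    stripʳ e1 (J (p ▹ e1))                                   ≈⟨ congruent L (J-▹-e1 p) ⟩
    stripʳ e1 (J p ▹ e1 ⊖ stripʳ ez p ▹ ez)                  ≈⟨ subtractive L (J p ▹ e1) (stripʳ ez p ▹ ez) ⟩
    stripʳ e1 (J p ▹ e1) ⊖ stripʳ e1 (stripʳ ez p ▹ ez)      ≈⟨ ⊖-cong (stripʳ-▹ e1 e1 (J p)) (stripʳ-▹ e1 ez (stripʳ ez p)) ⟩
    J p ⊖ 𝟘                                                  ≈⟨ ⊕-identityʳ (J p) ⟩
    J p                                                      ≈⟨ congruent J-linear (stripʳ-▹ e1 e1 p) ⟨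
    J (stripʳ e1 (p ▹ e1))                                   ∎
  step ez p = begin
    stripʳ e1 (J (p ▹ ez))
      ≈⟨ congruent L (J-▹-ez p) ⟩
    stripʳ e1 (J p ▹ ez ⊖ Z ▹ ez ⊕ Y ▹ ez ⊖ Y ▹ e1 ⊕ p)
      ≈⟨ solve ((_ , L) ∷ []) (J p ▹ ez ∷ Z ▹ ez ∷ Y ▹ ez ∷ Y ▹ e1 ∷ p ∷ [])
           (#0 $ (x₀ :⊖ x₁ :⊕ x₂ :⊖ x₃ :⊕ x₄)) (#0 $ x₀ :⊖ #0 $ x₁ :⊕ #0 $ x₂ :⊖ #0 $ x₃ :⊕ #0 $ x₄) refl ⟩
    stripʳ e1 (J p ▹ ez) ⊖ stripʳ e1 (Z ▹ ez) ⊕ stripʳ e1 (Y ▹ ez) ⊖ stripʳ e1 (Y ▹ e1) ⊕ Y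
      ≈⟨ ⊕-cong (⊖-cong (⊕-cong (⊖-cong (stripʳ-▹ e1 ez (J p)) (stripʳ-▹ e1 ez Z)) (stripʳ-▹ e1 ez Y)) (stripʳ-▹ e1 e1 Y)) (≃-refl {Y}) ⟩
    𝟘 ⊖ 𝟘 ⊕ 𝟘 ⊖ Y ⊕ Y
      ≈⟨ solve [] (Y ∷ []) (:𝟘 :⊖ :𝟘 :⊕ :𝟘 :⊖ x₀ :⊕ x₀) :𝟘 refl ⟩
    𝟘
      ≈⟨ annihilates J-linear (stripʳ-▹ e1 ez p) ⟨
    J (stripʳ e1 (p ▹ ez)) ∎
    where
    Y = stripʳ e1 p
    Z = stripʳ ez p

stripʳ-e1-K : ∀ p → stripʳ e1 (K p) ≃ K (stripʳ e1 p)
stripʳ-e1-K = ∷ʳ-ext (L ∘ˡ K-linear) (K-linear ∘ˡ L) ≃-refl step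
  where
  L = stripʳ-linear e1
  step : ∀ a p → stripʳ e1 (K (p ▹ a)) ≃ K (stripʳ e1 (p ▹ a))
  step e0 p = begin
    stripʳ e1 (K (p ▹ e0))                       ≈⟨ congruent L (K-▹-e0 p) ⟩
    stripʳ e1 (K p ▹ e0 ⊖ stripʳ ez p ▹ ez)      ≈⟨ null-⊖ L (K p ▹ e0) (stripʳ ez p ▹ ez) (stripʳ-▹ e1 e0 (K p)) (stripʳ-▹ e1 ez (stripʳ ez p)) ⟩
    𝟘                                            ≈⟨ annihilates K-linear (stripʳ-▹ e1 e0 p) ⟨
    K (stripʳ e1 (p ▹ e0))                       ∎
  step e1 p = begin
    stripʳ e1 (K (p ▹ e1))                                   ≈⟨ congruent L (K-▹-e1 p) ⟩
    stripʳ e1 (K p ▹ e1 ⊖ stripʳ ez p ▹ ez)                  ≈⟨ subtractive L (K p ▹ e1) (stripʳ ez p ▹ ez) ⟩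
    stripʳ e1 (K p ▹ e1) ⊖ stripʳ e1 (stripʳ ez p ▹ ez)      ≈⟨ ⊖-cong (stripʳ-▹ e1 e1 (K p)) (stripʳ-▹ e1 ez (stripʳ ez p)) ⟩
    K p ⊖ 𝟘                                                  ≈⟨ ⊕-identityʳ (K p) ⟩
    K p                                                      ≈⟨ congruent K-linear (stripʳ-▹ e1 e1 p) ⟨
    K (stripʳ e1 (p ▹ e1))                                   ∎
  step ez p = begin
    stripʳ e1 (K (p ▹ ez))
      ≈⟨ congruent L (K-▹-ez p) ⟩
    stripʳ e1 (K p ▹ ez ⊕ (X ▹ ez ⊕ Y ▹ ez))
      ≈⟨ null-⊕ L (K p ▹ ez) (X ▹ ez ⊕ Y ▹ ez) (stripʳ-▹ e1 ez (K p)) (null-⊕ L (X ▹ ez) (Y ▹ ez) (stripʳ-▹ e1 ez X) (stripʳ-▹ e1 ez Y)) ⟩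
    𝟘
      ≈⟨ annihilates K-linear (stripʳ-▹ e1 ez p) ⟨
    K (stripʳ e1 (p ▹ ez)) ∎
    where
    X = stripʳ e0 p
    Y = stripʳ e1 p

-- The duality maps

·-linearˡ : ∀ q → Linear (_· q)
·-linearˡ = bilinear-linearˡ _

·-linearʳ : ∀ p → Linear (p ·_)
·-linearʳ = bilinear-linearʳ _

·-letter : ∀ a p → p · letter a ≃ p ▹ a
·-letter a = ext (·-linearˡ (letter a)) (▹-linear a) λ w → bilinear-word (λ u v → word (u ++ v)) w [ a ]

letter-· : ∀ a p → letter a · p ≃ a ◃ p
letter-· a = ext (·-linearʳ (letter a)) (◃-linear a) λ w → bilinear-word (λ u v → word (u ++ v)) [ a ] w

linear-◃ : ∀ {h R} a → Linear R → (∀ w → h (a ∷ w) ≃ R (h w)) → ∀ p → linear h (a ◃ p) ≃ R (linear h p)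
linear-◃ {h} {R} a L step = ext (linear-linear h ∘ˡ ◃-linear a) (L ∘ˡ linear-linear h) λ w →
  ≃-trans (linear-word h (a ∷ w)) (≃-trans (step w) (congruent L (≃-sym (linear-word h w))))

·-letter-⊖ : ∀ a b p → p · (letter a ⊖ letter b) ≃ p ▹ a ⊖ p ▹ b
·-letter-⊖ a b p = ≃-trans (subtractive (·-linearʳ p) (letter a) (letter b)) (⊖-cong (·-letter a p) (·-letter b p))

·-•-letter : ∀ c a p → p · (c • letter a) ≃ c • p ▹ a
·-•-letter c a p = ≃-trans (scaling (·-linearʳ p) c (letter a)) (•-cong c (·-letter a p))

τz-linear : Linear τz
τz-linear = linear-linear _

τ∞-linear : Linear τ∞
τ∞-linear = linear-linear _

τz-e0 : ∀ p → τz (e0 ◃ p) ≃ τz p ▹ ez ⊖ τz p ▹ e1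
τz-e0 p = ≃-trans {q = τz p · (letter ez ⊖ letter e1)}
  (linear-◃ e0 (·-linearˡ (letter ez ⊖ letter e1)) (λ _ → ≃-refl) p) (·-letter-⊖ ez e1 (τz p))

τz-e1 : ∀ p → τz (e1 ◃ p) ≃ τz p ▹ ez ⊖ τz p ▹ e0
τz-e1 p = ≃-trans {q = τz p · (letter ez ⊖ letter e0)}
  (linear-◃ e1 (·-linearˡ (letter ez ⊖ letter e0)) (λ _ → ≃-refl) p) (·-letter-⊖ ez e0 (τz p))

τz-ez : ∀ p → τz (ez ◃ p) ≃ τz p ▹ ez
τz-ez p = ≃-trans {q = τz p · letter ez}
  (linear-◃ ez (·-linearˡ (letter ez)) (λ _ → ≃-refl) p) (·-letter ez (τz p))

τ∞-e0 : ∀ p → τ∞ (e0 ◃ p) ≃ -1ℤ • τ∞ p ▹ e1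
τ∞-e0 p = ≃-trans {q = τ∞ p · (-1ℤ • letter e1)}
  (linear-◃ e0 (·-linearˡ (-1ℤ • letter e1)) (λ _ → ≃-refl) p) (·-•-letter -1ℤ e1 (τ∞ p))

τ∞-e1 : ∀ p → τ∞ (e1 ◃ p) ≃ -1ℤ • τ∞ p ▹ e0
τ∞-e1 p = ≃-trans {q = τ∞ p · (-1ℤ • letter e0)}
  (linear-◃ e1 (·-linearˡ (-1ℤ • letter e0)) (λ _ → ≃-refl) p) (·-•-letter -1ℤ e0 (τ∞ p))

τ∞-ez : ∀ p → τ∞ (ez ◃ p) ≃ τ∞ p ▹ ez
τ∞-ez p = ≃-trans {q = τ∞ p · letter ez}
  (linear-◃ ez (·-linearˡ (letter ez)) (λ _ → ≃-refl) p) (·-letter ez (τ∞ p))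

∷-ext : ∀ {F G} → Linear F → Linear G → F (word []) ≃ G (word []) →
        (∀ a p → F p ≃ G p → F (a ◃ p) ≃ G (a ◃ p)) → ∀ p → F p ≃ G p
∷-ext {F} {G} LF LG base step = ext LF LG on-word
  where
  on-word : ∀ w → F (word w) ≃ G (word w)
  on-word []      = base
  on-word (a ∷ w) = step a (word w) (on-word w)

stripʳ-e0-τz : ∀ p → stripʳ e0 (τz p) ≃ -1ℤ • τz (stripˡ e1 p)
stripʳ-e0-τz = ∷-ext (L ∘ˡ τz-linear) (-1ℤ •ˡ τz-linear ∘ˡ stripˡ-linear e1) ≃-refl step
  where
  L = stripʳ-linear e0
  step : ∀ a p → _ → stripʳ e0 (τz (a ◃ p)) ≃ -1ℤ • τz (stripˡ e1 (a ◃ p))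
  step e0 p _ = begin
    stripʳ e0 (τz (e0 ◃ p))                 ≈⟨ congruent L (τz-e0 p) ⟩
    stripʳ e0 (τz p ▹ ez ⊖ τz p ▹ e1)       ≈⟨ null-⊖ L (τz p ▹ ez) (τz p ▹ e1) (stripʳ-▹ e0 ez (τz p)) (stripʳ-▹ e0 e1 (τz p)) ⟩
    𝟘                                       ≈⟨ •-cong -1ℤ (annihilates τz-linear (stripˡ-◃ e1 e0 p)) ⟨
    -1ℤ • τz (stripˡ e1 (e0 ◃ p))           ∎
  step e1 p _ = begin
    stripʳ e0 (τz (e1 ◃ p))                         ≈⟨ congruent L (τz-e1 p) ⟩
    stripʳ e0 (τz p ▹ ez ⊖ τz p ▹ e0)               ≈⟨ subtractive L (τz p ▹ ez) (τz p ▹ e0) ⟩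
    stripʳ e0 (τz p ▹ ez) ⊖ stripʳ e0 (τz p ▹ e0)   ≈⟨ ⊖-cong (stripʳ-▹ e0 ez (τz p)) (stripʳ-▹ e0 e0 (τz p)) ⟩
    -1ℤ • τz p                                      ≈⟨ •-cong -1ℤ (congruent τz-linear (stripˡ-◃ e1 e1 p)) ⟨
    -1ℤ • τz (stripˡ e1 (e1 ◃ p))                   ∎
  step ez p _ = begin
    stripʳ e0 (τz (ez ◃ p))                 ≈⟨ congruent L (τz-ez p) ⟩
    stripʳ e0 (τz p ▹ ez)                   ≈⟨ stripʳ-▹ e0 ez (τz p) ⟩
    𝟘                                       ≈⟨ •-cong -1ℤ (annihilates τz-linear (stripˡ-◃ e1 ez p)) ⟨
    -1ℤ • τz (stripˡ e1 (ez ◃ p))           ∎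

stripʳ-e1-τz : ∀ p → stripʳ e1 (τz p) ≃ -1ℤ • τz (stripˡ e0 p)
stripʳ-e1-τz = ∷-ext (L ∘ˡ τz-linear) (-1ℤ •ˡ τz-linear ∘ˡ stripˡ-linear e0) ≃-refl step
  where
  L = stripʳ-linear e1
  step : ∀ a p → _ → stripʳ e1 (τz (a ◃ p)) ≃ -1ℤ • τz (stripˡ e0 (a ◃ p))
  step e0 p _ = begin
    stripʳ e1 (τz (e0 ◃ p))                         ≈⟨ congruent L (τz-e0 p) ⟩
    stripʳ e1 (τz p ▹ ez ⊖ τz p ▹ e1)               ≈⟨ subtractive L (τz p ▹ ez) (τz p ▹ e1) ⟩
    stripʳ e1 (τz p ▹ ez) ⊖ stripʳ e1 (τz p ▹ e1)   ≈⟨ ⊖-cong (stripʳ-▹ e1 ez (τz p)) (stripʳ-▹ e1 e1 (τz p)) ⟩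
    -1ℤ • τz p                                      ≈⟨ •-cong -1ℤ (congruent τz-linear (stripˡ-◃ e0 e0 p)) ⟨
    -1ℤ • τz (stripˡ e0 (e0 ◃ p))                   ∎
  step e1 p _ = begin
    stripʳ e1 (τz (e1 ◃ p))                 ≈⟨ congruent L (τz-e1 p) ⟩
    stripʳ e1 (τz p ▹ ez ⊖ τz p ▹ e0)       ≈⟨ null-⊖ L (τz p ▹ ez) (τz p ▹ e0) (stripʳ-▹ e1 ez (τz p)) (stripʳ-▹ e1 e0 (τz p)) ⟩
    𝟘                                       ≈⟨ •-cong -1ℤ (annihilates τz-linear (stripˡ-◃ e0 e1 p)) ⟨
    -1ℤ • τz (stripˡ e0 (e1 ◃ p))           ∎
  step ez p _ = begin
    stripʳ e1 (τz (ez ◃ p))                 ≈⟨ congruent L (τz-ez p) ⟩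
    stripʳ e1 (τz p ▹ ez)                   ≈⟨ stripʳ-▹ e1 ez (τz p) ⟩
    𝟘                                       ≈⟨ •-cong -1ℤ (annihilates τz-linear (stripˡ-◃ e0 ez p)) ⟨
    -1ℤ • τz (stripˡ e0 (ez ◃ p))           ∎

-- The images of all three letters under `τz` contain `ez` with coefficient one, so a final `ez`
-- arises from every first letter.
stripʳ-ez-τz : ∀ p → stripʳ ez (τz p) ≃ τz (Σˡ λ a → stripˡ a p)
stripʳ-ez-τz = ∷-ext (L ∘ˡ τz-linear) (τz-linear ∘ˡ Σˡ-linear stripˡ-linear) ≃-refl step
  where
  L = stripʳ-linear ez
  rhs : ∀ a p → τz (Σˡ λ b → stripˡ b (a ◃ p)) ≃ τz p
  rhs a p = congruent τz-linear (≃-trans (Σˡ-cong λ b → stripˡ-◃ b a p) (collapse a))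
    where
    collapse : ∀ a → (Σˡ λ b → when (does (a ≟ˡ b)) p) ≃ p
    collapse e0 = solve [] (p ∷ []) (x₀ :⊕ :𝟘 :⊕ :𝟘) x₀ refl
    collapse e1 = solve [] (p ∷ []) (:𝟘 :⊕ x₀ :⊕ :𝟘) x₀ refl
    collapse ez = ≃-refl
  difference : ∀ b q → does (b ≟ˡ ez) ≡ false → stripʳ ez (q ▹ ez ⊖ q ▹ b) ≃ q
  difference b q b≢ez = ≃-trans (subtractive L (q ▹ ez) (q ▹ b)) (≃-trans
    (⊖-cong (stripʳ-▹ ez ez q) (≃-trans (stripʳ-▹ ez b q) (≡⇒≃ (cong (λ x → when x q) b≢ez)))) (⊕-identityʳ q))
  step : ∀ a p → _ → stripʳ ez (τz (a ◃ p)) ≃ τz (Σˡ λ b → stripˡ b (a ◃ p))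
  step e0 p _ = ≃-trans (congruent L (τz-e0 p)) (≃-trans (difference e1 (τz p) refl) (≃-sym (rhs e0 p)))
  step e1 p _ = ≃-trans (congruent L (τz-e1 p)) (≃-trans (difference e0 (τz p) refl) (≃-sym (rhs e1 p)))
  step ez p _ = ≃-trans (congruent L (τz-ez p)) (≃-trans (stripʳ-▹ ez ez (τz p)) (≃-sym (rhs ez p)))

τz-decompose : ∀ p → τz p ≃ τz (ε p) ⊕ ((τz (stripˡ e0 p) ▹ ez ⊖ τz (stripˡ e0 p) ▹ e1)
  ⊕ (τz (stripˡ e1 p) ▹ ez ⊖ τz (stripˡ e1 p) ▹ e0) ⊕ τz (stripˡ ez p) ▹ ez)
τz-decompose p = begin
  τz p
    ≈⟨ congruent τz-linear (decompose p) ⟩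
  τz (ε p ⊕ Σˡ λ a → a ◃ stripˡ a p)
    ≈⟨ solve ((_ , τz-linear) ∷ []) (ε p ∷ e0 ◃ stripˡ e0 p ∷ e1 ◃ stripˡ e1 p ∷ ez ◃ stripˡ ez p ∷ [])
        (#0 $ (x₀ :⊕ (x₁ :⊕ x₂ :⊕ x₃))) (#0 $ x₀ :⊕ (#0 $ x₁ :⊕ #0 $ x₂ :⊕ #0 $ x₃)) refl ⟩
  τz (ε p) ⊕ (τz (e0 ◃ stripˡ e0 p) ⊕ τz (e1 ◃ stripˡ e1 p) ⊕ τz (ez ◃ stripˡ ez p))
    ≈⟨ ⊕-cong (≃-refl {τz (ε p)}) (⊕-cong (⊕-cong (τz-e0 (stripˡ e0 p)) (τz-e1 (stripˡ e1 p))) (τz-ez (stripˡ ez p))) ⟩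
  τz (ε p) ⊕ ((τz (stripˡ e0 p) ▹ ez ⊖ τz (stripˡ e0 p) ▹ e1)
    ⊕ (τz (stripˡ e1 p) ▹ ez ⊖ τz (stripˡ e1 p) ▹ e0) ⊕ τz (stripˡ ez p) ▹ ez) ∎

τ-ops : Vec Op 4
τ-ops = (_ , ▹-linear e0) ∷ (_ , ▹-linear e1) ∷ (_ , ▹-linear ez) ∷ (_ , τz-linear) ∷ []

-- Since `τz` reverses words, prepending a letter to `p` appends letters to `τz p`. The corrections
-- of `K` at the right end of `τz p` are translated by the `stripʳ` identities above into its
-- corrections at the left end of `p`.
K-τz : ∀ p → K (τz p) ≃ τz (K p)
K-τz = ∷-ext (K-linear ∘ˡ τz-linear) (τz-linear ∘ˡ K-linear) ≃-refl step
  where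
  step : ∀ a p → K (τz p) ≃ τz (K p) → K (τz (a ◃ p)) ≃ τz (K (a ◃ p))
  step a p h = helper a
    where
    Q = τz p
    L₀ = stripˡ e0 p
    L₁ = stripˡ e1 p
    Lz = stripˡ ez p
    atoms : Vec Poly 4
    atoms = K p ∷ L₀ ∷ L₁ ∷ Lz ∷ []
    Q▹ez : K (Q ▹ ez) ≃ τz (K p) ▹ ez ⊕ ((-1ℤ • τz L₁) ▹ ez ⊕ (-1ℤ • τz L₀) ▹ ez)
    Q▹ez = ≃-trans (K-▹-ez Q) (⊕-cong (congruent (▹-linear ez) h)
      (⊕-cong (congruent (▹-linear ez) (stripʳ-e0-τz p)) (congruent (▹-linear ez) (stripʳ-e1-τz p))))
    Q▹e0 : K (Q ▹ e0) ≃ τz (K p) ▹ e0 ⊖ τz (L₀ ⊕ L₁ ⊕ Lz) ▹ ez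
    Q▹e0 = ≃-trans (K-▹-e0 Q) (⊖-cong (congruent (▹-linear e0) h) (congruent (▹-linear ez) (stripʳ-ez-τz p)))
    Q▹e1 : K (Q ▹ e1) ≃ τz (K p) ▹ e1 ⊖ τz (L₀ ⊕ L₁ ⊕ Lz) ▹ ez
    Q▹e1 = ≃-trans (K-▹-e1 Q) (⊖-cong (congruent (▹-linear e1) h) (congruent (▹-linear ez) (stripʳ-ez-τz p)))
    helper : ∀ a → K (τz (a ◃ p)) ≃ τz (K (a ◃ p))
    helper e0 = begin
      K (τz (e0 ◃ p))
        ≈⟨ congruent K-linear (τz-e0 p) ⟩
      K (Q ▹ ez ⊖ Q ▹ e1)
        ≈⟨ ≃-trans (subtractive K-linear (Q ▹ ez) (Q ▹ e1)) (⊖-cong Q▹ez Q▹e1) ⟩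
      τz (K p) ▹ ez ⊕ ((-1ℤ • τz L₁) ▹ ez ⊕ (-1ℤ • τz L₀) ▹ ez) ⊖ (τz (K p) ▹ e1 ⊖ τz (L₀ ⊕ L₁ ⊕ Lz) ▹ ez)
        ≈⟨ solve τ-ops atoms
             (#2 $ #3 $ x₀ :⊕ (#2 $ (-1ℤ :• #3 $ x₂) :⊕ #2 $ (-1ℤ :• #3 $ x₁)) :⊖ (#1 $ #3 $ x₀ :⊖ #2 $ #3 $ (x₁ :⊕ x₂ :⊕ x₃)))
             ((#2 $ #3 $ x₀ :⊖ #1 $ #3 $ x₀) :⊕ #2 $ #3 $ x₃) refl ⟩
      (τz (K p) ▹ ez ⊖ τz (K p) ▹ e1) ⊕ τz Lz ▹ ez
        ≈⟨ ⊕-cong (τz-e0 (K p)) (τz-ez Lz) ⟨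
      τz (e0 ◃ K p) ⊕ τz (ez ◃ Lz)
        ≈⟨ ≃-trans (congruent τz-linear (K-◃-e0 p)) (additive τz-linear (e0 ◃ K p) (ez ◃ Lz)) ⟨
      τz (K (e0 ◃ p)) ∎
    helper e1 = begin
      K (τz (e1 ◃ p))
        ≈⟨ congruent K-linear (τz-e1 p) ⟩
      K (Q ▹ ez ⊖ Q ▹ e0)
        ≈⟨ ≃-trans (subtractive K-linear (Q ▹ ez) (Q ▹ e0)) (⊖-cong Q▹ez Q▹e0) ⟩
      τz (K p) ▹ ez ⊕ ((-1ℤ • τz L₁) ▹ ez ⊕ (-1ℤ • τz L₀) ▹ ez) ⊖ (τz (K p) ▹ e0 ⊖ τz (L₀ ⊕ L₁ ⊕ Lz) ▹ ez)
        ≈⟨ solve τ-ops atoms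
             (#2 $ #3 $ x₀ :⊕ (#2 $ (-1ℤ :• #3 $ x₂) :⊕ #2 $ (-1ℤ :• #3 $ x₁)) :⊖ (#0 $ #3 $ x₀ :⊖ #2 $ #3 $ (x₁ :⊕ x₂ :⊕ x₃)))
             ((#2 $ #3 $ x₀ :⊖ #0 $ #3 $ x₀) :⊕ #2 $ #3 $ x₃) refl ⟩
      (τz (K p) ▹ ez ⊖ τz (K p) ▹ e0) ⊕ τz Lz ▹ ez
        ≈⟨ ⊕-cong (τz-e1 (K p)) (τz-ez Lz) ⟨
      τz (e1 ◃ K p) ⊕ τz (ez ◃ Lz)
        ≈⟨ ≃-trans (congruent τz-linear (K-◃-e1 p)) (additive τz-linear (e1 ◃ K p) (ez ◃ Lz)) ⟨
      τz (K (e1 ◃ p)) ∎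
    helper ez = begin
      K (τz (ez ◃ p))
        ≈⟨ ≃-trans (congruent K-linear (τz-ez p)) Q▹ez ⟩
      τz (K p) ▹ ez ⊕ ((-1ℤ • τz L₁) ▹ ez ⊕ (-1ℤ • τz L₀) ▹ ez)
        ≈⟨ solve τ-ops atoms
             (#2 $ #3 $ x₀ :⊕ (#2 $ (-1ℤ :• #3 $ x₂) :⊕ #2 $ (-1ℤ :• #3 $ x₁)))
             (#2 $ #3 $ x₀ :⊖ (#2 $ #3 $ x₁ :⊕ #2 $ #3 $ x₂)) refl ⟩
      τz (K p) ▹ ez ⊖ (τz L₀ ▹ ez ⊕ τz L₁ ▹ ez)
        ≈⟨ ⊖-cong (τz-ez (K p)) (⊕-cong (τz-ez L₀) (τz-ez L₁)) ⟨
      τz (ez ◃ K p) ⊖ (τz (ez ◃ L₀) ⊕ τz (ez ◃ L₁))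
        ≈⟨ solve ((_ , τz-linear) ∷ []) (ez ◃ K p ∷ ez ◃ L₀ ∷ ez ◃ L₁ ∷ [])
             (#0 $ x₀ :⊖ (#0 $ x₁ :⊕ #0 $ x₂)) (#0 $ (x₀ :⊖ (x₁ :⊕ x₂))) refl ⟩
      τz (ez ◃ K p ⊖ (ez ◃ L₀ ⊕ ez ◃ L₁))
        ≈⟨ congruent τz-linear (K-◃-ez p) ⟨
      τz (K (ez ◃ p)) ∎

-- The two extra terms come from the boundary letters 0 and 1 and vanish on 𝒜_z⁰. They have to be
-- carried along because the induction passes to tails of words, which leave 𝒜_z⁰.
J-τz : ∀ p → J (τz p) ≃ τz (J p ⊕ stripˡ e0 p ⊕ stripʳ e1 p)
J-τz = ∷-ext (J-linear ∘ˡ τz-linear) (τz-linear ∘ˡ (J-linear ⊕ˡ stripˡ-linear e0 ⊕ˡ stripʳ-linear e1)) ≃-refl step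
  where
  step : ∀ a p → J (τz p) ≃ τz (J p ⊕ stripˡ e0 p ⊕ stripʳ e1 p) →
         J (τz (a ◃ p)) ≃ τz (J (a ◃ p) ⊕ stripˡ e0 (a ◃ p) ⊕ stripʳ e1 (a ◃ p))
  step a p h = helper a
    where
    Q = τz p
    N = J p ⊕ stripˡ e0 p ⊕ stripʳ e1 p
    L₀ = stripˡ e0 p
    L₁ = stripˡ e1 p
    Lz = stripˡ ez p
    R₁ = stripʳ e1 p
    atoms : Vec Poly 7
    atoms = p ∷ J p ∷ L₀ ∷ L₁ ∷ Lz ∷ R₁ ∷ ε p ∷ []
    Nᵉ : Expr 4 7
    Nᵉ = x₁ :⊕ x₂ :⊕ x₅
    Σᴸ : Expr 4 7
    Σᴸ = x₂ :⊕ x₃ :⊕ x₄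
    Q▹ez : J (Q ▹ ez) ≃ τz N ▹ ez ⊖ τz (L₀ ⊕ L₁ ⊕ Lz) ▹ ez ⊕ (-1ℤ • τz L₀) ▹ ez ⊖ (-1ℤ • τz L₀) ▹ e1 ⊕ Q
    Q▹ez = ≃-trans (J-▹-ez Q) (⊕-cong (⊖-cong (⊕-cong (⊖-cong (congruent (▹-linear ez) h)
      (congruent (▹-linear ez) (stripʳ-ez-τz p))) (congruent (▹-linear ez) (stripʳ-e1-τz p)))
      (congruent (▹-linear e1) (stripʳ-e1-τz p))) (≃-refl {Q}))
    Q▹ezᵉ : Expr 4 7 → Expr 4 7
    Q▹ezᵉ τp = #2 $ #3 $ Nᵉ :⊖ #2 $ #3 $ Σᴸ :⊕ #2 $ (-1ℤ :• #3 $ x₂) :⊖ #1 $ (-1ℤ :• #3 $ x₂) :⊕ τp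
    τpᵉ : Expr 4 7
    τpᵉ = #3 $ x₆ :⊕ ((#2 $ #3 $ x₂ :⊖ #1 $ #3 $ x₂) :⊕ (#2 $ #3 $ x₃ :⊖ #0 $ #3 $ x₃) :⊕ #2 $ #3 $ x₄)
    -- In the cases `e1` and `ez` the bare summand `τz p` only combines with the others once it is
    -- split by the first letters of `p`.
    Q▹ez′ : J (Q ▹ ez) ≃ ⟦_⟧ τ-ops atoms (Q▹ezᵉ τpᵉ)
    Q▹ez′ = ≃-trans Q▹ez (⊕-cong ≃-refl (τz-decompose p))
    Q▹e0 : J (Q ▹ e0) ≃ τz N ▹ e0 ⊖ τz (L₀ ⊕ L₁ ⊕ Lz) ▹ e0
    Q▹e0 = ≃-trans (J-▹-e0 Q) (⊖-cong (congruent (▹-linear e0) h) (congruent (▹-linear e0) (stripʳ-ez-τz p)))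
    Q▹e1 : J (Q ▹ e1) ≃ τz N ▹ e1 ⊖ τz (L₀ ⊕ L₁ ⊕ Lz) ▹ ez
    Q▹e1 = ≃-trans (J-▹-e1 Q) (⊖-cong (congruent (▹-linear e1) h) (congruent (▹-linear ez) (stripʳ-ez-τz p)))
    helper : ∀ a → J (τz (a ◃ p)) ≃ τz (J (a ◃ p) ⊕ stripˡ e0 (a ◃ p) ⊕ stripʳ e1 (a ◃ p))
    helper e0 = begin
      J (τz (e0 ◃ p))
        ≈⟨ congruent J-linear (τz-e0 p) ⟩
      J (Q ▹ ez ⊖ Q ▹ e1)
        ≈⟨ ≃-trans (subtractive J-linear (Q ▹ ez) (Q ▹ e1)) (⊖-cong Q▹ez Q▹e1) ⟩
      τz N ▹ ez ⊖ τz (L₀ ⊕ L₁ ⊕ Lz) ▹ ez ⊕ (-1ℤ • τz L₀) ▹ ez ⊖ (-1ℤ • τz L₀) ▹ e1 ⊕ Q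
        ⊖ (τz N ▹ e1 ⊖ τz (L₀ ⊕ L₁ ⊕ Lz) ▹ ez)
        ≈⟨ solve τ-ops atoms
             (Q▹ezᵉ (#3 $ x₀) :⊖ (#1 $ #3 $ Nᵉ :⊖ #2 $ #3 $ Σᴸ))
             ((#2 $ #3 $ x₁ :⊖ #1 $ #3 $ x₁) :⊕ #3 $ x₀ :⊕ (#2 $ #3 $ x₅ :⊖ #1 $ #3 $ x₅)) refl ⟩
      (τz (J p) ▹ ez ⊖ τz (J p) ▹ e1) ⊕ τz p ⊕ (τz R₁ ▹ ez ⊖ τz R₁ ▹ e1)
        ≈⟨ ⊕-cong (⊕-cong (τz-e0 (J p)) (≃-refl {τz p})) (τz-e0 R₁) ⟨
      τz (e0 ◃ J p) ⊕ τz p ⊕ τz (e0 ◃ R₁)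
        ≈⟨ solve ((_ , τz-linear) ∷ []) (e0 ◃ J p ∷ p ∷ e0 ◃ R₁ ∷ [])
             (#0 $ x₀ :⊕ #0 $ x₁ :⊕ #0 $ x₂) (#0 $ (x₀ :⊕ x₁ :⊕ (x₂ :⊕ :𝟘))) refl ⟩
      τz (e0 ◃ J p ⊕ p ⊕ (e0 ◃ R₁ ⊕ 𝟘))
        ≈⟨ congruent τz-linear (⊕-cong (⊕-cong (J-◃-e0 p) (stripˡ-◃ e0 e0 p)) (stripʳ-◃ e1 e0 p)) ⟨
      τz (J (e0 ◃ p) ⊕ stripˡ e0 (e0 ◃ p) ⊕ stripʳ e1 (e0 ◃ p)) ∎
    helper e1 = begin
      J (τz (e1 ◃ p))
        ≈⟨ congruent J-linear (τz-e1 p) ⟩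
      J (Q ▹ ez ⊖ Q ▹ e0)
        ≈⟨ ≃-trans (subtractive J-linear (Q ▹ ez) (Q ▹ e0)) (⊖-cong Q▹ez′ Q▹e0) ⟩
      ⟦_⟧ τ-ops atoms (Q▹ezᵉ τpᵉ :⊖ (#0 $ #3 $ Nᵉ :⊖ #0 $ #3 $ Σᴸ))
        ≈⟨ solve τ-ops atoms
             (Q▹ezᵉ τpᵉ :⊖ (#0 $ #3 $ Nᵉ :⊖ #0 $ #3 $ Σᴸ))
             ((#2 $ #3 $ x₁ :⊖ #0 $ #3 $ x₁) :⊕ #2 $ #3 $ x₄ :⊖ (#2 $ #3 $ x₄ :⊖ #0 $ #3 $ x₄)
               :⊕ (#2 $ #3 $ x₅ :⊖ #0 $ #3 $ x₅) :⊕ #3 $ x₆) refl ⟩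
      (τz (J p) ▹ ez ⊖ τz (J p) ▹ e0) ⊕ τz Lz ▹ ez ⊖ (τz Lz ▹ ez ⊖ τz Lz ▹ e0) ⊕ (τz R₁ ▹ ez ⊖ τz R₁ ▹ e0) ⊕ τz (ε p)
        ≈⟨ ⊕-cong (⊕-cong (⊖-cong (⊕-cong (τz-e1 (J p)) (τz-ez Lz)) (τz-e1 Lz)) (τz-e1 R₁)) (≃-refl {τz (ε p)}) ⟨
      τz (e1 ◃ J p) ⊕ τz (ez ◃ Lz) ⊖ τz (e1 ◃ Lz) ⊕ τz (e1 ◃ R₁) ⊕ τz (ε p)
        ≈⟨ solve ((_ , τz-linear) ∷ []) (e1 ◃ J p ∷ ez ◃ Lz ∷ e1 ◃ Lz ∷ e1 ◃ R₁ ∷ ε p ∷ [])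
             (#0 $ x₀ :⊕ #0 $ x₁ :⊖ #0 $ x₂ :⊕ #0 $ x₃ :⊕ #0 $ x₄)
             (#0 $ (x₀ :⊕ (x₁ :⊖ x₂) :⊕ :𝟘 :⊕ (x₃ :⊕ x₄))) refl ⟩
      τz (e1 ◃ J p ⊕ (ez ◃ Lz ⊖ e1 ◃ Lz) ⊕ 𝟘 ⊕ (e1 ◃ R₁ ⊕ ε p))
        ≈⟨ congruent τz-linear (⊕-cong (⊕-cong (J-◃-e1 p) (stripˡ-◃ e0 e1 p)) (stripʳ-◃ e1 e1 p)) ⟨
      τz (J (e1 ◃ p) ⊕ stripˡ e0 (e1 ◃ p) ⊕ stripʳ e1 (e1 ◃ p)) ∎
    helper ez = begin
      J (τz (ez ◃ p))
        ≈⟨ ≃-trans (congruent J-linear (τz-ez p)) Q▹ez′ ⟩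
      ⟦_⟧ τ-ops atoms (Q▹ezᵉ τpᵉ)
        ≈⟨ solve τ-ops atoms (Q▹ezᵉ τpᵉ)
             (#2 $ #3 $ x₁ :⊕ (#2 $ #3 $ x₃ :⊖ #0 $ #3 $ x₃) :⊖ #2 $ #3 $ x₃ :⊕ #3 $ x₆ :⊕ #2 $ #3 $ x₅) refl ⟩
      τz (J p) ▹ ez ⊕ (τz L₁ ▹ ez ⊖ τz L₁ ▹ e0) ⊖ τz L₁ ▹ ez ⊕ τz (ε p) ⊕ τz R₁ ▹ ez
        ≈⟨ ⊕-cong (⊕-cong (⊖-cong (⊕-cong (τz-ez (J p)) (τz-e1 L₁)) (τz-ez L₁)) (≃-refl {τz (ε p)})) (τz-ez R₁) ⟨
      τz (ez ◃ J p) ⊕ τz (e1 ◃ L₁) ⊖ τz (ez ◃ L₁) ⊕ τz (ε p) ⊕ τz (ez ◃ R₁)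
        ≈⟨ solve ((_ , τz-linear) ∷ []) (ez ◃ J p ∷ e1 ◃ L₁ ∷ ez ◃ L₁ ∷ ε p ∷ ez ◃ R₁ ∷ [])
             (#0 $ x₀ :⊕ #0 $ x₁ :⊖ #0 $ x₂ :⊕ #0 $ x₃ :⊕ #0 $ x₄)
             (#0 $ (x₀ :⊕ (x₁ :⊖ x₂) :⊕ x₃ :⊕ :𝟘 :⊕ (x₄ :⊕ :𝟘))) refl ⟩
      τz (ez ◃ J p ⊕ (e1 ◃ L₁ ⊖ ez ◃ L₁) ⊕ ε p ⊕ 𝟘 ⊕ (ez ◃ R₁ ⊕ 𝟘))
        ≈⟨ congruent τz-linear (⊕-cong (⊕-cong (J-◃-ez p) (stripˡ-◃ e0 ez p)) (stripʳ-◃ e1 ez p)) ⟨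
      τz (J (ez ◃ p) ⊕ stripˡ e0 (ez ◃ p) ⊕ stripʳ e1 (ez ◃ p)) ∎

-- The substitution e₀ ↦ e₀, e₁ ↦ e₁ − e_z, e_z ↦ 0, which intertwines τ∞ with τz.
φʷ : Word → Poly
φʷ []       = word []
φʷ (e0 ∷ w) = e0 ◃ φʷ w
φʷ (e1 ∷ w) = e1 ◃ φʷ w ⊖ ez ◃ φʷ w
φʷ (ez ∷ w) = 𝟘

φ : Poly → Poly
φ = linear φʷ

φ-linear : Linear φ
φ-linear = linear-linear φʷ

φˡ φʳ : Letter → Poly → Poly
φˡ e0 p = e0 ◃ p
φˡ e1 p = e1 ◃ p ⊖ ez ◃ p
φˡ ez p = 𝟘
φʳ e0 p = p ▹ e0
φʳ e1 p = p ▹ e1 ⊖ p ▹ ez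
φʳ ez p = 𝟘

φˡ-linear : ∀ a → Linear (φˡ a)
φˡ-linear e0 = ◃-linear e0
φˡ-linear e1 = ◃-linear e1 ⊖ˡ ◃-linear ez
φˡ-linear ez = 𝟘ˡ

φʳ-linear : ∀ a → Linear (φʳ a)
φʳ-linear e0 = ▹-linear e0
φʳ-linear e1 = ▹-linear e1 ⊖ˡ ▹-linear ez
φʳ-linear ez = 𝟘ˡ

φ-◃ : ∀ a p → φ (a ◃ p) ≃ φˡ a (φ p)
φ-◃ a = linear-◃ a (φˡ-linear a) (step a)
  where
  step : ∀ a w → φʷ (a ∷ w) ≃ φˡ a (φʷ w)
  step e0 w = ≃-refl
  step e1 w = ≃-refl
  step ez w = ≃-refl

◃-φʳ : ∀ c a p → c ◃ φʳ a p ≃ φʳ a (c ◃ p)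
◃-φʳ c e0 p = ≡⇒≃ (sym (◃-▹ c e0 p))
◃-φʳ c e1 p = ≃-trans (subtractive (◃-linear c) (p ▹ e1) (p ▹ ez))
  (≡⇒≃ (sym (cong₂ _⊖_ (◃-▹ c e1 p) (◃-▹ c ez p))))
◃-φʳ c ez p = ≃-refl

φˡ-φʳ : ∀ c a p → φˡ c (φʳ a p) ≃ φʳ a (φˡ c p)
φˡ-φʳ e0 a p = ◃-φʳ e0 a p
φˡ-φʳ e1 a p = ≃-trans (⊖-cong (◃-φʳ e1 a p) (◃-φʳ ez a p)) (≃-sym (subtractive (φʳ-linear a) (e1 ◃ p) (ez ◃ p)))
φˡ-φʳ ez a p = ≃-sym (null (φʳ-linear a))

φ-▹ : ∀ a p → φ (p ▹ a) ≃ φʳ a (φ p)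
φ-▹ a = ∷-ext (φ-linear ∘ˡ ▹-linear a) (φʳ-linear a ∘ˡ φ-linear) (base a) step
  where
  base : ∀ a → φ (letter a) ≃ φʳ a (φ (word []))
  base e0 = ≃-refl
  base e1 = ≃-refl
  base ez = ≃-refl
  step : ∀ c p → φ (p ▹ a) ≃ φʳ a (φ p) → φ ((c ◃ p) ▹ a) ≃ φʳ a (φ (c ◃ p))
  step c p h = begin
    φ ((c ◃ p) ▹ a)    ≡⟨ cong φ (◃-▹ c a p) ⟩
    φ (c ◃ (p ▹ a))    ≈⟨ φ-◃ c (p ▹ a) ⟩
    φˡ c (φ (p ▹ a))   ≈⟨ congruent (φˡ-linear c) h ⟩
    φˡ c (φʳ a (φ p))  ≈⟨ φˡ-φʳ c a (φ p) ⟩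
    φʳ a (φˡ c (φ p))  ≈⟨ congruent (φʳ-linear a) (φ-◃ c p) ⟨
    φʳ a (φ (c ◃ p))   ∎

-- On letters: `τz` sends e₁ - e_z to -e₀ and e₀ to -(e₁ - e_z), which are the images under `φ` of
-- τ∞(e₁) and τ∞(e₀).
τz-φ : ∀ p → τz (φ p) ≃ φ (τ∞ p)
τz-φ = ∷-ext (τz-linear ∘ˡ φ-linear) (φ-linear ∘ˡ τ∞-linear) ≃-refl step
  where
  step : ∀ a p → τz (φ p) ≃ φ (τ∞ p) → τz (φ (a ◃ p)) ≃ φ (τ∞ (a ◃ p))
  step e0 p h = begin
    τz (φ (e0 ◃ p))                             ≈⟨ ≃-trans (congruent τz-linear (φ-◃ e0 p)) (τz-e0 (φ p)) ⟩
    τz (φ p) ▹ ez ⊖ τz (φ p) ▹ e1               ≈⟨ ⊖-cong (congruent (▹-linear ez) h) (congruent (▹-linear e1) h) ⟩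
    φ (τ∞ p) ▹ ez ⊖ φ (τ∞ p) ▹ e1               ≈⟨ solve [] (φ (τ∞ p) ▹ ez ∷ φ (τ∞ p) ▹ e1 ∷ []) (x₀ :⊖ x₁) (-1ℤ :• (x₁ :⊖ x₀)) refl ⟩
    -1ℤ • (φ (τ∞ p) ▹ e1 ⊖ φ (τ∞ p) ▹ ez)       ≈⟨ •-cong -1ℤ (φ-▹ e1 (τ∞ p)) ⟨
    -1ℤ • φ (τ∞ p ▹ e1)                         ≈⟨ ≃-trans (congruent φ-linear (τ∞-e0 p)) (scaling φ-linear -1ℤ (τ∞ p ▹ e1)) ⟨
    φ (τ∞ (e0 ◃ p))                             ∎
  step e1 p h = begin
    τz (φ (e1 ◃ p))                             ≈⟨ congruent τz-linear (φ-◃ e1 p) ⟩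
    τz (e1 ◃ φ p ⊖ ez ◃ φ p)                    ≈⟨ ≃-trans (subtractive τz-linear (e1 ◃ φ p) (ez ◃ φ p)) (⊖-cong (τz-e1 (φ p)) (τz-ez (φ p))) ⟩
    τz (φ p) ▹ ez ⊖ τz (φ p) ▹ e0 ⊖ τz (φ p) ▹ ez  ≈⟨ solve [] (τz (φ p) ▹ ez ∷ τz (φ p) ▹ e0 ∷ []) (x₀ :⊖ x₁ :⊖ x₀) (-1ℤ :• x₁) refl ⟩
    -1ℤ • τz (φ p) ▹ e0                         ≈⟨ •-cong -1ℤ (≃-trans (congruent (▹-linear e0) h) (≃-sym (φ-▹ e0 (τ∞ p)))) ⟩
    -1ℤ • φ (τ∞ p ▹ e0)                         ≈⟨ ≃-trans (congruent φ-linear (τ∞-e1 p)) (scaling φ-linear -1ℤ (τ∞ p ▹ e0)) ⟨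
    φ (τ∞ (e1 ◃ p))                             ∎
  step ez p h = begin
    τz (φ (ez ◃ p))     ≈⟨ annihilates τz-linear (φ-◃ ez p) ⟩
    𝟘                   ≈⟨ ≃-trans (congruent φ-linear (τ∞-ez p)) (φ-▹ ez (τ∞ p)) ⟨
    φ (τ∞ (ez ◃ p))     ∎

stripˡ-e0-φ : ∀ p → stripˡ e0 (φ p) ≃ φ (stripˡ e0 p)
stripˡ-e0-φ = ∷-ext (L ∘ˡ φ-linear) (φ-linear ∘ˡ L) ≃-refl step
  where
  L = stripˡ-linear e0
  step : ∀ a p → _ → stripˡ e0 (φ (a ◃ p)) ≃ φ (stripˡ e0 (a ◃ p))
  step e0 p _ = ≃-trans (congruent L (φ-◃ e0 p)) (≃-trans (stripˡ-◃ e0 e0 (φ p)) (≃-sym (congruent φ-linear (stripˡ-◃ e0 e0 p))))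
  step e1 p _ = ≃-trans (congruent L (φ-◃ e1 p))
    (≃-trans (null-⊖ L (e1 ◃ φ p) (ez ◃ φ p) (stripˡ-◃ e0 e1 (φ p)) (stripˡ-◃ e0 ez (φ p)))
      (≃-sym (annihilates φ-linear (stripˡ-◃ e0 e1 p))))
  step ez p _ = ≃-trans (annihilates L (φ-◃ ez p)) (≃-sym (annihilates φ-linear (stripˡ-◃ e0 ez p)))

stripʳ-e1-φ : ∀ p → stripʳ e1 (φ p) ≃ φ (stripʳ e1 p)
stripʳ-e1-φ = ∷ʳ-ext (L ∘ˡ φ-linear) (φ-linear ∘ˡ L) ≃-refl step
  where
  L = stripʳ-linear e1
  step : ∀ a p → stripʳ e1 (φ (p ▹ a)) ≃ φ (stripʳ e1 (p ▹ a))
  step e0 p = ≃-trans (congruent L (φ-▹ e0 p)) (≃-trans (stripʳ-▹ e1 e0 (φ p)) (≃-sym (annihilates φ-linear (stripʳ-▹ e1 e0 p))))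
  step e1 p = ≃-trans (congruent L (φ-▹ e1 p)) (≃-trans (subtractive L (φ p ▹ e1) (φ p ▹ ez))
    (≃-trans (⊖-cong (stripʳ-▹ e1 e1 (φ p)) (stripʳ-▹ e1 ez (φ p)))
      (≃-trans (⊕-identityʳ (φ p)) (≃-sym (congruent φ-linear (stripʳ-▹ e1 e1 p))))))
  step ez p = ≃-trans (annihilates L (φ-▹ ez p)) (≃-sym (annihilates φ-linear (stripʳ-▹ e1 ez p)))

-- Under `φ` the letter e_z occurs only in e₁ - e_z, so a final `ez` stems from a final `e1`. Hence
-- `φ` maps 𝒜_z⁰ even into 𝒜_z⁻².
stripʳ-ez-φ : ∀ p → stripʳ ez (φ p) ≃ -1ℤ • φ (stripʳ e1 p)
stripʳ-ez-φ = ∷ʳ-ext (L ∘ˡ φ-linear) (-1ℤ •ˡ φ-linear ∘ˡ stripʳ-linear e1) ≃-refl step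
  where
  L = stripʳ-linear ez
  rhs-null : ∀ a p → stripʳ e1 (p ▹ a) ≃ 𝟘 → -1ℤ • φ (stripʳ e1 (p ▹ a)) ≃ 𝟘
  rhs-null a p h = •-cong -1ℤ (annihilates φ-linear h)
  step : ∀ a p → stripʳ ez (φ (p ▹ a)) ≃ -1ℤ • φ (stripʳ e1 (p ▹ a))
  step e0 p = ≃-trans (congruent L (φ-▹ e0 p)) (≃-trans (stripʳ-▹ ez e0 (φ p)) (≃-sym (rhs-null e0 p (stripʳ-▹ e1 e0 p))))
  step e1 p = ≃-trans (congruent L (φ-▹ e1 p)) (≃-trans (subtractive L (φ p ▹ e1) (φ p ▹ ez))
    (≃-trans (⊖-cong (stripʳ-▹ ez e1 (φ p)) (stripʳ-▹ ez ez (φ p)))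
      (≃-sym (•-cong -1ℤ (congruent φ-linear (stripʳ-▹ e1 e1 p))))))
  step ez p = ≃-trans (annihilates L (φ-▹ ez p)) (≃-sym (rhs-null ez p (stripʳ-▹ e1 ez p)))

-- Constant terms and end letters under `φ`, `τz` and `τ∞`

Const-φ : ∀ p → Const (φ p) ≃ Const p
Const-φ = ∷-ext (Const-linear ∘ˡ φ-linear) Const-linear ≃-refl step
  where
  step : ∀ a p → Const (φ p) ≃ Const p → Const (φ (a ◃ p)) ≃ Const (a ◃ p)
  step e0 p h = ≃-trans (congruent Const-linear (φ-◃ e0 p)) (≃-trans (Const-◃ e0 (φ p))
    (≃-trans (congruent (◃-linear e0) h) (≃-sym (Const-◃ e0 p))))
  step e1 p h = begin
    Const (φ (e1 ◃ p))                         ≈⟨ congruent Const-linear (φ-◃ e1 p) ⟩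
    Const (e1 ◃ φ p ⊖ ez ◃ φ p)                ≈⟨ subtractive Const-linear (e1 ◃ φ p) (ez ◃ φ p) ⟩
    Const (e1 ◃ φ p) ⊖ Const (ez ◃ φ p)        ≈⟨ ⊖-cong (Const-◃ e1 (φ p)) (Const-◃ ez (φ p)) ⟩
    e1 ◃ Const (φ p) ⊖ 𝟘                       ≈⟨ ⊕-identityʳ (e1 ◃ Const (φ p)) ⟩
    e1 ◃ Const (φ p)                           ≈⟨ congruent (◃-linear e1) h ⟩
    e1 ◃ Const p                               ≈⟨ Const-◃ e1 p ⟨
    Const (e1 ◃ p)                             ∎
  step ez p h = ≃-trans (annihilates Const-linear (φ-◃ ez p)) (≃-sym (Const-◃ ez p))

keepʳ : Letter → Poly → Poly
keepʳ a p = if does (a ≟ˡ ez) then 𝟘 else p ▹ a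

keepʳ-linear : ∀ a → Linear (keepʳ a)
keepʳ-linear e0 = ▹-linear e0
keepʳ-linear e1 = ▹-linear e1
keepʳ-linear ez = 𝟘ˡ

keep-keepʳ : ∀ c a p → keep c (keepʳ a p) ≡ keepʳ a (keep c p)
keep-keepʳ e0 e0 p = sym (◃-▹ e0 e0 p)
keep-keepʳ e0 e1 p = sym (◃-▹ e0 e1 p)
keep-keepʳ e0 ez p = refl
keep-keepʳ e1 e0 p = sym (◃-▹ e1 e0 p)
keep-keepʳ e1 e1 p = sym (◃-▹ e1 e1 p)
keep-keepʳ e1 ez p = refl
keep-keepʳ ez e0 p = refl
keep-keepʳ ez e1 p = refl
keep-keepʳ ez ez p = refl

Const-▹ : ∀ a p → Const (p ▹ a) ≃ keepʳ a (Const p)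
Const-▹ a = ∷-ext (Const-linear ∘ˡ ▹-linear a) (keepʳ-linear a ∘ˡ Const-linear) (base a) step
  where
  base : ∀ a → Const (letter a) ≃ keepʳ a (Const (word []))
  base e0 = ≃-refl
  base e1 = ≃-refl
  base ez = ≃-refl
  step : ∀ c p → Const (p ▹ a) ≃ keepʳ a (Const p) → Const ((c ◃ p) ▹ a) ≃ keepʳ a (Const (c ◃ p))
  step c p h = begin
    Const ((c ◃ p) ▹ a)          ≡⟨ cong Const (◃-▹ c a p) ⟩
    Const (c ◃ (p ▹ a))          ≈⟨ Const-◃ c (p ▹ a) ⟩
    keep c (Const (p ▹ a))       ≈⟨ congruent (keep-linear c) h ⟩
    keep c (keepʳ a (Const p))   ≡⟨ keep-keepʳ c a (Const p) ⟩
    keepʳ a (keep c (Const p))   ≈⟨ congruent (keepʳ-linear a) (Const-◃ c p) ⟨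
    keepʳ a (Const (c ◃ p))      ∎

-- Modulo words containing e_z, `τz` becomes e₀ ↦ -e₁, e₁ ↦ -e₀.
Const-τz : ∀ p → Const (τz p) ≃ τ∞ (Const p)
Const-τz = ∷-ext (Const-linear ∘ˡ τz-linear) (τ∞-linear ∘ˡ Const-linear) ≃-refl step
  where
  step : ∀ a p → Const (τz p) ≃ τ∞ (Const p) → Const (τz (a ◃ p)) ≃ τ∞ (Const (a ◃ p))
  step e0 p h = begin
    Const (τz (e0 ◃ p))                          ≈⟨ ≃-trans (congruent Const-linear (τz-e0 p)) (subtractive Const-linear (τz p ▹ ez) (τz p ▹ e1)) ⟩
    Const (τz p ▹ ez) ⊖ Const (τz p ▹ e1)        ≈⟨ ⊖-cong (Const-▹ ez (τz p)) (Const-▹ e1 (τz p)) ⟩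
    -1ℤ • Const (τz p) ▹ e1                      ≈⟨ •-cong -1ℤ (congruent (▹-linear e1) h) ⟩
    -1ℤ • τ∞ (Const p) ▹ e1                      ≈⟨ ≃-trans (congruent τ∞-linear (Const-◃ e0 p)) (τ∞-e0 (Const p)) ⟨
    τ∞ (Const (e0 ◃ p))                          ∎
  step e1 p h = begin
    Const (τz (e1 ◃ p))                          ≈⟨ ≃-trans (congruent Const-linear (τz-e1 p)) (subtractive Const-linear (τz p ▹ ez) (τz p ▹ e0)) ⟩
    Const (τz p ▹ ez) ⊖ Const (τz p ▹ e0)        ≈⟨ ⊖-cong (Const-▹ ez (τz p)) (Const-▹ e0 (τz p)) ⟩
    -1ℤ • Const (τz p) ▹ e0                      ≈⟨ •-cong -1ℤ (congruent (▹-linear e0) h) ⟩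
    -1ℤ • τ∞ (Const p) ▹ e0                      ≈⟨ ≃-trans (congruent τ∞-linear (Const-◃ e1 p)) (τ∞-e1 (Const p)) ⟨
    τ∞ (Const (e1 ◃ p))                          ∎
  step ez p h = ≃-trans (congruent Const-linear (τz-ez p)) (≃-trans (Const-▹ ez (τz p)) (≃-sym (annihilates τ∞-linear (Const-◃ ez p))))

Const-τ∞ : ∀ p → Const (τ∞ p) ≃ τ∞ (Const p)
Const-τ∞ = ∷-ext (Const-linear ∘ˡ τ∞-linear) (τ∞-linear ∘ˡ Const-linear) ≃-refl step
  where
  step : ∀ a p → Const (τ∞ p) ≃ τ∞ (Const p) → Const (τ∞ (a ◃ p)) ≃ τ∞ (Const (a ◃ p))
  step e0 p h = begin
    Const (τ∞ (e0 ◃ p))           ≈⟨ ≃-trans (congruent Const-linear (τ∞-e0 p)) (scaling Const-linear -1ℤ (τ∞ p ▹ e1)) ⟩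
    -1ℤ • Const (τ∞ p ▹ e1)       ≈⟨ •-cong -1ℤ (≃-trans (Const-▹ e1 (τ∞ p)) (congruent (▹-linear e1) h)) ⟩
    -1ℤ • τ∞ (Const p) ▹ e1       ≈⟨ ≃-trans (congruent τ∞-linear (Const-◃ e0 p)) (τ∞-e0 (Const p)) ⟨
    τ∞ (Const (e0 ◃ p))           ∎
  step e1 p h = begin
    Const (τ∞ (e1 ◃ p))           ≈⟨ ≃-trans (congruent Const-linear (τ∞-e1 p)) (scaling Const-linear -1ℤ (τ∞ p ▹ e0)) ⟩
    -1ℤ • Const (τ∞ p ▹ e0)       ≈⟨ •-cong -1ℤ (≃-trans (Const-▹ e0 (τ∞ p)) (congruent (▹-linear e0) h)) ⟩
    -1ℤ • τ∞ (Const p) ▹ e0       ≈⟨ ≃-trans (congruent τ∞-linear (Const-◃ e1 p)) (τ∞-e1 (Const p)) ⟨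
    τ∞ (Const (e1 ◃ p))           ∎
  step ez p h = ≃-trans (congruent Const-linear (τ∞-ez p)) (≃-trans (Const-▹ ez (τ∞ p)) (≃-sym (annihilates τ∞-linear (Const-◃ ez p))))

ε-τ∞ : ∀ p → ε (τ∞ p) ≃ ε p
ε-τ∞ = ∷-ext (ε-linear ∘ˡ τ∞-linear) ε-linear ≃-refl step
  where
  step : ∀ a p → _ → ε (τ∞ (a ◃ p)) ≃ ε (a ◃ p)
  step e0 p _ = ≃-trans (congruent ε-linear (τ∞-e0 p)) (≃-trans (null-• ε-linear -1ℤ (τ∞ p ▹ e1) (ε-▹ e1 (τ∞ p))) (≃-sym (ε-◃ e0 p)))
  step e1 p _ = ≃-trans (congruent ε-linear (τ∞-e1 p)) (≃-trans (null-• ε-linear -1ℤ (τ∞ p ▹ e0) (ε-▹ e0 (τ∞ p))) (≃-sym (ε-◃ e1 p)))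
  step ez p _ = ≃-trans (congruent ε-linear (τ∞-ez p)) (≃-trans (ε-▹ ez (τ∞ p)) (≃-sym (ε-◃ ez p)))

τ∞-ε : ∀ p → τ∞ (ε p) ≃ ε p
τ∞-ε = ext (τ∞-linear ∘ˡ ε-linear) ε-linear on-word
  where
  on-word : ∀ w → τ∞ (ε (word w)) ≃ ε (word w)
  on-word []      = ≃-refl
  on-word (_ ∷ _) = ≃-refl

stripʳ-e1-τ∞ : ∀ p → stripʳ e1 (τ∞ p) ≃ -1ℤ • τ∞ (stripˡ e0 p)
stripʳ-e1-τ∞ = ∷-ext (L ∘ˡ τ∞-linear) (-1ℤ •ˡ τ∞-linear ∘ˡ stripˡ-linear e0) ≃-refl step
  where
  L = stripʳ-linear e1
  step : ∀ a p → _ → stripʳ e1 (τ∞ (a ◃ p)) ≃ -1ℤ • τ∞ (stripˡ e0 (a ◃ p))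
  step e0 p _ = begin
    stripʳ e1 (τ∞ (e0 ◃ p))        ≈⟨ ≃-trans (congruent L (τ∞-e0 p)) (scaling L -1ℤ (τ∞ p ▹ e1)) ⟩
    -1ℤ • stripʳ e1 (τ∞ p ▹ e1)    ≈⟨ •-cong -1ℤ (stripʳ-▹ e1 e1 (τ∞ p)) ⟩
    -1ℤ • τ∞ p                     ≈⟨ •-cong -1ℤ (congruent τ∞-linear (stripˡ-◃ e0 e0 p)) ⟨
    -1ℤ • τ∞ (stripˡ e0 (e0 ◃ p))  ∎
  step e1 p _ = ≃-trans (congruent L (τ∞-e1 p)) (≃-trans (null-• L -1ℤ (τ∞ p ▹ e0) (stripʳ-▹ e1 e0 (τ∞ p)))
    (≃-sym (•-cong -1ℤ (annihilates τ∞-linear (stripˡ-◃ e0 e1 p)))))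
  step ez p _ = ≃-trans (congruent L (τ∞-ez p)) (≃-trans (stripʳ-▹ e1 ez (τ∞ p))
    (≃-sym (•-cong -1ℤ (annihilates τ∞-linear (stripˡ-◃ e0 ez p)))))

stripˡ-e0-τ∞ : ∀ p → stripˡ e0 (τ∞ p) ≃ -1ℤ • τ∞ (stripʳ e1 p)
stripˡ-e0-τ∞ = ∷-ext (L ∘ˡ τ∞-linear) (-1ℤ •ˡ τ∞-linear ∘ˡ stripʳ-linear e1) ≃-refl step
  where
  L = stripˡ-linear e0
  step : ∀ a p → stripˡ e0 (τ∞ p) ≃ -1ℤ • τ∞ (stripʳ e1 p) → stripˡ e0 (τ∞ (a ◃ p)) ≃ -1ℤ • τ∞ (stripʳ e1 (a ◃ p))
  step e0 p h = begin
    stripˡ e0 (τ∞ (e0 ◃ p))                    ≈⟨ ≃-trans (congruent L (τ∞-e0 p)) (scaling L -1ℤ (τ∞ p ▹ e1)) ⟩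
    -1ℤ • stripˡ e0 (τ∞ p ▹ e1)                ≈⟨ •-cong -1ℤ (≃-trans (stripˡ-▹ e0 e1 (τ∞ p)) (⊕-identityʳ (stripˡ e0 (τ∞ p) ▹ e1))) ⟩
    -1ℤ • stripˡ e0 (τ∞ p) ▹ e1                ≈⟨ •-cong -1ℤ (≃-trans (congruent (▹-linear e1) h) (scaling (▹-linear e1) -1ℤ (τ∞ (stripʳ e1 p)))) ⟩
    -1ℤ • -1ℤ • τ∞ (stripʳ e1 p) ▹ e1          ≈⟨ •-cong -1ℤ (τ∞-e0 (stripʳ e1 p)) ⟨
    -1ℤ • τ∞ (e0 ◃ stripʳ e1 p)                ≈⟨ •-cong -1ℤ (congruent τ∞-linear (≃-trans (stripʳ-◃ e1 e0 p) (⊕-identityʳ (e0 ◃ stripʳ e1 p)))) ⟨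
    -1ℤ • τ∞ (stripʳ e1 (e0 ◃ p))              ∎
  step e1 p h = begin
    stripˡ e0 (τ∞ (e1 ◃ p))                        ≈⟨ ≃-trans (congruent L (τ∞-e1 p)) (scaling L -1ℤ (τ∞ p ▹ e0)) ⟩
    -1ℤ • stripˡ e0 (τ∞ p ▹ e0)                    ≈⟨ •-cong -1ℤ (stripˡ-▹ e0 e0 (τ∞ p)) ⟩
    -1ℤ • (stripˡ e0 (τ∞ p) ▹ e0 ⊕ ε (τ∞ p))       ≈⟨ •-cong -1ℤ (⊕-cong (≃-trans (congruent (▹-linear e0) h) (scaling (▹-linear e0) -1ℤ (τ∞ (stripʳ e1 p)))) (≃-trans (ε-τ∞ p) (≃-sym (τ∞-ε p)))) ⟩
    -1ℤ • (-1ℤ • τ∞ (stripʳ e1 p) ▹ e0 ⊕ τ∞ (ε p)) ≈⟨ •-cong -1ℤ (⊕-cong (τ∞-e1 (stripʳ e1 p)) (≃-refl {τ∞ (ε p)})) ⟨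
    -1ℤ • (τ∞ (e1 ◃ stripʳ e1 p) ⊕ τ∞ (ε p))       ≈⟨ •-cong -1ℤ (≃-trans (congruent τ∞-linear (stripʳ-◃ e1 e1 p)) (additive τ∞-linear (e1 ◃ stripʳ e1 p) (ε p))) ⟨
    -1ℤ • τ∞ (stripʳ e1 (e1 ◃ p))                  ∎
  step ez p h = begin
    stripˡ e0 (τ∞ (ez ◃ p))                    ≈⟨ ≃-trans (congruent L (τ∞-ez p)) (stripˡ-▹ e0 ez (τ∞ p)) ⟩
    stripˡ e0 (τ∞ p) ▹ ez ⊕ 𝟘                  ≈⟨ ⊕-identityʳ (stripˡ e0 (τ∞ p) ▹ ez) ⟩
    stripˡ e0 (τ∞ p) ▹ ez                      ≈⟨ ≃-trans (congruent (▹-linear ez) h) (scaling (▹-linear ez) -1ℤ (τ∞ (stripʳ e1 p))) ⟩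
    -1ℤ • τ∞ (stripʳ e1 p) ▹ ez                ≈⟨ •-cong -1ℤ (τ∞-ez (stripʳ e1 p)) ⟨
    -1ℤ • τ∞ (ez ◃ stripʳ e1 p)                ≈⟨ •-cong -1ℤ (congruent τ∞-linear (≃-trans (stripʳ-◃ e1 ez p) (⊕-identityʳ (ez ◃ stripʳ e1 p)))) ⟨
    -1ℤ • τ∞ (stripʳ e1 (ez ◃ p))              ∎

-- The substitution of e₁ for e_z

merge : Letter → Letter
merge e0 = e0
merge e1 = e1
merge ez = e1

λ′-linear : Linear λ′
λ′-linear = linear-linear _

λ′-◃ : ∀ a p → λ′ (a ◃ p) ≃ merge a ◃ λ′ p
λ′-◃ e0 p = ≃-trans {q = letter e0 · λ′ p} (linear-◃ e0 (·-linearʳ (letter e0)) (λ _ → ≃-refl) p) (letter-· e0 (λ′ p))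
λ′-◃ e1 p = ≃-trans {q = letter e1 · λ′ p} (linear-◃ e1 (·-linearʳ (letter e1)) (λ _ → ≃-refl) p) (letter-· e1 (λ′ p))
λ′-◃ ez p = ≃-trans {q = letter e1 · λ′ p} (linear-◃ ez (·-linearʳ (letter e1)) (λ _ → ≃-refl) p) (letter-· e1 (λ′ p))

λ′-▹ : ∀ a p → λ′ (p ▹ a) ≃ λ′ p ▹ merge a
λ′-▹ a = ∷-ext (λ′-linear ∘ˡ ▹-linear a) (▹-linear (merge a) ∘ˡ λ′-linear) (base a) step
  where
  base : ∀ a → λ′ (letter a) ≃ λ′ (word []) ▹ merge a
  base e0 = ≃-refl
  base e1 = ≃-refl
  base ez = ≃-refl
  step : ∀ c p → λ′ (p ▹ a) ≃ λ′ p ▹ merge a → λ′ ((c ◃ p) ▹ a) ≃ λ′ (c ◃ p) ▹ merge a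
  step c p h = begin
    λ′ ((c ◃ p) ▹ a)               ≡⟨ cong λ′ (◃-▹ c a p) ⟩
    λ′ (c ◃ (p ▹ a))               ≈⟨ λ′-◃ c (p ▹ a) ⟩
    merge c ◃ λ′ (p ▹ a)           ≈⟨ congruent (◃-linear (merge c)) h ⟩
    merge c ◃ (λ′ p ▹ merge a)     ≡⟨ ◃-▹ (merge c) (merge a) (λ′ p) ⟨
    (merge c ◃ λ′ p) ▹ merge a     ≈⟨ congruent (▹-linear (merge a)) (λ′-◃ c p) ⟨
    λ′ (c ◃ p) ▹ merge a           ∎

-- A shuffle interleaves positions without regard to the letters, so replacing letters by letters is
-- compatible with it.
λ′-ш : ∀ p q → λ′ (p ш q) ≃ λ′ p ш λ′ q
λ′-ш = ext₂ ((λ q → λ′-linear ∘ˡ ш-linearˡ q) , (λ p → λ′-linear ∘ˡ ш-linearʳ p))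
  ((λ q → ш-linearˡ (λ′ q) ∘ˡ λ′-linear) , (λ p → ш-linearʳ (λ′ p) ∘ˡ λ′-linear)) on-word
  where
  step : ∀ a b U V → λ′ (U ш (b ◃ V)) ≃ λ′ U ш λ′ (b ◃ V) → λ′ ((a ◃ U) ш V) ≃ λ′ (a ◃ U) ш λ′ V →
    λ′ ((a ◃ U) ш (b ◃ V)) ≃ λ′ (a ◃ U) ш λ′ (b ◃ V)
  step a b U V h₁ h₂ = begin
    λ′ ((a ◃ U) ш (b ◃ V))
      ≈⟨ congruent λ′-linear (◃-ш-◃ a b U V) ⟩
    λ′ (a ◃ (U ш (b ◃ V)) ⊕ b ◃ ((a ◃ U) ш V))
      ≈⟨ additive λ′-linear (a ◃ (U ш (b ◃ V))) (b ◃ ((a ◃ U) ш V)) ⟩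
    λ′ (a ◃ (U ш (b ◃ V))) ⊕ λ′ (b ◃ ((a ◃ U) ш V))
      ≈⟨ ⊕-cong (λ′-◃ a (U ш (b ◃ V))) (λ′-◃ b ((a ◃ U) ш V)) ⟩
    merge a ◃ λ′ (U ш (b ◃ V)) ⊕ merge b ◃ λ′ ((a ◃ U) ш V)
      ≈⟨ ⊕-cong (congruent (◃-linear (merge a)) (≃-trans h₁ (congruent (ш-linearʳ (λ′ U)) (λ′-◃ b V))))
                (congruent (◃-linear (merge b)) (≃-trans h₂ (congruent (ш-linearˡ (λ′ V)) (λ′-◃ a U)))) ⟩
    merge a ◃ (λ′ U ш (merge b ◃ λ′ V)) ⊕ merge b ◃ ((merge a ◃ λ′ U) ш λ′ V)
      ≈⟨ ◃-ш-◃ (merge a) (merge b) (λ′ U) (λ′ V) ⟨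
    (merge a ◃ λ′ U) ш (merge b ◃ λ′ V)
      ≈⟨ ш-cong (λ′-◃ a U) (λ′-◃ b V) ⟨
    λ′ (a ◃ U) ш λ′ (b ◃ V) ∎
  on-word : ∀ u v → λ′ (word u ш word v) ≃ λ′ (word u) ш λ′ (word v)
  on-word [] v = ≃-trans (congruent λ′-linear (ш-identityˡ (word v))) (≃-sym (ш-identityˡ (λ′ (word v))))
  on-word u@(_ ∷ _) [] = ≃-trans (congruent λ′-linear (ш-identityʳ (word u))) (≃-sym (ш-identityʳ (λ′ (word u))))
  on-word (a ∷ u) (b ∷ v) = step a b (word u) (word v) (on-word u (b ∷ v)) (on-word (a ∷ u) v)

λ′-Const : ∀ p → λ′ (Const p) ≃ Const p
λ′-Const = ∷-ext (λ′-linear ∘ˡ Const-linear) Const-linear ≃-refl step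
  where
  step : ∀ a p → λ′ (Const p) ≃ Const p → λ′ (Const (a ◃ p)) ≃ Const (a ◃ p)
  step e0 p h = ≃-trans (congruent λ′-linear (Const-◃ e0 p)) (≃-trans (λ′-◃ e0 (Const p))
    (≃-trans (congruent (◃-linear e0) h) (≃-sym (Const-◃ e0 p))))
  step e1 p h = ≃-trans (congruent λ′-linear (Const-◃ e1 p)) (≃-trans (λ′-◃ e1 (Const p))
    (≃-trans (congruent (◃-linear e1) h) (≃-sym (Const-◃ e1 p))))
  step ez p h = ≃-trans (annihilates λ′-linear (Const-◃ ez p)) (≃-sym (Const-◃ ez p))

Const-λ′ : ∀ p → Const (λ′ p) ≃ λ′ p
Const-λ′ = ∷-ext (Const-linear ∘ˡ λ′-linear) λ′-linear ≃-refl step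
  where
  keep-merge : ∀ a p → keep (merge a) p ≃ merge a ◃ p
  keep-merge e0 p = ≃-refl
  keep-merge e1 p = ≃-refl
  keep-merge ez p = ≃-refl
  step : ∀ a p → Const (λ′ p) ≃ λ′ p → Const (λ′ (a ◃ p)) ≃ λ′ (a ◃ p)
  step a p h = begin
    Const (λ′ (a ◃ p))             ≈⟨ congruent Const-linear (λ′-◃ a p) ⟩
    Const (merge a ◃ λ′ p)         ≈⟨ Const-◃ (merge a) (λ′ p) ⟩
    keep (merge a) (Const (λ′ p))  ≈⟨ congruent (keep-linear (merge a)) h ⟩
    keep (merge a) (λ′ p)          ≈⟨ keep-merge a (λ′ p) ⟩
    merge a ◃ λ′ p                 ≈⟨ λ′-◃ a p ⟨
    λ′ (a ◃ p)                     ∎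

stripˡ-e0-λ′ : ∀ p → stripˡ e0 (λ′ p) ≃ λ′ (stripˡ e0 p)
stripˡ-e0-λ′ = ∷-ext (stripˡ-linear e0 ∘ˡ λ′-linear) (λ′-linear ∘ˡ stripˡ-linear e0) ≃-refl step
  where
  when-merge : ∀ a p → when (does (merge a ≟ˡ e0)) (λ′ p) ≃ λ′ (when (does (a ≟ˡ e0)) p)
  when-merge e0 p = ≃-refl
  when-merge e1 p = ≃-refl
  when-merge ez p = ≃-refl
  step : ∀ a p → _ → stripˡ e0 (λ′ (a ◃ p)) ≃ λ′ (stripˡ e0 (a ◃ p))
  step a p _ = begin
    stripˡ e0 (λ′ (a ◃ p))                 ≈⟨ congruent (stripˡ-linear e0) (λ′-◃ a p) ⟩
    stripˡ e0 (merge a ◃ λ′ p)             ≈⟨ stripˡ-◃ e0 (merge a) (λ′ p) ⟩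
    when (does (merge a ≟ˡ e0)) (λ′ p)     ≈⟨ when-merge a p ⟩
    λ′ (when (does (a ≟ˡ e0)) p)           ≈⟨ congruent λ′-linear (stripˡ-◃ e0 a p) ⟨
    λ′ (stripˡ e0 (a ◃ p))                 ∎

-- After merging, a final `e1` may have been `e1` or `ez`. Both are excluded on 𝒜_z⁻², whereas 𝒜_z⁰
-- excludes only the first; this is why λ′ is restricted to 𝒜_z⁻².
stripʳ-e1-λ′ : ∀ p → stripʳ e1 (λ′ p) ≃ λ′ (stripʳ e1 p) ⊕ λ′ (stripʳ ez p)
stripʳ-e1-λ′ = ∷ʳ-ext (stripʳ-linear e1 ∘ˡ λ′-linear) ((λ′-linear ∘ˡ stripʳ-linear e1) ⊕ˡ (λ′-linear ∘ˡ stripʳ-linear ez)) ≃-refl step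
  where
  when-merge : ∀ a p → when (does (merge a ≟ˡ e1)) (λ′ p) ≃ λ′ (when (does (a ≟ˡ e1)) p) ⊕ λ′ (when (does (a ≟ˡ ez)) p)
  when-merge e0 p = ≃-refl
  when-merge e1 p = ≃-sym (⊕-identityʳ (λ′ p))
  when-merge ez p = ≃-refl
  step : ∀ a p → stripʳ e1 (λ′ (p ▹ a)) ≃ λ′ (stripʳ e1 (p ▹ a)) ⊕ λ′ (stripʳ ez (p ▹ a))
  step a p = begin
    stripʳ e1 (λ′ (p ▹ a))                                               ≈⟨ congruent (stripʳ-linear e1) (λ′-▹ a p) ⟩
    stripʳ e1 (λ′ p ▹ merge a)                                           ≈⟨ stripʳ-▹ e1 (merge a) (λ′ p) ⟩
    when (does (merge a ≟ˡ e1)) (λ′ p)                                   ≈⟨ when-merge a p ⟩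
    λ′ (when (does (a ≟ˡ e1)) p) ⊕ λ′ (when (does (a ≟ˡ ez)) p)          ≈⟨ ⊕-cong (congruent λ′-linear (stripʳ-▹ e1 a p)) (congruent λ′-linear (stripʳ-▹ ez a p)) ⟨
    λ′ (stripʳ e1 (p ▹ a)) ⊕ λ′ (stripʳ ez (p ▹ a))                      ∎

-- A leading `e1` turns into e₁ - e_z under `φ`, and `λ′` sends this difference to zero. Without
-- words starting in `e0`, only the constant term survives.
λ′-φ : ∀ p → stripˡ e0 p ≃ 𝟘 → λ′ (φ p) ≃ ε p
λ′-φ p h = begin
  λ′ (φ p)
    ≈⟨ congruent L (decompose p) ⟩
  λ′ (φ (ε p ⊕ Σˡ λ a → a ◃ stripˡ a p))
    ≈⟨ solve ((_ , L) ∷ []) (ε p ∷ e0 ◃ stripˡ e0 p ∷ e1 ◃ stripˡ e1 p ∷ ez ◃ stripˡ ez p ∷ [])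
        (#0 $ (x₀ :⊕ (x₁ :⊕ x₂ :⊕ x₃))) (#0 $ x₀ :⊕ (#0 $ x₁ :⊕ #0 $ x₂ :⊕ #0 $ x₃)) refl ⟩
  λ′ (φ (ε p)) ⊕ (λ′ (φ (e0 ◃ stripˡ e0 p)) ⊕ λ′ (φ (e1 ◃ stripˡ e1 p)) ⊕ λ′ (φ (ez ◃ stripˡ ez p)))
    ≈⟨ ⊕-cong (λ′-φ-ε p) (⊕-cong (⊕-cong (annihilates (L ∘ˡ ◃-linear e0) h) (λ′-φ-e1 (stripˡ e1 p))) (annihilates λ′-linear (φ-◃ ez (stripˡ ez p)))) ⟩
  ε p ⊕ 𝟘
    ≈⟨ ⊕-identityʳ (ε p) ⟩
  ε p ∎
  where
  L = λ′-linear ∘ˡ φ-linear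
  λ′-φ-ε : ∀ p → λ′ (φ (ε p)) ≃ ε p
  λ′-φ-ε = ext (L ∘ˡ ε-linear) ε-linear on-word
    where
    on-word : ∀ w → λ′ (φ (ε (word w))) ≃ ε (word w)
    on-word []      = ≃-refl
    on-word (_ ∷ _) = ≃-refl
  λ′-φ-e1 : ∀ q → λ′ (φ (e1 ◃ q)) ≃ 𝟘
  λ′-φ-e1 q = begin
    λ′ (φ (e1 ◃ q))                        ≈⟨ congruent λ′-linear (φ-◃ e1 q) ⟩
    λ′ (e1 ◃ φ q ⊖ ez ◃ φ q)               ≈⟨ subtractive λ′-linear (e1 ◃ φ q) (ez ◃ φ q) ⟩
    λ′ (e1 ◃ φ q) ⊖ λ′ (ez ◃ φ q)          ≈⟨ ⊖-cong (λ′-◃ e1 (φ q)) (λ′-◃ ez (φ q)) ⟩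
    e1 ◃ λ′ (φ q) ⊖ e1 ◃ λ′ (φ q)          ≈⟨ ⊖-self (e1 ◃ λ′ (φ q)) ⟩
    𝟘                                      ∎

-- Membership in 𝒜_z⁰, 𝒜_z⁻² and 𝒜⁰

-- Conditions on supports are recast as equations, which pass through linear maps and derivations.
-- The word e_z satisfies both, and e₀ and e₁ each violate one, in agreement with the separate
-- summand ℤe_z of 𝒜_z⁰.
record In𝒜z⁰ (p : Poly) : Set where
  constructor _,_
  field
    no-e0-first : stripˡ e0 p ≃ 𝟘
    no-e1-last  : stripʳ e1 p ≃ 𝟘
open In𝒜z⁰

record In𝒜z⁻² (p : Poly) : Set where
  constructor _,_
  field
    in𝒜z⁰      : In𝒜z⁰ p
    no-ez-last : stripʳ ez p ≃ 𝟘
open In𝒜z⁻²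

record In𝒜⁰ (p : Poly) : Set where
  constructor _,_
  field
    in𝒜z⁰ : In𝒜z⁰ p
    no-ez : Const p ≃ p
open In𝒜⁰ using (no-ez) renaming (in𝒜z⁰ to 𝒜⁰⇒𝒜z⁰)

In𝒜z⁰-resp : ∀ {p q} → p ≃ q → In𝒜z⁰ p → In𝒜z⁰ q
In𝒜z⁰-resp e (l , r) = ≃-trans (congruent (stripˡ-linear e0) (≃-sym e)) l , ≃-trans (congruent (stripʳ-linear e1) (≃-sym e)) r

In𝒜z⁰-⊕ : ∀ {p q} → In𝒜z⁰ p → In𝒜z⁰ q → In𝒜z⁰ (p ⊕ q)
In𝒜z⁰-⊕ {p} {q} (l , r) (l′ , r′) = null-⊕ (stripˡ-linear e0) p q l l′ , null-⊕ (stripʳ-linear e1) p q r r′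

In𝒜z⁰-• : ∀ c {p} → In𝒜z⁰ p → In𝒜z⁰ (c • p)
In𝒜z⁰-• c {p} (l , r) = null-• (stripˡ-linear e0) c p l , null-• (stripʳ-linear e1) c p r

In𝒜z⁰-ш : ∀ {p q} → In𝒜z⁰ p → In𝒜z⁰ q → In𝒜z⁰ (p ш q)
In𝒜z⁰-ш {p} {q} (l , r) (l′ , r′) =
  derivation-null (stripˡ-ш e0) {p} {q} l l′ , derivation-null (stripʳ-ш e1) {p} {q} r r′

In𝒜⁰-resp : ∀ {p q} → p ≃ q → In𝒜⁰ p → In𝒜⁰ q
In𝒜⁰-resp e (i , c) = In𝒜z⁰-resp e i , ≃-trans (congruent Const-linear (≃-sym e)) (≃-trans c e)

In𝒜⁰-⊕ : ∀ {p q} → In𝒜⁰ p → In𝒜⁰ q → In𝒜⁰ (p ⊕ q)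
In𝒜⁰-⊕ {p} {q} (i , c) (i′ , c′) = In𝒜z⁰-⊕ i i′ , ≃-trans (additive Const-linear p q) (⊕-cong c c′)

In𝒜⁰-• : ∀ d {p} → In𝒜⁰ p → In𝒜⁰ (d • p)
In𝒜⁰-• d {p} (i , c) = In𝒜z⁰-• d i , ≃-trans (scaling Const-linear d p) (•-cong d c)

stripˡ-ez-Const : ∀ p → stripˡ ez (Const p) ≃ 𝟘
stripˡ-ez-Const = ∷-ext (stripˡ-linear ez ∘ˡ Const-linear) 𝟘ˡ ≃-refl step
  where
  step : ∀ a p → _ → stripˡ ez (Const (a ◃ p)) ≃ 𝟘
  step e0 p _ = ≃-trans (congruent (stripˡ-linear ez) (Const-◃ e0 p)) (stripˡ-◃ ez e0 (Const p))
  step e1 p _ = ≃-trans (congruent (stripˡ-linear ez) (Const-◃ e1 p)) (stripˡ-◃ ez e1 (Const p))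
  step ez p _ = annihilates (stripˡ-linear ez) (Const-◃ ez p)

stripʳ-ez-Const : ∀ p → stripʳ ez (Const p) ≃ 𝟘
stripʳ-ez-Const = ∷ʳ-ext (stripʳ-linear ez ∘ˡ Const-linear) 𝟘ˡ ≃-refl step
  where
  step : ∀ a p → stripʳ ez (Const (p ▹ a)) ≃ 𝟘
  step e0 p = ≃-trans (congruent (stripʳ-linear ez) (Const-▹ e0 p)) (stripʳ-▹ ez e0 (Const p))
  step e1 p = ≃-trans (congruent (stripʳ-linear ez) (Const-▹ e1 p)) (stripʳ-▹ ez e1 (Const p))
  step ez p = annihilates (stripʳ-linear ez) (Const-▹ ez p)

stripˡ-e0-Const : ∀ p → stripˡ e0 (Const p) ≃ Const (stripˡ e0 p)
stripˡ-e0-Const = ∷-ext (L ∘ˡ Const-linear) (Const-linear ∘ˡ L) ≃-refl step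
  where
  L = stripˡ-linear e0
  step : ∀ a p → _ → stripˡ e0 (Const (a ◃ p)) ≃ Const (stripˡ e0 (a ◃ p))
  step e0 p _ = ≃-trans (congruent L (Const-◃ e0 p)) (≃-trans (stripˡ-◃ e0 e0 (Const p)) (≃-sym (congruent Const-linear (stripˡ-◃ e0 e0 p))))
  step e1 p _ = ≃-trans (congruent L (Const-◃ e1 p)) (≃-trans (stripˡ-◃ e0 e1 (Const p)) (≃-sym (annihilates Const-linear (stripˡ-◃ e0 e1 p))))
  step ez p _ = ≃-trans (annihilates L (Const-◃ ez p)) (≃-sym (annihilates Const-linear (stripˡ-◃ e0 ez p)))

stripʳ-e1-Const : ∀ p → stripʳ e1 (Const p) ≃ Const (stripʳ e1 p)
stripʳ-e1-Const = ∷ʳ-ext (L ∘ˡ Const-linear) (Const-linear ∘ˡ L) ≃-refl step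
  where
  L = stripʳ-linear e1
  step : ∀ a p → stripʳ e1 (Const (p ▹ a)) ≃ Const (stripʳ e1 (p ▹ a))
  step e0 p = ≃-trans (congruent L (Const-▹ e0 p)) (≃-trans (stripʳ-▹ e1 e0 (Const p)) (≃-sym (annihilates Const-linear (stripʳ-▹ e1 e0 p))))
  step e1 p = ≃-trans (congruent L (Const-▹ e1 p)) (≃-trans (stripʳ-▹ e1 e1 (Const p)) (≃-sym (congruent Const-linear (stripʳ-▹ e1 e1 p))))
  step ez p = ≃-trans (annihilates L (Const-▹ ez p)) (≃-sym (annihilates Const-linear (stripʳ-▹ e1 ez p)))

Const-Const : ∀ p → Const (Const p) ≃ Const p
Const-Const p = begin
  Const (Const p)       ≈⟨ congruent Const-linear (λ′-Const p) ⟨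
  Const (λ′ (Const p))  ≈⟨ Const-λ′ (Const p) ⟩
  λ′ (Const p)          ≈⟨ λ′-Const p ⟩
  Const p               ∎

In𝒜⁰-Const : ∀ {p} → In𝒜z⁰ p → In𝒜⁰ (Const p)
In𝒜⁰-Const {p} (l , r) =
  (≃-trans (stripˡ-e0-Const p) (annihilates Const-linear l) , ≃-trans (stripʳ-e1-Const p) (annihilates Const-linear r)) , Const-Const p

𝒜⁰⇒𝒜z⁻² : ∀ {p} → In𝒜⁰ p → In𝒜z⁻² p
𝒜⁰⇒𝒜z⁻² {p} (i , c) = i , ≃-trans (congruent (stripʳ-linear ez) (≃-sym c)) (stripʳ-ez-Const p)

In𝒜⁰-τ∞ : ∀ {p} → In𝒜⁰ p → In𝒜⁰ (τ∞ p)
In𝒜⁰-τ∞ {p} ((l , r) , c) =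
  ( ≃-trans (stripˡ-e0-τ∞ p) (•-cong -1ℤ (annihilates τ∞-linear r))
  , ≃-trans (stripʳ-e1-τ∞ p) (•-cong -1ℤ (annihilates τ∞-linear l)) ) ,
  ≃-trans (Const-τ∞ p) (congruent τ∞-linear c)

Δ-linear : Linear Δ
Δ-linear = idˡ ⊖ˡ τ∞-linear

In𝒜⁰-Δ : ∀ {p} → In𝒜⁰ p → In𝒜⁰ (Δ p)
In𝒜⁰-Δ i = In𝒜⁰-⊕ i (In𝒜⁰-• -1ℤ (In𝒜⁰-τ∞ i))

In𝒜z⁻²-φ : ∀ {p} → In𝒜z⁰ p → In𝒜z⁻² (φ p)
In𝒜z⁻²-φ {p} (l , r) =
  (≃-trans (stripˡ-e0-φ p) (annihilates φ-linear l) , ≃-trans (stripʳ-e1-φ p) (annihilates φ-linear r)) ,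
  ≃-trans (stripʳ-ez-φ p) (•-cong -1ℤ (annihilates φ-linear r))

In𝒜⁰-λ′ : ∀ {p} → In𝒜z⁻² p → In𝒜⁰ (λ′ p)
In𝒜⁰-λ′ {p} ((l , r) , z) =
  ( ≃-trans (stripˡ-e0-λ′ p) (annihilates λ′-linear l)
  , ≃-trans (stripʳ-e1-λ′ p) (⊕-cong (annihilates λ′-linear r) (annihilates λ′-linear z)) ) , Const-λ′ p

λ′-fixes : ∀ {p} → Const p ≃ p → λ′ p ≃ p
λ′-fixes {p} c = ≃-trans (congruent λ′-linear (≃-sym c)) (≃-trans (λ′-Const p) c)

-- Comparison with the support conditions

coeff-null : ∀ f w → (∀ v → coeff (f v) w ≡ 0ℤ) → ∀ p → coeff (linear f p) w ≡ 0ℤ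
coeff-null f w h []            = refl
coeff-null f w h ((c , v) ∷ p) = trans (coeff-⊕ (c • f v) (linear f p) w)
  (cong₂ _+ℤ_ (trans (coeff-• c (f v) w) (trans (cong (c *ℤ_) (h v)) (*-zeroʳ c))) (coeff-null f w h p))

coeff-Const-ez : ∀ p {w} → Any (_≡ ez) w → coeff (Const p) w ≡ 0ℤ
coeff-Const-ez p {w} z = coeff-null Constʷ w on-word p
  where
  on-word : ∀ v → coeff (Constʷ v) w ≡ 0ℤ
  on-word v with any? (_≟ˡ ez) v
  ... | yes _ = refl
  ... | no ¬z = coeff-word-≢ {v} {w} λ { refl → ¬z z }

coeff-Const : ∀ p {w} → ¬ Any (_≡ ez) w → coeff (Const p) w ≡ coeff p w
coeff-Const p {w} ¬z = coeff-linear Constʷ w w on-word p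
  where
  on-word : ∀ v → coeff (Constʷ v) w ≡ coeff (word v) w
  on-word v with any? (_≟ˡ ez) v
  ... | yes z = sym (coeff-word-≢ {v} {w} λ { refl → ¬z z })
  ... | no _  = refl

first-null : ∀ p a w → stripˡ a p ≃ 𝟘 → coeff p (a ∷ w) ≡ 0ℤ
first-null p a w h = trans (sym (coeff-stripˡ a p w)) (coeff-≡ h w)

last-null : ∀ p w a → stripʳ a p ≃ 𝟘 → coeff p (w ∷ʳ a) ≡ 0ℤ
last-null p w a h = trans (sym (coeff-stripʳ a p w)) (coeff-≡ h w)

to-𝒜z⁰ : ∀ {p} → In𝒜z⁰ p → 𝒜z⁰ p
to-𝒜z⁰ (l , r) [] _ = inj₂ empty
to-𝒜z⁰ {p} (l , r) (a ∷ w) c≢0 with initLast w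
to-𝒜z⁰ {p} (l , r) (e0 ∷ w) c≢0 | _        = ⊥-elim (c≢0 (first-null p e0 w l))
to-𝒜z⁰ {p} (l , r) (e1 ∷ _) c≢0 | []       = ⊥-elim (c≢0 (last-null p [] e1 r))
to-𝒜z⁰ {p} (l , r) (ez ∷ _) c≢0 | []       = inj₁ refl
to-𝒜z⁰ {p} (l , r) (a  ∷ _) c≢0 | v ∷ʳ′ e1 = ⊥-elim (c≢0 (last-null p (a ∷ v) e1 r))
to-𝒜z⁰ {p} (l , r) (e1 ∷ _) c≢0 | v ∷ʳ′ e0 = inj₂ (ends (here refl) v (here refl))
to-𝒜z⁰ {p} (l , r) (e1 ∷ _) c≢0 | v ∷ʳ′ ez = inj₂ (ends (here refl) v (there (here refl)))
to-𝒜z⁰ {p} (l , r) (ez ∷ _) c≢0 | v ∷ʳ′ e0 = inj₂ (ends (there (here refl)) v (here refl))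
to-𝒜z⁰ {p} (l , r) (ez ∷ _) c≢0 | v ∷ʳ′ ez = inj₂ (ends (there (here refl)) v (there (here refl)))

to-𝒜z⁻² : ∀ {p} → In𝒜z⁻² p → 𝒜z⁻² p
to-𝒜z⁻² {p} (i , z) w c≢0 with to-𝒜z⁰ i w c≢0
... | inj₁ refl                               = ⊥-elim (c≢0 (last-null p [] ez z))
... | inj₂ empty                              = empty
... | inj₂ (ends a u (here refl))             = ends a u (here refl)
... | inj₂ (ends {a} _ u (there (here refl))) = ⊥-elim (c≢0 (last-null p (a ∷ u) ez z))

∷ʳ-≢[] : ∀ (w : Word) {a} → w ∷ʳ a ≢ []
∷ʳ-≢[] []      ()
∷ʳ-≢[] (_ ∷ _) ()

Bounded-last : ∀ {S T w x b} → Bounded S T x → x ≡ w ∷ʳ b → b ∈ T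
Bounded-last {w = w} empty e = ⊥-elim (∷ʳ-≢[] w (sym e))
Bounded-last {w = w} (ends {a} _ u b∈T) e with refl ← proj₂ (∷ʳ-injective (a ∷ u) w e) = b∈T

from-𝒜⁰ : ∀ {p} → 𝒜⁰ p → In𝒜⁰ p
from-𝒜⁰ {p} h = (pointwise first , pointwise last) , pointwise const
  where
  zero-unless : ∀ w → ¬ (Bounded [ e1 ] [ e0 ] w × Over (e0 ∷ e1 ∷ []) w) → coeff p w ≡ 0ℤ
  zero-unless w ¬b = decidable-stable (coeff p w ≟ℤ 0ℤ) λ c≢0 → ¬b (h w c≢0)
  first : ∀ w → coeff (stripˡ e0 p) w ≡ 0ℤ
  first w = trans (coeff-stripˡ e0 p w) (zero-unless (e0 ∷ w) λ { (ends (here ()) _ _ , _) ; (ends (there ()) _ _ , _) })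
  last : ∀ w → coeff (stripʳ e1 p) w ≡ 0ℤ
  last w = trans (coeff-stripʳ e1 p w) (zero-unless (w ∷ʳ e1) λ (b , _) → not-e0 (Bounded-last {w = w} b refl))
    where
    not-e0 : ¬ (e1 ∈ [ e0 ])
    not-e0 (here ())
    not-e0 (there ())
  no-ez-in : ∀ {w} → Over (e0 ∷ e1 ∷ []) w → ¬ Any (_≡ ez) w
  no-ez-in (here () ∷ _)           (here refl)
  no-ez-in (there (here ()) ∷ _)   (here refl)
  no-ez-in (there (there ()) ∷ _)  (here refl)
  no-ez-in (_ ∷ o) (there z) = no-ez-in o z
  const : ∀ w → coeff (Const p) w ≡ coeff p w
  const w with any? (_≟ˡ ez) w
  ... | yes z = trans (coeff-Const-ez p z) (sym (zero-unless w λ (_ , o) → no-ez-in o z))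
  ... | no ¬z = coeff-Const p ¬z

-- The dual basis

-- The value at `e1` is set to zero so that operators can be indexed by all words; those containing
-- `e1` then contribute nothing.
D : Letter → Poly → Poly
D e0 p = -1ℤ • K p
D e1 p = 𝟘
D ez p = J p

D-linear : ∀ a → Linear (D a)
D-linear e0 = -1ℤ •ˡ K-linear
D-linear e1 = 𝟘ˡ
D-linear ez = J-linear

-- The letters of r are removed from the right, so r indexes the word dual to D* _ r in
-- reverse order.
D* : Poly → Word → Poly
D* p []      = p
D* p (a ∷ r) = D* (D a p) r

D*-linear : ∀ r → Linear (λ p → D* p r)
D*-linear []      = idˡ
D*-linear (a ∷ r) = D*-linear r ∘ˡ D-linear a

In𝒜z⁰-D : ∀ a {p} → In𝒜z⁰ p → In𝒜z⁰ (D a p)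
In𝒜z⁰-D e0 {p} (l , r) = In𝒜z⁰-• -1ℤ
  (≃-trans (stripˡ-e0-K p) (annihilates K-linear l) , ≃-trans (stripʳ-e1-K p) (annihilates K-linear r))
In𝒜z⁰-D e1 i = ≃-refl , ≃-refl
In𝒜z⁰-D ez {p} (l , r) =
  ≃-trans (stripˡ-e0-J p) (annihilates J-linear l) , ≃-trans (stripʳ-e1-J p) (annihilates J-linear r)

In𝒜z⁰-D* : ∀ r {p} → In𝒜z⁰ p → In𝒜z⁰ (D* p r)
In𝒜z⁰-D* []      i = i
In𝒜z⁰-D* (a ∷ r) i = In𝒜z⁰-D* r (In𝒜z⁰-D a i)

D-τz : ∀ a {p} → In𝒜z⁰ p → D a (τz p) ≃ τz (D a p)
D-τz e0 {p} i = ≃-trans (•-cong -1ℤ (K-τz p)) (≃-sym (scaling τz-linear -1ℤ (K p)))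
D-τz e1 i = ≃-refl
-- The boundary terms of `J-τz` are the two strips that vanish on 𝒜_z⁰.
D-τz ez {p} (l , r) = ≃-trans (J-τz p) (congruent τz-linear
  (≃-trans (⊕-cong (⊕-cong (≃-refl {J p}) l) r) (≃-trans (⊕-identityʳ (J p ⊕ 𝟘)) (⊕-identityʳ (J p)))))

D*-τz : ∀ r {p} → In𝒜z⁰ p → D* (τz p) r ≃ τz (D* p r)
D*-τz []      i = ≃-refl
D*-τz (a ∷ r) i = ≃-trans (congruent (D*-linear r) (D-τz a i)) (D*-τz r (In𝒜z⁰-D a i))

-- A word without e_z has no adjacency involving e_z, and the boundary letters 0 and 1 do not create
-- one.
J-Const : ∀ p → J (Const p) ≃ 𝟘
J-Const = ∷-ext (J-linear ∘ˡ Const-linear) 𝟘ˡ ≃-refl step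
  where
  step : ∀ a p → J (Const p) ≃ 𝟘 → J (Const (a ◃ p)) ≃ 𝟘
  step e0 p h = ≃-trans (congruent J-linear (Const-◃ e0 p)) (≃-trans (J-◃-e0 (Const p)) (annihilates (◃-linear e0) h))
  step e1 p h = ≃-trans (congruent J-linear (Const-◃ e1 p)) (≃-trans (J-◃-e1 (Const p))
    (⊕-cong (annihilates (◃-linear e1) h)
      (⊖-cong (annihilates (◃-linear ez) (stripˡ-ez-Const p)) (annihilates (◃-linear e1) (stripˡ-ez-Const p)))))
  step ez p h = annihilates J-linear (Const-◃ ez p)

K-Const : ∀ p → K (Const p) ≃ 𝟘
K-Const = ∷-ext (K-linear ∘ˡ Const-linear) 𝟘ˡ ≃-refl step
  where
  step : ∀ a p → K (Const p) ≃ 𝟘 → K (Const (a ◃ p)) ≃ 𝟘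
  step e0 p h = ≃-trans (congruent K-linear (Const-◃ e0 p)) (≃-trans (K-◃-e0 (Const p))
    (⊕-cong (annihilates (◃-linear e0) h) (annihilates (◃-linear ez) (stripˡ-ez-Const p))))
  step e1 p h = ≃-trans (congruent K-linear (Const-◃ e1 p)) (≃-trans (K-◃-e1 (Const p))
    (⊕-cong (annihilates (◃-linear e1) h) (annihilates (◃-linear ez) (stripˡ-ez-Const p))))
  step ez p h = annihilates K-linear (Const-◃ ez p)

D-Const : ∀ a p → Const p ≃ p → D a p ≃ 𝟘
D-Const e0 p c = •-cong -1ℤ (≃-trans (congruent K-linear (≃-sym c)) (K-Const p))
D-Const e1 p c = ≃-refl
D-Const ez p c = ≃-trans (congruent J-linear (≃-sym c)) (J-Const p)

K-ш : Derivation K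
K-ш p q = ≃-trans (⊕-cong (∂from-ш ez e0 e0 p q) (∂from-ш ez e1 e0 p q))
  (solve ((_ , ш-linearˡ q) ∷ (_ , ш-linearʳ p) ∷ []) (∂ ez e0 p ∷ ∂ ez e1 p ∷ ∂ ez e0 q ∷ ∂ ez e1 q ∷ [])
    ((#0 $ x₀ :⊕ #1 $ x₂) :⊕ (#0 $ x₁ :⊕ #1 $ x₃)) (#0 $ (x₀ :⊕ x₁) :⊕ #1 $ (x₂ :⊕ x₃)) refl)

D-ш : ∀ a → Derivation (D a)
D-ш e0 p q = ≃-trans (•-cong -1ℤ (K-ш p q))
  (solve ((_ , ш-linearˡ q) ∷ (_ , ш-linearʳ p) ∷ []) (K p ∷ K q ∷ [])
    (-1ℤ :• (#0 $ x₀ :⊕ #1 $ x₁)) (#0 $ (-1ℤ :• x₀) :⊕ #1 $ (-1ℤ :• x₁)) refl)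
D-ш e1 p q = ≃-sym (null (ш-linearʳ p))
D-ш ez = ∂from-ш ez e1 e0

-- A derivation that kills `a` commutes with multiplication by `a`.
D*-ш : ∀ r {a} p → Const a ≃ a → D* (a ш p) r ≃ a ш D* p r
D*-ш []      p c = ≃-refl
D*-ш (b ∷ r) {a} p c = ≃-trans
  (congruent (D*-linear r) (≃-trans (D-ш b a p) (⊕-cong (congruent (ш-linearˡ p) (D-Const b a c)) (≃-refl {a ш D b p}))))
  (D*-ш r (D b p) c)

Const-D*-ш : ∀ r {a} p → Const a ≃ a → Const (D* (a ш p) r) ≃ a ш Const (D* p r)
Const-D*-ш r {a} p c = ≃-trans (congruent Const-linear (D*-ш r p c))
  (≃-trans (Const-ш a (D* p r)) (congruent (ш-linearˡ (Const (D* p r))) c))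

-- Only deleting the e_z of a word with a single e_z can contribute. Each of its two neighbours,
-- boundary letters included, is 0 or 1 and has weight one in `K`, with opposite signs on the two
-- sides, so the weights cancel.
Const-K : ∀ p → Const (K p) ≃ 𝟘
Const-K = ∷-ext (Const-linear ∘ˡ K-linear) 𝟘ˡ ≃-refl step
  where
  L = Const-linear
  step : ∀ a p → Const (K p) ≃ 𝟘 → Const (K (a ◃ p)) ≃ 𝟘
  step e0 p h = ≃-trans (congruent L (K-◃-e0 p)) (null-⊕ L (e0 ◃ K p) (ez ◃ stripˡ ez p)
    (≃-trans (Const-◃ e0 (K p)) (annihilates (◃-linear e0) h)) (Const-◃ ez (stripˡ ez p)))
  step e1 p h = ≃-trans (congruent L (K-◃-e1 p)) (null-⊕ L (e1 ◃ K p) (ez ◃ stripˡ ez p)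
    (≃-trans (Const-◃ e1 (K p)) (annihilates (◃-linear e1) h)) (Const-◃ ez (stripˡ ez p)))
  step ez p h = ≃-trans (congruent L (K-◃-ez p)) (null-⊖ L (ez ◃ K p) (ez ◃ stripˡ e0 p ⊕ ez ◃ stripˡ e1 p)
    (Const-◃ ez (K p)) (null-⊕ L (ez ◃ stripˡ e0 p) (ez ◃ stripˡ e1 p) (Const-◃ ez (stripˡ e0 p)) (Const-◃ ez (stripˡ e1 p))))

-- The reversals of the empty word and of the words in e₀ and e_z starting with e_z.
data Admissible : Word → Set where
  nil  : Admissible []
  one  : Admissible [ ez ]
  cons : ∀ {a b r} → a ≢ e1 → Admissible (b ∷ r) → Admissible (a ∷ b ∷ r)

-- The last letter of `r` is the operator applied last. If it is `e0`, the constant part vanishes by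
-- `Const-K`; this is what forces the dual words to start with `ez`.
admissible? : ∀ r → Admissible r ⊎ (∀ p → Const (D* p r) ≃ 𝟘)
admissible? [] = inj₁ nil
admissible? (e1 ∷ r) = inj₂ λ p → annihilates Const-linear (null (D*-linear r))
admissible? (e0 ∷ []) = inj₂ λ p → null-• Const-linear -1ℤ (K p) (Const-K p)
admissible? (ez ∷ []) = inj₁ one
admissible? (e0 ∷ r@(_ ∷ _)) with admissible? r
... | inj₁ g = inj₁ (cons (λ ()) g)
... | inj₂ h = inj₂ λ p → h (-1ℤ • K p)
admissible? (ez ∷ r@(_ ∷ _)) with admissible? r
... | inj₁ g = inj₁ (cons (λ ()) g)
... | inj₂ h = inj₂ λ p → h (J p)

W : Word → Poly
W []      = word []
W (a ∷ r) = W r ▹ a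

-- The invariant for appending letters. The first two fields are the aim, up to the sign in `D e0`;
-- the next two remove the correction terms of `J-▹` and `K-▹`. The last one is preserved thanks to
-- `no-constant` and is needed for the regularisation of `W`.
record LastLetter (p : Poly) : Set where
  field
    J-strips    : J p ≃ stripʳ ez p
    K-strips    : K p ≃ -1ℤ • stripʳ e0 p
    no-e1       : stripʳ e1 p ≃ 𝟘
    no-constant : ε p ≃ 𝟘
    no-first-e0 : stripˡ e0 p ≃ 𝟘
open LastLetter

LastLetter-▹ : ∀ {p} a → a ≢ e1 → LastLetter p → LastLetter (p ▹ a)
LastLetter-▹ e1 a≢e1 h = ⊥-elim (a≢e1 refl)
LastLetter-▹ {p} e0 _ h = record
  { J-strips = begin
      J (p ▹ e0)                       ≈⟨ J-▹-e0 p ⟩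
      J p ▹ e0 ⊖ stripʳ ez p ▹ e0      ≈⟨ ⊖-null (congruent (▹-linear e0) (J-strips h)) ⟩
      𝟘                                ≈⟨ stripʳ-▹ ez e0 p ⟨
      stripʳ ez (p ▹ e0)               ∎
  ; K-strips = begin
      K (p ▹ e0)
        ≈⟨ ≃-trans (K-▹-e0 p) (⊖-cong (congruent (▹-linear e0) (K-strips h)) (≃-refl {stripʳ ez p ▹ ez})) ⟩
      (-1ℤ • stripʳ e0 p) ▹ e0 ⊖ stripʳ ez p ▹ ez
        ≈⟨ solve ((_ , ▹-linear e0) ∷ []) (stripʳ e0 p ∷ stripʳ ez p ▹ ez ∷ [])
             (#0 $ (-1ℤ :• x₀) :⊖ x₁) (-1ℤ :• (:𝟘 :⊕ (#0 $ x₀ :⊕ :𝟘 :⊕ x₁))) refl ⟩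
      -1ℤ • (stripʳ e0 p ▹ e0 ⊕ 𝟘 ⊕ stripʳ ez p ▹ ez)
        -- With no constant term and no final `e1`, the two remaining summands make up all of `p`.
        ≈⟨ •-cong -1ℤ (≃-trans (decomposeʳ p) (⊕-cong (no-constant h)
             (⊕-cong (⊕-cong (≃-refl {stripʳ e0 p ▹ e0}) (annihilates (▹-linear e1) (no-e1 h))) (≃-refl {stripʳ ez p ▹ ez})))) ⟨
      -1ℤ • p
        ≈⟨ •-cong -1ℤ (stripʳ-▹ e0 e0 p) ⟨
      -1ℤ • stripʳ e0 (p ▹ e0) ∎
  ; no-e1       = stripʳ-▹ e1 e0 p
  ; no-constant = ε-▹ e0 p
  ; no-first-e0 = ≃-trans (stripˡ-▹ e0 e0 p) (⊕-cong (annihilates (▹-linear e0) (no-first-e0 h)) (no-constant h)) }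
LastLetter-▹ {p} ez _ h = record
  { J-strips = begin
      J (p ▹ ez)
        ≈⟨ J-▹-ez p ⟩
      J p ▹ ez ⊖ stripʳ ez p ▹ ez ⊕ stripʳ e1 p ▹ ez ⊖ stripʳ e1 p ▹ e1 ⊕ p
        -- The first two summands cancel by the invariant; the last summand `p` stems from the
        -- adjacency of the new `ez` with the boundary 1.
        ≈⟨ ⊕-cong (⊖-cong (⊕-cong (⊖-null (congruent (▹-linear ez) (J-strips h)))
             (annihilates (▹-linear ez) (no-e1 h))) (annihilates (▹-linear e1) (no-e1 h))) (≃-refl {p}) ⟩
      p
        ≈⟨ stripʳ-▹ ez ez p ⟨
      stripʳ ez (p ▹ ez) ∎
  ; K-strips = begin
      K (p ▹ ez)
        ≈⟨ K-▹-ez p ⟩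
      K p ▹ ez ⊕ (stripʳ e0 p ▹ ez ⊕ stripʳ e1 p ▹ ez)
        ≈⟨ ⊕-cong (congruent (▹-linear ez) (K-strips h)) (⊕-cong (≃-refl {stripʳ e0 p ▹ ez}) (annihilates (▹-linear ez) (no-e1 h))) ⟩
      (-1ℤ • stripʳ e0 p) ▹ ez ⊕ (stripʳ e0 p ▹ ez ⊕ 𝟘)
        ≈⟨ solve ((_ , ▹-linear ez) ∷ []) (stripʳ e0 p ∷ []) (#0 $ (-1ℤ :• x₀) :⊕ (#0 $ x₀ :⊕ :𝟘)) :𝟘 refl ⟩
      𝟘
        ≈⟨ •-cong -1ℤ (stripʳ-▹ e0 ez p) ⟨
      -1ℤ • stripʳ e0 (p ▹ ez) ∎
  ; no-e1       = stripʳ-▹ e1 ez p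
  ; no-constant = ε-▹ ez p
  ; no-first-e0 = ≃-trans (stripˡ-▹ e0 ez p) (≃-trans (⊕-identityʳ (stripˡ e0 p ▹ ez)) (annihilates (▹-linear ez) (no-first-e0 h))) }

LastLetter-W : ∀ {a r} → Admissible (a ∷ r) → LastLetter (W (a ∷ r))
LastLetter-W one = record
  { J-strips = J-◃-ez (word [])
  ; K-strips = K-◃-ez (word [])
  ; no-e1 = ≃-refl ; no-constant = ≃-refl ; no-first-e0 = ≃-refl }
LastLetter-W (cons a≢e1 g) = LastLetter-▹ _ a≢e1 (LastLetter-W g)

D-W : ∀ c {a r} → Admissible (a ∷ r) → D c (W (a ∷ r)) ≃ when (does (a ≟ˡ c)) (W r)
D-W c {a} {r} g = ≃-trans (D-strips c) (stripʳ-▹ c a (W r))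
  where
  h = LastLetter-W g
  D-strips : ∀ c → D c (W (a ∷ r)) ≃ stripʳ c (W (a ∷ r))
  D-strips e0 = ≃-trans (•-cong -1ℤ (K-strips h)) (solve [] (stripʳ e0 (W (a ∷ r)) ∷ []) (-1ℤ :• -1ℤ :• x₀) x₀ refl)
  D-strips e1 = ≃-sym (no-e1 h)
  D-strips ez = J-strips h

Const-W : ∀ {a r} → Admissible (a ∷ r) → Const (W (a ∷ r)) ≃ 𝟘
Const-W one = ≃-refl
Const-W {e0} (cons {r = r} _ g) = ≃-trans (Const-▹ e0 (W (_ ∷ r))) (annihilates (▹-linear e0) (Const-W g))
Const-W {e1} (cons a≢e1 g) = ⊥-elim (a≢e1 refl)
Const-W {ez} (cons {r = r} _ g) = Const-▹ ez (W (_ ∷ r))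

Admissible-tail : ∀ {a r} → Admissible (a ∷ r) → Admissible r
Admissible-tail one        = nil
Admissible-tail (cons _ g) = g

-- Each operator removes the matching last letter or gives zero. If letters are left over in `W`,
-- the initial `ez` is among them and `Const` kills the word; if operators are left over, they act
-- on the constant word.
Const-D*-W : ∀ {r} → Admissible r → ∀ s → Const (D* (W r) s) ≃ coeff (word r) s • word []
Const-D*-W {[]} g [] = ≃-refl
Const-D*-W {[]} g (e0 ∷ s) = ≃-trans (annihilates Const-linear (null (D*-linear s))) (≃-sym (0• (word [])))
Const-D*-W {[]} g (e1 ∷ s) = ≃-trans (annihilates Const-linear (null (D*-linear s))) (≃-sym (0• (word [])))
Const-D*-W {[]} g (ez ∷ s) = ≃-trans (annihilates Const-linear (null (D*-linear s))) (≃-sym (0• (word [])))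
Const-D*-W {a ∷ r} g [] = ≃-trans (Const-W g) (≃-sym (0• (word [])))
Const-D*-W {a ∷ r} g (c ∷ s) = ≃-trans (congruent (Const-linear ∘ˡ D*-linear s) (D-W c g)) cases
  where
  cases : Const (D* (when (does (a ≟ˡ c)) (W r)) s) ≃ coeff (word (a ∷ r)) (c ∷ s) • word []
  cases with a ≟ˡ c
  ... | yes refl = Const-D*-W (Admissible-tail g) s
  ... | no _     = ≃-trans (annihilates Const-linear (null (D*-linear s))) (≃-sym (0• (word [])))

-- Regularisation

ez^ : ℕ → Word
ez^ k = replicate k ez

-- The graph of λ on 𝒜_z⁻² ш ℤ⟨e_z⟩, where N is the identity.
data Regularised : Poly → Poly → Set where
  pure : ∀ {u} → In𝒜z⁻² u → ∀ k → Regularised (u ш word (ez^ k)) (coeff (word (ez^ k)) [] • λ′ u)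
  zero : Regularised 𝟘 𝟘
  plus : ∀ {p q x y} → Regularised p x → Regularised q y → Regularised (p ⊕ q) (x ⊕ y)
  resp : ∀ {p q x y} → p ≃ q → x ≃ y → Regularised p x → Regularised q y

stripʳ-e1-ez^ : ∀ k → stripʳʷ e1 (ez^ k) ≃ 𝟘
stripʳ-e1-ez^ zero    = ≃-refl
stripʳ-e1-ez^ (suc k) = ≃-trans (⊕-identityʳ (ez ◃ stripʳʷ e1 (ez^ k))) (annihilates (◃-linear ez) (stripʳ-e1-ez^ k))

In𝒜z⁰-ez^ : ∀ k → In𝒜z⁰ (word (ez^ k))
In𝒜z⁰-ez^ k = first k , ≃-trans (linear-word (stripʳʷ e1) (ez^ k)) (stripʳ-e1-ez^ k)
  where
  first : ∀ k → stripˡ e0 (word (ez^ k)) ≃ 𝟘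
  first zero    = ≃-refl
  first (suc k) = ≃-refl

Regularised⇒𝒜z⁰ : ∀ {p x} → Regularised p x → In𝒜z⁰ p
Regularised⇒𝒜z⁰ (pure u k)   = In𝒜z⁰-ш (in𝒜z⁰ u) (In𝒜z⁰-ez^ k)
Regularised⇒𝒜z⁰ zero         = ≃-refl , ≃-refl
Regularised⇒𝒜z⁰ (plus g h)   = In𝒜z⁰-⊕ (Regularised⇒𝒜z⁰ g) (Regularised⇒𝒜z⁰ h)
Regularised⇒𝒜z⁰ (resp e _ g) = In𝒜z⁰-resp e (Regularised⇒𝒜z⁰ g)

Regularised⇒𝒜⁰ : ∀ {p x} → Regularised p x → In𝒜⁰ x
Regularised⇒𝒜⁰ (pure u k)   = In𝒜⁰-• (coeff (word (ez^ k)) []) (In𝒜⁰-λ′ u)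
Regularised⇒𝒜⁰ zero         = (≃-refl , ≃-refl) , ≃-refl
Regularised⇒𝒜⁰ (plus g h)   = In𝒜⁰-⊕ (Regularised⇒𝒜⁰ g) (Regularised⇒𝒜⁰ h)
Regularised⇒𝒜⁰ (resp _ e g) = In𝒜⁰-resp e (Regularised⇒𝒜⁰ g)

In𝒜z⁻²-ш : ∀ {p q} → In𝒜z⁻² p → In𝒜z⁻² q → In𝒜z⁻² (p ш q)
In𝒜z⁻²-ш {p} {q} (i , z) (j , z′) = In𝒜z⁰-ш i j , derivation-null (stripʳ-ш ez) {p} {q} z z′

Regularised-ш : ∀ {a p x} → In𝒜⁰ a → Regularised p x → Regularised (a ш p) (a ш x)
Regularised-ш {a} i (pure {u} j k) = resp (ш-assoc a u (word (ez^ k)))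
  (≃-trans (•-cong c (≃-trans (λ′-ш a u) (congruent (ш-linearˡ (λ′ u)) (λ′-fixes (no-ez i)))))
    (≃-sym (scaling (ш-linearʳ a) c (λ′ u))))
  (pure (In𝒜z⁻²-ш (𝒜⁰⇒𝒜z⁻² i) j) k)
  where c = coeff (word (ez^ k)) []
Regularised-ш {a} i zero = resp (≃-sym (null (ш-linearʳ a))) (≃-sym (null (ш-linearʳ a))) zero
Regularised-ш {a} i (plus {p} {q} {x} {y} g h) =
  resp (≃-sym (additive (ш-linearʳ a) p q)) (≃-sym (additive (ш-linearʳ a) x y)) (plus (Regularised-ш i g) (Regularised-ш i h))
Regularised-ш {a} i (resp e e′ g) = resp (congruent (ш-linearʳ a) e) (congruent (ш-linearʳ a) e′) (Regularised-ш i g)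

In𝒜⁰-[] : In𝒜⁰ (word [])
In𝒜⁰-[] = (≃-refl , ≃-refl) , ≃-refl

•-ш : ∀ c p → (c • word []) ш p ≃ c • p
•-ш c p = ≃-trans (scaling (ш-linearˡ p) c (word [])) (•-cong c (ш-identityˡ p))

Regularised-• : ∀ c {p x} → Regularised p x → Regularised (c • p) (c • x)
Regularised-• c {p} {x} g = resp (•-ш c p) (•-ш c x) (Regularised-ш (In𝒜⁰-• c In𝒜⁰-[]) g)

Regularised-λ′ : ∀ {u} → In𝒜z⁻² u → Regularised u (λ′ u)
Regularised-λ′ {u} i = resp (ш-identityʳ u) (1• (λ′ u)) (pure i 0)

▹ez^ : Poly → ℕ → Poly
▹ez^ p zero    = p
▹ez^ p (suc m) = ▹ez^ (p ▹ ez) m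

▹ez^-linear : ∀ m → Linear (λ p → ▹ez^ p m)
▹ez^-linear zero    = idˡ
▹ez^-linear (suc m) = ▹ez^-linear m ∘ˡ ▹-linear ez

ez^-▹ : ∀ k → word (ez^ k) ▹ ez ≡ word (ez^ (suc k))
ez^-▹ zero    = refl
ez^-▹ (suc k) = cong (ez ◃_) (ez^-▹ k)

ε-ш : ∀ p q → ε p ≃ 𝟘 → ε (p ш q) ≃ 𝟘
ε-ш p q h = ≃-trans (ε-hom p q) (congruent (ш-linearˡ (ε q)) h)
  where
  ε-hom : ∀ p q → ε (p ш q) ≃ ε p ш ε q
  ε-hom = ext₂ ((λ q → ε-linear ∘ˡ ш-linearˡ q) , (λ p → ε-linear ∘ˡ ш-linearʳ p))
    ((λ q → ш-linearˡ (ε q) ∘ˡ ε-linear) , (λ p → ш-linearʳ (ε p) ∘ˡ ε-linear)) on-word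
    where
    on-word : ∀ u v → ε (word u ш word v) ≃ ε (word u) ш ε (word v)
    on-word [] v = ≃-trans (congruent ε-linear (ш-identityˡ (word v))) (≃-sym (ш-identityˡ (ε (word v))))
    on-word u@(_ ∷ _) [] = congruent ε-linear (ш-identityʳ (word u))
    on-word (a ∷ u) (b ∷ v) = ≃-trans (congruent ε-linear (◃-ш-◃ a b (word u) (word v)))
      (null-⊕ ε-linear (a ◃ (word u ш word (b ∷ v))) (b ◃ (word (a ∷ u) ш word v))
        (ε-◃ a (word u ш word (b ∷ v))) (ε-◃ b (word (a ∷ u) ш word v)))

In𝒜z⁻²-▹e0 : ∀ {u} → stripˡ e0 u ≃ 𝟘 → ε u ≃ 𝟘 → In𝒜z⁻² (u ▹ e0)
In𝒜z⁻²-▹e0 {u} l e =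
  (≃-trans (stripˡ-▹ e0 e0 u) (⊕-cong (annihilates (▹-linear e0) l) e) , stripʳ-▹ e1 e0 u) , stripʳ-▹ ez e0 u

Regularisable : Poly → Set
Regularisable p = ∃ (Regularised p)

-- (u e₀ ш e_z^j) e_z^(m+1) = (u e₀ ш e_z^(j+1)) e_z^m − (u ш e_z^(j+1)) e₀ e_z^m
regularise : ∀ m j u → stripˡ e0 u ≃ 𝟘 → ε u ≃ 𝟘 → Regularisable (▹ez^ ((u ▹ e0) ш word (ez^ j)) m)
regularise zero    j u l e = _ , pure (In𝒜z⁻²-▹e0 {u} l e) j
regularise (suc m) j u l e =
  let x , g = regularise m (suc j) u l e
      u′    = u ш word (ez^ (suc j))
      y , h = regularise m 0 u′ (derivation-null (stripˡ-ш e0) {u} {word (ez^ (suc j))} l (no-e0-first (In𝒜z⁰-ez^ (suc j)))) (ε-ш u (word (ez^ (suc j))) e)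
  in x ⊕ -1ℤ • y , resp step (≃-refl {x ⊕ -1ℤ • y}) (plus g (Regularised-• -1ℤ h))
  where
  Q  = (u ▹ e0) ш word (ez^ (suc j))
  R  = (u ш word (ez^ (suc j))) ▹ e0
  S  = ((u ▹ e0) ш word (ez^ j)) ▹ ez
  L  = ▹ez^-linear m
  expand : Q ≃ R ⊕ S
  expand = begin
    (u ▹ e0) ш word (ez^ (suc j))      ≡⟨ cong ((u ▹ e0) ш_) (ez^-▹ j) ⟨
    (u ▹ e0) ш (word (ez^ j) ▹ ez)     ≈⟨ ▹-ш-▹ e0 ez u (word (ez^ j)) ⟩
    (u ш (word (ez^ j) ▹ ez)) ▹ e0 ⊕ S ≡⟨ cong (λ z → (u ш z) ▹ e0 ⊕ S) (ez^-▹ j) ⟩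
    R ⊕ S                              ∎
  step : ▹ez^ Q m ⊖ ▹ez^ (R ш word []) m ≃ ▹ez^ S m
  step = begin
    ▹ez^ Q m ⊖ ▹ez^ (R ш word []) m    ≈⟨ ⊖-cong (congruent L expand) (congruent L (ш-identityʳ R)) ⟩
    ▹ez^ (R ⊕ S) m ⊖ ▹ez^ R m          ≈⟨ solve ((_ , L) ∷ []) (R ∷ S ∷ []) (#0 $ (x₀ :⊕ x₁) :⊖ #0 $ x₀) (#0 $ x₁) refl ⟩
    ▹ez^ S m                           ∎

▹ez^-[] : ∀ m k → ▹ez^ (word (ez^ k)) m ≡ word (ez^ (m +ℕ k))
▹ez^-[] zero    k = refl
▹ez^-[] (suc m) k = trans (cong (λ p → ▹ez^ p m) (ez^-▹ k))
  (trans (▹ez^-[] m (suc k)) (cong (λ n → word (ez^ n)) (ℕ.+-suc m k)))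

Regularisable-ez^ : ∀ k → Regularisable (word (ez^ k))
Regularisable-ez^ k = _ , resp (ш-identityˡ (word (ez^ k))) (≃-refl {coeff (word (ez^ k)) [] • λ′ (word [])}) (pure (𝒜⁰⇒𝒜z⁻² In𝒜⁰-[]) k)

-- The count `m` collects the trailing letters `ez` until an `e0` is met, where `regularise`
-- applies, or until the word turns out to be a power of `ez`.
regularise-W : ∀ {r} → Admissible r → ∀ m → Regularisable (▹ez^ (W r) m)
regularise-W nil m rewrite ▹ez^-[] m 0 = Regularisable-ez^ (m +ℕ 0)
regularise-W one m rewrite ▹ez^-[] m 1 = Regularisable-ez^ (m +ℕ 1)
regularise-W {ez ∷ _} (cons _ g) m = regularise-W g (suc m)
regularise-W {e1 ∷ _} (cons a≢e1 g) m = ⊥-elim (a≢e1 refl)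
regularise-W {e0 ∷ r} (cons _ g) m =
  let x , h = regularise m 0 (W r) (no-first-e0 (LastLetter-W g)) (no-constant (LastLetter-W g))
  in x , resp (congruent (▹ez^-linear m) (ш-identityʳ (W r ▹ e0))) (≃-refl {x}) h

τz-ez^ : ∀ k → τz (word (ez^ k)) ≃ word (ez^ k)
τz-ez^ zero    = ≃-refl
τz-ez^ (suc k) = ≃-trans (τz-ez (word (ez^ k))) (≃-trans (congruent (▹-linear ez) (τz-ez^ k)) (≡⇒≃ (ez^-▹ k)))

Span-word : ∀ {P : Pred Word 0ℓ} {v} → P v → Span P (word v)
Span-word {v = v} h w c≢0 with v ≟ʷ w
... | yes refl = h
... | no _     = ⊥-elim (c≢0 refl)

Over-ez^ : ∀ {S} → ez ∈ S → ∀ k → ℤ⟨ S ⟩ (word (ez^ k))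
Over-ez^ h k = Span-word (replicate⁺ k h)

EzTensor : Tensor → Set
EzTensor = All λ (u , v) → In𝒜z⁻² u × ∃ λ k → v ≡ word (ez^ k)

shuffle-++ : ∀ s t → shuffle (s ++ t) ≃ shuffle s ⊕ shuffle t
shuffle-++ []            t = ≃-refl
shuffle-++ ((u , v) ∷ s) t = ≃-trans (⊕-cong (≃-refl {u ш v}) (shuffle-++ s t)) (≃-sym (⊕-assoc (u ш v) (shuffle s) (shuffle t)))

id⊗const-++ : ∀ s t → id⊗const (s ++ t) ≃ id⊗const s ⊕ id⊗const t
id⊗const-++ []            t = ≃-refl
id⊗const-++ ((u , v) ∷ s) t = ≃-trans (⊕-cong (≃-refl {coeff v [] • u}) (id⊗const-++ s t))
  (≃-sym (⊕-assoc (coeff v [] • u) (id⊗const s) (id⊗const t)))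

Regularised⇒tensor : ∀ {p x} → Regularised p x → ∃ λ t → EzTensor t × shuffle t ≃ p × x ≃ λ′ (id⊗const t)
Regularised⇒tensor (pure {u} i k) = (u , word (ez^ k)) ∷ [] , (i , k , refl) ∷ [] , ⊕-identityʳ (u ш word (ez^ k)) ,
  ≃-trans (≃-sym (scaling λ′-linear c u)) (congruent λ′-linear (≃-sym (⊕-identityʳ (c • u))))
  where c = coeff (word (ez^ k)) []
Regularised⇒tensor zero = [] , [] , ≃-refl , ≃-refl
Regularised⇒tensor (plus g h) =
  let s , Es , es , xs = Regularised⇒tensor g
      t , Et , et , xt = Regularised⇒tensor h
  in s ++ t , ++⁺ Es Et , ≃-trans (shuffle-++ s t) (⊕-cong es et) ,
     ≃-trans (⊕-cong xs xt) (≃-trans (≃-sym (additive λ′-linear (id⊗const s) (id⊗const t))) (congruent λ′-linear (≃-sym (id⊗const-++ s t))))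
Regularised⇒tensor (resp e e′ g) =
  let t , Et , et , xt = Regularised⇒tensor g
  in t , Et , ≃-trans et e , ≃-trans (≃-sym e′) xt

shuffle-τz : ∀ {t} → EzTensor t → shuffle t ≃ shuffle (map (map₂ τz) t)
shuffle-τz [] = ≃-refl
shuffle-τz {(u , _) ∷ _} ((_ , k , refl) ∷ Et) = ⊕-cong (congruent (ш-linearʳ u) (≃-sym (τz-ez^ k))) (shuffle-τz Et)

-- One tensor represents both preimages: its second factors are powers of `ez`, which lie in both
-- prescribed spaces and are fixed by `τz`, so N changes nothing.
Regularised⇒λ : ∀ {p x} → Regularised p x → λ[ p ]≈ x
Regularised⇒λ g =
  let t , Et , et , xt = Regularised⇒tensor g
  in shuffle (map (map₂ τz) t) ,
     (t , (All.map (λ { (i , k , refl) → to-𝒜z⁻² i , to-𝒜z⁰ (In𝒜z⁰-ez^ k) , Over-ez^ (there (here refl)) k }) Et , coeff-≡ et) , λ _ → refl) ,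
     t , (All.map (λ { (i , k , refl) → to-𝒜z⁻² i , Over-ez^ (here refl) k }) Et , coeff-≡ (shuffle-τz Et)) , coeff-≡ xt

-- Confluence relations

Standard : Poly → Set
Standard p = ∀ r → Const (D* p r) ≃ 𝟘

Const-D*-linear : ∀ r → Linear (λ p → Const (D* p r))
Const-D*-linear r = Const-linear ∘ˡ D*-linear r

-- ∂_{z,0} = -D(e₀) - D(e_z) and ∂_{z,1} = D(e_z). As being standard is preserved, it does not
-- matter that `D*` and `foldr` process their lists in opposite orders.
Standard-∂ : ∀ {α p} → α ∈ e0 ∷ e1 ∷ [] → Standard p → Standard (∂ ez α p)
Standard-∂ {p = p} (here refl) h r = ≃-trans (congruent (Const-D*-linear r) ∂≃)
  (null-⊖ (Const-D*-linear r) (-1ℤ • D e0 p) (J p) (null-• (Const-D*-linear r) -1ℤ (D e0 p) (h (e0 ∷ r))) (h (ez ∷ r)))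
  where
  ∂≃ : ∂ ez e0 p ≃ -1ℤ • D e0 p ⊖ J p
  ∂≃ = solve [] (∂ ez e0 p ∷ J p ∷ []) x₀ (-1ℤ :• -1ℤ :• (x₀ :⊕ x₁) :⊖ x₁) refl
Standard-∂ (there (here refl)) h r = h (ez ∷ r)

Standard-∂* : ∀ {αs p} → All (_∈ e0 ∷ e1 ∷ []) αs → Standard p → Standard (foldr (∂ ez) p αs)
Standard-∂* []       h = h
Standard-∂* (α ∷ αs) h = Standard-∂ α (Standard-∂* αs h)

Confluent : Poly → Set
Confluent x = ∃ λ p → Standard p × Regularised p x

Confluent⇒𝓘CF : ∀ {x} → Confluent x → 𝓘CF x
Confluent⇒𝓘CF (p , s , g) = p , (to-𝒜z⁰ (Regularised⇒𝒜z⁰ g) , λ αs A → coeff-≡ (Standard-∂* A s [])) , Regularised⇒λ g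

Confluent-resp : ∀ {x y} → x ≃ y → Confluent x → Confluent y
Confluent-resp e (p , s , g) = p , s , resp (≃-refl {p}) e g

Confluent-𝟘 : Confluent 𝟘
Confluent-𝟘 = 𝟘 , (λ r → null (Const-D*-linear r)) , zero

Confluent-⊕ : ∀ {x y} → Confluent x → Confluent y → Confluent (x ⊕ y)
Confluent-⊕ (p , s , g) (q , t , h) = p ⊕ q , (λ r → null-⊕ (Const-D*-linear r) p q (s r) (t r)) , plus g h

Confluent-ш : ∀ {a x} → In𝒜⁰ a → Confluent x → Confluent (a ш x)
Confluent-ш {a} i (p , s , g) = a ш p ,
  (λ r → ≃-trans (Const-D*-ш r p (no-ez i)) (annihilates (ш-linearʳ a) (s r))) , Regularised-ш i g

Confluent-• : ∀ c {x} → Confluent x → Confluent (c • x)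
Confluent-• c {x} h = Confluent-resp (•-ш c x) (Confluent-ш (In𝒜⁰-• c In𝒜⁰-[]) h)

-- Bounds on the length of words

Short : ℕ → Poly → Set
Short n = All λ e → length (proj₂ e) < n

Short-0 : ∀ {p} → Short 0 p → p ≡ []
Short-0 []       = refl
Short-0 (() ∷ _)

Short-• : ∀ c {n p} → Short n p → Short n (c • p)
Short-• c h = map⁺ h

Short-◃ : ∀ a {n p} → Short n p → Short (suc n) (a ◃ p)
Short-◃ a h = map⁺ (All.map s≤s h)

Short-linear : ∀ {m n} f → (∀ v → length v < m → Short n (f v)) → ∀ {p} → Short m p → Short n (linear f p)
Short-linear f h []       = []
Short-linear f h {(c , v) ∷ p} (l ∷ s) = ++⁺ (Short-• c (h v l)) (Short-linear f h s)

Short-suc : ∀ {n p} → Short n p → Short (suc n) p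
Short-suc = All.map ℕ.m<n⇒m<1+n

Short-∂ʷ : ∀ α β p n v → length v < suc n → Short n (∂ʷ α β p v)
Short-∂ʷ α β p n       []      l = []
Short-∂ʷ α β p (suc n) (a ∷ v) (s≤s l) = l ∷ Short-◃ a (Short-∂ʷ α β a n v l)

Short-∂ : ∀ α β {n p} → Short (suc n) p → Short n (∂ α β p)
Short-∂ α β {n} = Short-linear (∂ʷ α β e0) (Short-∂ʷ α β e0 n)

Short-D : ∀ a {n p} → Short (suc n) p → Short n (D a p)
Short-D e0 s = Short-• -1ℤ (++⁺ (Short-∂ ez e0 s) (Short-∂ ez e1 s))
Short-D e1 s = []
Short-D ez s = Short-∂ ez e1 s

Short-D* : ∀ r {n p} → Short n p → Short n (D* p r)
Short-D* []      s = s
Short-D* (a ∷ r) s = Short-D* r (Short-D a (Short-suc s))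

-- Each operator lowers the bound by one. The bound is strict, so at zero there are no words left,
-- not even the empty one.
D*-Short-null : ∀ r {n p} → Short n p → n ≤ length r → D* p r ≃ 𝟘
D*-Short-null r       {zero}  s _       with refl ← Short-0 s = null (D*-linear r)
D*-Short-null (a ∷ r) {suc n} s (s≤s l) = D*-Short-null r (Short-D a s) l

Short-Const : ∀ {n p} → Short n p → Short n (Const p)
Short-Const {n} = Short-linear Constʷ on-word
  where
  on-word : ∀ v → length v < n → Short n (Constʷ v)
  on-word v l with does (any? (_≟ˡ ez) v)
  ... | true  = []
  ... | false = l ∷ []

Short-φ : ∀ {n p} → Short n p → Short n (φ p)
Short-φ {n} = Short-linear φʷ (on-word n)
  where
  on-word : ∀ n v → length v < n → Short n (φʷ v)
  on-word n       []       l = l ∷ []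
  on-word (suc n) (e0 ∷ v) (s≤s l) = Short-◃ e0 (on-word n v l)
  on-word (suc n) (e1 ∷ v) (s≤s l) = ++⁺ (Short-◃ e1 (on-word n v l)) (Short-• -1ℤ (Short-◃ ez (on-word n v l)))
  on-word n       (ez ∷ v) l = []

length-bound : ∀ p → ∃ λ n → Short n p
length-bound []            = 0 , []
length-bound ((c , v) ∷ p) = let n , s = length-bound p in
  suc (length v) ⊔ n , ℕ.m≤m⊔n (suc (length v)) n ∷ All.map (λ l → ℕ.≤-trans l (ℕ.m≤n⊔m (suc (length v)) n)) s

-- The sum of the nonempty words of length at most n.
nonempty : ℕ → Poly
nonempty zero    = 𝟘
nonempty (suc n) = Σˡ λ a → a ◃ (word [] ⊕ nonempty n)

NonEmpty : Poly → Set
NonEmpty = All λ e → proj₂ e ≢ []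

NonEmpty-◃ : ∀ a p → NonEmpty (a ◃ p)
NonEmpty-◃ a p = map⁺ (All.universal (λ _ ()) p)

nonempty-NonEmpty : ∀ n → NonEmpty (nonempty n)
nonempty-NonEmpty zero    = []
nonempty-NonEmpty (suc n) = ++⁺ (++⁺ (NonEmpty-◃ e0 q) (NonEmpty-◃ e1 q)) (NonEmpty-◃ ez q)
  where q = word [] ⊕ nonempty n

coeff-NonEmpty : ∀ {p} → NonEmpty p → coeff p [] ≡ 0ℤ
coeff-NonEmpty []                            = refl
coeff-NonEmpty {(c , [])    ∷ p} (h ∷ _)     = ⊥-elim (h refl)
coeff-NonEmpty {(c , _ ∷ _) ∷ p} (_ ∷ hs)    = trans (+-identityˡ (coeff p [])) (coeff-NonEmpty hs)

stripˡ-Σˡ : ∀ b p → stripˡ b (Σˡ (_◃ p)) ≃ p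
stripˡ-Σˡ b p = ≃-trans (≃-trans (additive L (e0 ◃ p ⊕ e1 ◃ p) (ez ◃ p)) (⊕-cong (additive L (e0 ◃ p) (e1 ◃ p)) (≃-refl {stripˡ b (ez ◃ p)})))
  (≃-trans (⊕-cong (⊕-cong (stripˡ-◃ b e0 p) (stripˡ-◃ b e1 p)) (stripˡ-◃ b ez p)) (collapse b))
  where
  L = stripˡ-linear b
  collapse : ∀ b → when (does (e0 ≟ˡ b)) p ⊕ when (does (e1 ≟ˡ b)) p ⊕ when (does (ez ≟ˡ b)) p ≃ p
  collapse e0 = solve [] (p ∷ []) (x₀ :⊕ :𝟘 :⊕ :𝟘) x₀ refl
  collapse e1 = solve [] (p ∷ []) (:𝟘 :⊕ x₀ :⊕ :𝟘) x₀ refl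
  collapse ez = ≃-refl

coeff-nonempty : ∀ n a r → length r < n → coeff (nonempty n) (a ∷ r) ≡ 1ℤ
coeff-nonempty (suc n) a r l = trans (sym (coeff-stripˡ a (nonempty (suc n)) r))
  (trans (coeff-≡ (stripˡ-Σˡ a (word [] ⊕ nonempty n)) r) (tail r l))
  where
  tail : ∀ r → length r < suc n → coeff (word [] ⊕ nonempty n) r ≡ 1ℤ
  tail []      l       = cong (1ℤ +ℤ_) (coeff-NonEmpty (nonempty-NonEmpty n))
  tail (b ∷ r) (s≤s l) = trans (+-identityˡ (coeff (nonempty n) (b ∷ r))) (coeff-nonempty n b r l)

-- The dual basis yields an element whose derivatives Const (D* _ r) are prescribed.
module _ (a : Word → Poly) (a∈𝒜⁰ : ∀ r → In𝒜⁰ (a r)) (a-admissible : ∀ r → Admissible r ⊎ a r ≃ 𝟘) where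

  -- Here `y` is the correction and `x` its image under λ. The weight `c` records which derivatives
  -- have been matched, so that corrections for single words can be added.
  Corrected : Word → (Word → ℤ) → Set
  Corrected r c = ∃₂ λ y x → Regularised y x × Confluent x × (∀ s → Const (D* y s) ≃ c s • Δ (a s))

  -- For admissible `r` the witness is the monomial `Δ (a r) ш W r`: by duality its only possibly
  -- nonzero derivative is the one at `r`. Otherwise `a r` vanishes and there is nothing to correct.
  correct-word : ∀ r → Confluent (Δ (a r)) → Corrected r (coeff (word r))
  correct-word r h with a-admissible r
  ... | inj₁ g =
    let x , R = regularise-W g 0
        i = In𝒜⁰-Δ (a∈𝒜⁰ r)
    in Δ (a r) ш W r , Δ (a r) ш x , Regularised-ш i R ,
       Confluent-resp (ш-comm x (Δ (a r))) (Confluent-ш (Regularised⇒𝒜⁰ R) h) ,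
       λ s → ≃-trans (Const-D*-ш s (W r) (no-ez i)) (≃-trans (congruent (ш-linearʳ (Δ (a r))) (Const-D*-W g s)) (unit s))
    where
    unit : ∀ s → Δ (a r) ш (coeff (word r) s • word []) ≃ coeff (word r) s • Δ (a s)
    unit s = ≃-trans (≃-trans (scaling (ш-linearʳ (Δ (a r))) (coeff (word r) s) (word []))
      (•-cong (coeff (word r) s) (ш-identityʳ (Δ (a r))))) same
      where
      same : coeff (word r) s • Δ (a r) ≃ coeff (word r) s • Δ (a s)
      same with r ≟ʷ s
      ... | yes refl = ≃-refl
      ... | no _     = ≃-trans (0• (Δ (a r))) (≃-sym (0• (Δ (a s))))
  ... | inj₂ e = 𝟘 , 𝟘 , zero , Confluent-𝟘 , λ s → ≃-trans (null (Const-D*-linear s)) (≃-sym (same s))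
    where
    same : ∀ s → coeff (word r) s • Δ (a s) ≃ 𝟘
    same s with r ≟ʷ s
    ... | yes refl = •-cong 1ℤ (annihilates Δ-linear e)
    ... | no _     = 0• (Δ (a s))

  correct : ∀ B → NonEmpty B → (∀ b r → Confluent (Δ (a (b ∷ r)))) → Corrected [] (coeff B)
  correct []            []       h = 𝟘 , 𝟘 , zero , Confluent-𝟘 , λ s → ≃-trans (null (Const-D*-linear s)) (≃-sym (0• (Δ (a s))))
  correct ((c , [])    ∷ B) (n ∷ _)  h = ⊥-elim (n refl)
  correct ((c , b ∷ r) ∷ B) (_ ∷ ns) h =
    let y , x , R , C , e = correct-word (b ∷ r) (h b r)
        y′ , x′ , R′ , C′ , e′ = correct B ns h
    in c • y ⊕ y′ , c • x ⊕ x′ , plus (Regularised-• c R) R′ , Confluent-⊕ (Confluent-• c C) C′ ,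
       λ s → begin
         Const (D* (c • y ⊕ y′) s)
           ≈⟨ ≃-trans (additive (Const-D*-linear s) (c • y) y′) (⊕-cong (scaling (Const-D*-linear s) c y) (≃-refl {Const (D* y′ s)})) ⟩
         c • Const (D* y s) ⊕ Const (D* y′ s)
           ≈⟨ ⊕-cong (≃-trans (•-cong c (e s)) (•-• c (coeff (word (b ∷ r)) s) (Δ (a s)))) (e′ s) ⟩
         (c *ℤ coeff (word (b ∷ r)) s) • Δ (a s) ⊕ coeff B s • Δ (a s)
           ≈⟨ +-• (c *ℤ coeff (word (b ∷ r)) s) (coeff B s) (Δ (a s)) ⟨
         (c *ℤ coeff (word (b ∷ r)) s +ℤ coeff B s) • Δ (a s)
           ≡⟨ cong (λ k → (k +ℤ coeff B s) • Δ (a s)) (head s) ⟩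
         coeff ((c , b ∷ r) ∷ B) s • Δ (a s) ∎
    where
    head : ∀ s → c *ℤ coeff (word (b ∷ r)) s ≡ (if does ((b ∷ r) ≟ʷ s) then c else 0ℤ)
    head s with does ((b ∷ r) ≟ʷ s)
    ... | true  = *-identityʳ c
    ... | false = *-zeroʳ c

-- Induction on the weight

Δ-Confluent : ∀ n p → Short n p → In𝒜⁰ p → Confluent (Δ p)
Δ-Confluent zero p s i with refl ← Short-0 s = Confluent-resp (≃-sym (null Δ-linear)) Confluent-𝟘
Δ-Confluent (suc n) p s i@(i₀ , c) =
  -- λ sends `ω` to `x ⊕ Δ p`, and `x` is confluent by the induction hypothesis, so it can be
  -- subtracted.
  Confluent-resp (solve [] (x ∷ Δ p ∷ []) ((x₀ :⊕ x₁) :⊕ -1ℤ :• x₀) x₁ refl)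
    (Confluent-⊕ (ω , standard , regularised) (Confluent-• -1ℤ C))
  where
  φp∈ : In𝒜z⁻² (φ p)
  φp∈ = In𝒜z⁻²-φ i₀

  a : Word → Poly
  a r = Const (D* (φ p) r)

  a∈𝒜⁰ : ∀ r → In𝒜⁰ (a r)
  a∈𝒜⁰ r = In𝒜⁰-Const (In𝒜z⁰-D* r (in𝒜z⁰ φp∈))

  a-admissible : ∀ r → Admissible r ⊎ a r ≃ 𝟘
  a-admissible r with admissible? r
  ... | inj₁ g = inj₁ g
  ... | inj₂ h = inj₂ (h (φ p))

  -- The words of `p`, and hence of `φ p`, have at most `n` letters, so derivatives indexed by
  -- longer words vanish and `nonempty n` lists all that matter. The first operator already deletes
  -- a letter, which brings `a (b ∷ r)` within the induction hypothesis.
  corrected = correct a a∈𝒜⁰ a-admissible (nonempty n) (nonempty-NonEmpty n) λ b r →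
    Δ-Confluent n (a (b ∷ r)) (Short-Const (Short-D* r (Short-D b (Short-φ s)))) (a∈𝒜⁰ (b ∷ r))

  y = proj₁ corrected
  x = proj₁ (proj₂ corrected)
  R = proj₁ (proj₂ (proj₂ corrected))
  C = proj₁ (proj₂ (proj₂ (proj₂ corrected)))
  derivatives = proj₂ (proj₂ (proj₂ (proj₂ corrected)))

  ω : Poly
  ω = y ⊕ Δ p ⊖ (φ p ⊖ φ (τ∞ p))

  φ-derivatives : ∀ r → Const (D* (φ p ⊖ φ (τ∞ p)) r) ≃ Δ (a r)
  φ-derivatives r = ≃-trans (subtractive (Const-D*-linear r) (φ p) (φ (τ∞ p))) (⊖-cong (≃-refl {a r}) (begin
    Const (D* (φ (τ∞ p)) r)  ≈⟨ congruent (Const-D*-linear r) (τz-φ p) ⟨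
    Const (D* (τz (φ p)) r)  ≈⟨ congruent Const-linear (D*-τz r (in𝒜z⁰ φp∈)) ⟩
    Const (τz (D* (φ p) r))  ≈⟨ Const-τz (D* (φ p) r) ⟩
    τ∞ (a r)                 ∎))

  -- At the empty word the correction has weight zero and `Δ p` supplies the term. At nonempty words
  -- `Δ p` is killed, being free of e_z, and the correction supplies it with weight one, or the word
  -- is too long and both sides are zero.
  balance : ∀ r → coeff (nonempty n) r • Δ (a r) ⊕ Const (D* (Δ p) r) ≃ Δ (a r)
  balance [] = ≃-trans (⊕-cong (≃-trans (≡⇒≃ (cong (_• Δ (a [])) (coeff-NonEmpty (nonempty-NonEmpty n)))) (0• (Δ (a []))))
    (no-ez (In𝒜⁰-Δ i))) (congruent Δ-linear (≃-sym (≃-trans (Const-φ p) c)))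
  balance (b ∷ r) = ≃-trans (⊕-cong weight (annihilates (Const-D*-linear r) (D-Const b (Δ p) (no-ez (In𝒜⁰-Δ i)))))
    (⊕-identityʳ (Δ (a (b ∷ r))))
    where
    weight : coeff (nonempty n) (b ∷ r) • Δ (a (b ∷ r)) ≃ Δ (a (b ∷ r))
    weight with ℕ.<-≤-connex (length r) n
    ... | inj₁ l = ≃-trans (≡⇒≃ (cong (_• Δ (a (b ∷ r))) (coeff-nonempty n b r l))) (1• (Δ (a (b ∷ r))))
    ... | inj₂ l = ≃-trans (•-cong (coeff (nonempty n) (b ∷ r)) vanishes) (≃-sym vanishes)
      where
      vanishes : Δ (a (b ∷ r)) ≃ 𝟘
      vanishes = annihilates (Δ-linear ∘ˡ Const-linear) (D*-Short-null (b ∷ r) (Short-φ s) (s≤s l))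

  standard : Standard ω
  standard r = begin
    Const (D* ω r)
      ≈⟨ subtractive (Const-D*-linear r) (y ⊕ Δ p) (φ p ⊖ φ (τ∞ p)) ⟩
    Const (D* (y ⊕ Δ p) r) ⊖ Const (D* (φ p ⊖ φ (τ∞ p)) r)
      ≈⟨ ⊖-cong (≃-trans (additive (Const-D*-linear r) y (Δ p)) (⊕-cong (derivatives r) (≃-refl {Const (D* (Δ p) r)}))) (φ-derivatives r) ⟩
    coeff (nonempty n) r • Δ (a r) ⊕ Const (D* (Δ p) r) ⊖ Δ (a r)
      ≈⟨ ⊖-null (balance r) ⟩
    𝟘 ∎

  λ′-vanishes : λ′ (φ p) ⊖ λ′ (φ (τ∞ p)) ≃ 𝟘
  -- Both terms reduce to a constant term, and `τ∞` preserves constant terms.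
  λ′-vanishes = ⊖-null (≃-trans (λ′-φ p (no-e0-first i₀))
    (≃-sym (≃-trans (λ′-φ (τ∞ p) (no-e0-first (𝒜⁰⇒𝒜z⁰ (In𝒜⁰-τ∞ i)))) (ε-τ∞ p))))

  regularised : Regularised ω (x ⊕ Δ p)
  regularised = resp (≃-refl {ω})
    (≃-trans (⊖-cong (⊕-cong (≃-refl {x}) (λ′-fixes (no-ez (In𝒜⁰-Δ i)))) λ′-vanishes) (⊕-identityʳ (x ⊕ Δ p)))
    (plus (plus R (Regularised-λ′ (𝒜⁰⇒𝒜z⁻² (In𝒜⁰-Δ i))))
      (Regularised-• -1ℤ (plus (Regularised-λ′ φp∈) (Regularised-• -1ℤ (Regularised-λ′ (In𝒜z⁻²-φ (𝒜⁰⇒𝒜z⁰ (In𝒜⁰-τ∞ i))))))))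

𝓘Δ⇒Confluent : 𝓘Δ ⊆ Confluent
𝓘Δ⇒Confluent (generator (w , w∈ , e)) = let n , s = length-bound w in
  Confluent-resp (≃-sym (pointwise e)) (Δ-Confluent n w s (from-𝒜⁰ {w} w∈))
𝓘Δ⇒Confluent zero         = Confluent-𝟘
𝓘Δ⇒Confluent (plus g h)   = Confluent-⊕ (𝓘Δ⇒Confluent g) (𝓘Δ⇒Confluent h)
𝓘Δ⇒Confluent (absorb {a} i g) = Confluent-ш (from-𝒜⁰ {a} i) (𝓘Δ⇒Confluent g)
𝓘Δ⇒Confluent (resp e g)   = Confluent-resp (pointwise e) (𝓘Δ⇒Confluent g)

theorem28 : 𝓘Δ ⊆ 𝓘CF
theorem28 h = Confluent⇒𝓘CF (𝓘Δ⇒Confluent h)
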